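{- Let $\mathcal{H}$ be a finite family of connected graphs. (i) There exists a constant $c(\mathcal{H})$ such that $\mathrm{inspc}(G)\le c(\mathcal{H})$ for every connected $\mathcal{H}$-free graph $G$ if and only if $\mathcal{H}\le \{K_n,S^*_n,F^{(1)}_n,F^{(2)}_n,F^{(3)}_n\}$ for some integer $n\ge 4$. (ii) There exists a constant $c(\mathcal{H})$ such that $\mathrm{inspp}(G)\le c(\mathcal{H})$ for every connected $\mathcal{H}$-free graph $G$ if and only if $\mathcal{H}\le \{K_n,S^*_n,\tilde S_n,F^{(1)}_n,F^{(2)}_n,F^{(4)}_n,F^{(5)}_n\}$ for some integer $n\ge 4$.
   Context: All graphs are finite, simple, undirected. A graph $G$ is $H$-free if $G$ contains no induced subgraph isomorphic to $H$; for a family $\mathcal{H}$, $G$ is $\mathcal{H}$-free if it is $H$-free for every $H\in\mathcal{H}$. For families $\mathcal{H}_1,\mathcal{H}_2$, write $\mathcal{H}_1\le\mathcal{H}_2$ if every $H_2\in\mathcal{H}_2$ contains an induced subgraph isomorphic to some element of $\mathcal{H}_1$. $K_n$ is the complete graph of order $n$, $K_{1,n}$ the star of order $n+1$, $P_n$ the path of order $n$. An induced SP-cover of $G$ is a family $\mathcal{P}$ of induced subgraphs of $G$, each isomorphic to some $K_{1,m}$ ($m\ge1$) or some $P_m$ ($m\ge1$), with $\bigcup_{P\in\mathcal{P}}V(P)=V(G)$; it is an induced SP-partition if its members are pairwise vertex-disjoint. $\mathrm{inspc}(G)$ (resp. $\mathrm{inspp}(G)$) is the minimum cardinality of an induced SP-cover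 (resp. induced SP-partition) of $G$. For $n\ge2$ let $A=\{x_i,y_i,z_i:1\le i\le n\}$. $S^*_n$: vertex set $A\setminus\{x_i:2\le i\le n\}$, edges $\{x_1y_i,\,y_iz_i:1\le i\le n\}$. $\tilde S_n$: $S^*_n$ plus the edges $x_1z_i$ ($1\le i\le n$). $F^{(1)}_n$: vertex set $A\setminus\{x_i:3\le i\le n\}$, edges $\{x_1x_2,x_1y_1,x_1z_1\}\cup\{y_iy_{i+1},z_iz_{i+1}:1\le i\le n-1\}$. $F^{(2)}_n$: vertex set $A\setminus\{x_i:2\le i\le n\}$, edges $\{x_1y_1,x_1z_1,y_1z_1\}\cup\{y_iy_{i+1},z_iz_{i+1}:1\le i\le n-1\}$. $F^{(3)}_n$: vertex set $A$, edges $\{x_iy_1,x_iz_1:1\le i\le n\}\cup\{y_iy_{i+1},z_iz_{i+1}:1\le i\le n-1\}$. $F^{(4)}_n$: $F^{(3)}_n$ with the vertices $x_i$ ($3\le i\le n$) deleted. $F^{(5)}_n$: $F^{(4)}_n$ plus the edge $x_1x_2$. -}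

module Defs where

open import Data.Nat using (ℕ; zero; suc; _+_; _*_; _∸_; _≤_; _<_; _≡ᵇ_; _<ᵇ_)
open import Data.Bool using (Bool; true; false; not; _∧_; _∨_; if_then_else_)
open import Data.Bool.Properties using (∨-comm)
open import Data.Fin using (Fin; toℕ)
open import Data.Product using (Σ; ∃; ∃-syntax; _×_; _,_)
open import Data.Sum using (_⊎_)
open import Data.Empty using (⊥)
open import Data.List using (List; length; []; _∷_)
open import Data.List.Relation.Unary.All using (All)
open import Data.List.Relation.Unary.Any using (Any)
open import Data.List.Relation.Unary.AllPairs using (AllPairs)
open import Relation.Nullary using (¬_)
open import Relation.Binary.PropositionalEquality using (_≡_; refl; cong₂)
open import Function.Definitions using (Injective)

record Graph : Set where
  field
    size   : ℕ
    adj    : Fin size → Fin size → Bool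
    sym    : ∀ i j → adj i j ≡ adj j i
    irrefl : ∀ i → adj i i ≡ false
open Graph public

≡ᵇ-sym : ∀ m n → (m ≡ᵇ n) ≡ (n ≡ᵇ m)
≡ᵇ-sym zero zero = refl
≡ᵇ-sym zero (suc n) = refl
≡ᵇ-sym (suc m) zero = refl
≡ᵇ-sym (suc m) (suc n) = ≡ᵇ-sym m n

≡ᵇ-refl : ∀ m → (m ≡ᵇ m) ≡ true
≡ᵇ-refl zero = refl
≡ᵇ-refl (suc m) = ≡ᵇ-refl m

mkGraph : (k : ℕ) → (ℕ → ℕ → Bool) → Graph
mkGraph k e = record
  { size = k
  ; adj = A
  ; sym = λ i j → cong₂ (λ a b → not a ∧ b) (≡ᵇ-sym (toℕ i) (toℕ j))
                        (∨-comm (e (toℕ i) (toℕ j)) (e (toℕ j) (toℕ i)))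
  ; irrefl = λ i → cong₂ (λ a b → not a ∧ b) (≡ᵇ-refl (toℕ i))
                        (refl {x = e (toℕ i) (toℕ i) ∨ e (toℕ i) (toℕ i)})
  }
  where
  A : Fin k → Fin k → Bool
  A i j = not (toℕ i ≡ᵇ toℕ j) ∧ (e (toℕ i) (toℕ j) ∨ e (toℕ j) (toℕ i))

data Walk (G : Graph) : Fin (size G) → Fin (size G) → Set where
  here : ∀ {u} → Walk G u u
  step : ∀ {u v w} → adj G u v ≡ true → Walk G v w → Walk G u w

Connected : Graph → Set
Connected G = (0 < size G) × (∀ u v → Walk G u v)

record Embedding (H G : Graph) : Set where
  field
    map  : Fin (size H) → Fin (size G)
    inj  : Injective _≡_ _≡_ map
    pres : ∀ i j → adj G (map i) (map j) ≡ adj H i j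
open Embedding public

Contains : Graph → Graph → Set
Contains G H = Embedding H G

Free : List Graph → Graph → Set
Free ℋ G = All (λ H → ¬ Contains G H) ℋ

_≼_ : List Graph → List Graph → Set
ℋ₁ ≼ ℋ₂ = All (λ H₂ → Any (λ H₁ → Contains H₂ H₁) ℋ₁) ℋ₂

complete : ℕ → Graph
complete n = mkGraph n (λ _ _ → true)

star : ℕ → Graph
star m = mkGraph (suc m) (λ a _ → a ≡ᵇ 0)

path : ℕ → Graph
path m = mkGraph m (λ a b → b ≡ᵇ suc a)

-- Graphs on vertex sets {x_1..x_m} ∪ {y_1..y_n} ∪ {z_1..z_n}
-- (1-based labels), numbered x_i ↦ i-1, y_i ↦ m+i-1, z_i ↦ m+n+i-1.

data Vtx : Set where
  x y z : ℕ → Vtx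

decode : ℕ → ℕ → ℕ → Vtx
decode m n a =
  if a <ᵇ m then x (suc a)
  else if a <ᵇ m + n then y (suc (a ∸ m))
  else z (suc (a ∸ (m + n)))

vtxGraph : (m n : ℕ) → (Vtx → Vtx → Bool) → Graph
vtxGraph m n e = mkGraph (m + (n + n)) (λ a b → e (decode m n a) (decode m n b))

yzPaths : Vtx → Vtx → Bool
yzPaths (y i) (y j) = j ≡ᵇ suc i
yzPaths (z i) (z j) = j ≡ᵇ suc i
yzPaths _ _ = false

eS* : Vtx → Vtx → Bool
eS* (x 1) (y _) = true
eS* (y i) (z j) = i ≡ᵇ j
eS* _ _ = false

S* : ℕ → Graph
S* n = vtxGraph 1 n eS*

eS~ : Vtx → Vtx → Bool
eS~ (x 1) (z _) = true
eS~ u v = eS* u v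

S~ : ℕ → Graph
S~ n = vtxGraph 1 n eS~

eF1 : Vtx → Vtx → Bool
eF1 (x 1) (x 2) = true
eF1 (x 1) (y 1) = true
eF1 (x 1) (z 1) = true
eF1 u v = yzPaths u v

F1 : ℕ → Graph
F1 n = vtxGraph 2 n eF1

eF2 : Vtx → Vtx → Bool
eF2 (x 1) (y 1) = true
eF2 (x 1) (z 1) = true
eF2 (y 1) (z 1) = true
eF2 u v = yzPaths u v

F2 : ℕ → Graph
F2 n = vtxGraph 1 n eF2

eF3 : Vtx → Vtx → Bool
eF3 (x _) (y 1) = true
eF3 (x _) (z 1) = true
eF3 u v = yzPaths u v

F3 : ℕ → Graph
F3 n = vtxGraph n n eF3

F4 : ℕ → Graph
F4 n = vtxGraph 2 n eF3

eF5 : Vtx → Vtx → Bool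
eF5 (x 1) (x 2) = true
eF5 u v = eF3 u v

F5 : ℕ → Graph
F5 n = vtxGraph 2 n eF5

familyI : ℕ → List Graph
familyI n = complete n ∷ S* n ∷ F1 n ∷ F2 n ∷ F3 n ∷ []

familyII : ℕ → List Graph
familyII n = complete n ∷ S* n ∷ S~ n ∷ F1 n ∷ F2 n ∷ F4 n ∷ F5 n ∷ []

data SPShape : Set where
  starS pathS : ℕ → SPShape

shapeGraph : SPShape → Graph
shapeGraph (starS m) = star m
shapeGraph (pathS m) = path m

shapeParam : SPShape → ℕ
shapeParam (starS m) = m
shapeParam (pathS m) = m

record SPPiece (G : Graph) : Set where
  field
    shape : SPShape
    pos   : 1 ≤ shapeParam shape
    emb   : Embedding (shapeGraph shape) G
open SPPiece public

InPiece : {G : Graph} → SPPiece G → Fin (size G) → Set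
InPiece p v = ∃[ i ] map (emb p) i ≡ v

Covers : {G : Graph} → List (SPPiece G) → Set
Covers {G} ps = ∀ v → Any (λ p → InPiece p v) ps

Disjoint : {G : Graph} → SPPiece G → SPPiece G → Set
Disjoint p q = ∀ v → InPiece p v → InPiece q v → ⊥

inspc≤ : Graph → ℕ → Set
inspc≤ G c = ∃[ ps ] (length ps ≤ c) × Covers {G} ps

inspp≤ : Graph → ℕ → Set
inspp≤ G c = ∃[ ps ] (length ps ≤ c) × Covers {G} ps × AllPairs Disjoint ps

{-# OPTIONS --safe #-}

-- Sufficiency.  Let lev be the distance from a root.  A vertex of level i with a neighbour in the
-- middle of a path p with lev (p j) = j is, by F1- and F2-freeness, joined to p (i - 1) and
-- p (i + 1).  Such vertices form bags; consecutive bags are completely joined and no other edge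
-- leaves a bag, so the middle of p is a blown-up path, a strand.  Balls of bounded radius are
-- dominated by boundedly many vertices, since a minimal dominating set has private neighbours
-- and Ramsey turns these into K_n or an induced S*_n.  Hence boundedly many vertices dominate G
-- apart from boundedly many strands.
-- For covers, F3-freeness bounds the bags, so a strand is covered by few paths, and a dominated
-- part by few stars once neighbourhoods have bounded chromatic number; this follows by induction
-- on the clique number, as the decomposition dominates every level by few vertices.
-- For partitions, F4- and F5-freeness make the bags trivial, so strands are disjoint paths, and
-- S~-freeness partitions a dominated part into few stars, again by induction on the clique number.
--
-- Necessity.  K_n, S*_n and S~_n need many pieces themselves.  For the F's, string many copies
-- together at large distance; a small connected graph in such a chain sees at most one copy.
-- Each piece passes only partly through at most two copies, so among many copies there is one
-- through which all pieces meeting it pass completely, which few pieces cannot do.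
module Submission where

open import Defs
open import Data.Nat
open import Data.Nat.Properties
open import Data.Bool as Bool using (Bool; true; false; _∧_; _∨_; not; if_then_else_; T)
open import Data.Bool.Properties as Boolₚ using (∨-comm; ∨-identityʳ; ∨-zeroʳ; ∧-zeroʳ)
open import Data.Fin as Fin using (Fin; toℕ; fromℕ<)
import Data.Fin.Properties as Finₚ
open import Data.Product using (Σ; ∃; ∃-syntax; _×_; _,_; proj₁; proj₂)
open import Data.Sum as Sum using (_⊎_; inj₁; inj₂; [_,_]′; map₂)
open import Data.Empty using (⊥; ⊥-elim)
open import Data.Unit using (tt)
open import Data.List as List using (List; []; _∷_; length; filter; lookup; allFin; _++_; concatMap)
import Data.List.Properties as Listₚ
open import Data.List.Relation.Unary.All as All using (All; []; _∷_)
import Data.List.Relation.Unary.All.Properties as Allₚ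
open import Data.List.Relation.Unary.Any as Any using (Any; here; there)
import Data.List.Relation.Unary.Any.Properties as Anyₚ
open import Data.List.Relation.Unary.AllPairs as AllPairs using (AllPairs; []; _∷_)
import Data.List.Relation.Unary.AllPairs.Properties as AllPairsₚ
open import Data.List.Relation.Unary.Unique.Propositional using (Unique)
import Data.List.Relation.Unary.Unique.Propositional.Properties as Uniqueₚ
open import Data.List.Membership.Propositional using (_∈_; find; lose)
open import Data.List.Membership.Propositional.Properties using (∈-filter⁺; ∈-filter⁻; ∈-allFin; ∈-lookup; ∈-map⁺; ∈-cartesianProduct⁺)
open import Data.List.Relation.Binary.Sublist.Propositional using (_⊆_; []; _∷_; _∷ʳ_; ⊆-trans; minimum)
import Data.List.Relation.Binary.Sublist.Propositional.Properties as Sublistₚ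
open import Data.Vec as Vec using (Vec)
open import Data.Vec.Properties using (lookup∘tabulate)
open import Function using (_∘_; id)
open import Function.Bundles using (_⇔_; mk⇔)
open import Relation.Nullary using (¬_; Dec; yes; no; contradiction)
open import Relation.Nullary.Decidable using (_×-dec_; _⊎-dec_; ¬?; map′; decidable-stable; _→-dec_)
open import Relation.Unary using (Decidable)
open import Relation.Binary using (tri<; tri≈; tri>)
open import Relation.Binary.PropositionalEquality as ≡ using (_≡_; _≢_; refl; cong; cong₂; subst; trans)
open import Level using (Level)
open import Data.List.Extrema ≤-totalOrder using (argmax; argmax-all; f[⊥]≤f[argmax]; f[xs]≤f[argmax])
open import Data.List.Relation.Unary.Unique.DecPropositional.Properties using (deduplicate-!)

-- Ramsey's theorem for lists

-- The structural lemmas hold only in the middle of a level path, since F1 and F2 need n spare path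
-- vertices on each side of an attachment. The levels near the root and those around the tip of a
-- strand are therefore dominated separately; constants such as `3 + n` and `7 + n + n` measure this
-- loss. The number of strands is bounded because one is chosen per dominator of a ball about the
-- root: if the ancestors of two deep vertices at level 3 + n are near the same dominator, closure
-- of bags carries the tree path of the shallower one into the bags of the deeper, down to the last
-- levels. Taking a deepest vertex makes the path long enough. Partitions also need disjoint
-- strands, so the tip of a strand is made a function of its ancestor at level 3 + n. In the
-- converse one n is the order of the complete graph, the length of a block and the number of
-- blocks, so it depends on c and on the sizes of the members of ℋ. Chains for F1 and F2 have many
-- simplicial vertices, at most two of which fit into a piece; counting the gaps that a piece passes
-- through serves F3, F4 and F5.

ramsey : ℕ → ℕ → ℕ
ramsey zero    b       = 0
ramsey (suc a) zero    = 0
ramsey (suc a) (suc b) = suc (ramsey a (suc b) + ramsey (suc a) b)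

module _ {A : Set} where

  All-resp-⊆ : {P : A → Set} {us vs : List A} → us ⊆ vs → All P vs → All P us
  All-resp-⊆ []         []         = []
  All-resp-⊆ (_ ∷ʳ s)   (_ ∷ ps)   = All-resp-⊆ s ps
  All-resp-⊆ (refl ∷ s) (p ∷ ps)   = p ∷ All-resp-⊆ s ps

  AllPairs-resp-⊆ : {R : A → A → Set} {us vs : List A} → us ⊆ vs → AllPairs R vs → AllPairs R us
  AllPairs-resp-⊆ []         []       = []
  AllPairs-resp-⊆ (_ ∷ʳ s)   (_ ∷ ps) = AllPairs-resp-⊆ s ps
  AllPairs-resp-⊆ (refl ∷ s) (p ∷ ps) = All-resp-⊆ s p ∷ AllPairs-resp-⊆ s ps

  Homogeneous : (A → A → Set) → ℕ → List A → Set
  Homogeneous R a us = ∃[ vs ] (vs ⊆ us) × (length vs ≡ a) × AllPairs R vs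

  length-filter-split : {P : A → Set} (P? : Decidable P) (us : List A) →
    length us ≡ length (filter P? us) + length (filter (¬? ∘ P?) us)
  length-filter-split P? [] = refl
  length-filter-split P? (u ∷ us) with P? u
  ... | yes _ = cong suc (length-filter-split P? us)
  ... | no  _ = trans (cong suc (length-filter-split P? us)) (≡.sym (+-suc _ _))

  -- The head splits the tail into the entries related to it and the others. The recursion for
  -- `ramsey` makes one part long enough, and the head extends one of the two outcomes there.
  -- Results are sublists so that facts about all entries or all pairs, such as distinctness,
  -- restrict to them.
  ramsey-list : {R : A → A → Set} (R? : ∀ u v → Dec (R u v)) → ∀ a b us → ramsey a b ≤ length us →
    Homogeneous R a us ⊎ Homogeneous (λ u v → ¬ R u v) b us
  ramsey-list R? zero b us _ = inj₁ ([] , minimum us , refl , [])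
  ramsey-list R? (suc a) zero us _ = inj₂ ([] , minimum us , refl , [])
  ramsey-list {R} R? (suc a) (suc b) (u ∷ us) (s≤s h)
    with ramsey a (suc b) ≤? length (filter (R? u) us)
  ... | yes big with ramsey-list R? a (suc b) (filter (R? u) us) big
  ...   | inj₁ (vs , vs⊆ , len , hom) =
            inj₁ (u ∷ vs , refl ∷ ⊆-trans vs⊆ (Sublistₚ.filter-⊆ (R? u) us) , cong suc len
                 , All-resp-⊆ vs⊆ (Allₚ.all-filter (R? u) us) ∷ hom)
  ...   | inj₂ (vs , vs⊆ , len , hom) =
            inj₂ (vs , u ∷ʳ ⊆-trans vs⊆ (Sublistₚ.filter-⊆ (R? u) us) , len , hom)
  ramsey-list {R} R? (suc a) (suc b) (u ∷ us) (s≤s h) | no small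
    with ramsey-list R? (suc a) b (filter (¬? ∘ R? u) us)
           (+-cancelˡ-≤ (ramsey a (suc b)) _ _
             (≤-trans h (≤-trans (≤-reflexive (length-filter-split (R? u) us))
               (+-monoˡ-≤ _ (≰⇒≥ small)))))
  ...   | inj₁ (vs , vs⊆ , len , hom) =
            inj₁ (vs , u ∷ʳ ⊆-trans vs⊆ (Sublistₚ.filter-⊆ (¬? ∘ R? u) us) , len , hom)
  ...   | inj₂ (vs , vs⊆ , len , hom) =
            inj₂ (u ∷ vs , refl ∷ ⊆-trans vs⊆ (Sublistₚ.filter-⊆ (¬? ∘ R? u) us) , cong suc len
                 , All-resp-⊆ vs⊆ (Allₚ.all-filter (¬? ∘ R? u) us) ∷ hom)

  lookup-AllPairs : {R : A → A → Set} {us : List A} → AllPairs R us →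
    ∀ i j → i Fin.< j → R (lookup us i) (lookup us j)
  lookup-AllPairs (p ∷ _) Fin.zero    (Fin.suc j) _         = All.lookup p (∈-lookup j)
  lookup-AllPairs (_ ∷ p) (Fin.suc i) (Fin.suc j) (s≤s i<j) = lookup-AllPairs p i j i<j

  lookup-injective : {us : List A} → Unique us → ∀ i j → lookup us i ≡ lookup us j → i ≡ j
  lookup-injective p i j eq with Finₚ.<-cmp i j
  ... | tri< i<j _ _ = contradiction eq (lookup-AllPairs p i j i<j)
  ... | tri≈ _ i≡j _ = i≡j
  ... | tri> _ _ j<i = contradiction (≡.sym eq) (lookup-AllPairs p j i j<i)

  -- A total lookup with a default value, so that a list can serve as one of the functions from ℕ to
  -- vertices that `embed-xyz` takes.
  nth : A → List A → ℕ → A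
  nth d []       _       = d
  nth d (u ∷ us) zero    = u
  nth d (u ∷ us) (suc i) = nth d us i

  nth-All : {P : A → Set} {d : A} {us : List A} → All P us → ∀ i → i < length us → P (nth d us i)
  nth-All (p ∷ ps) zero    _         = p
  nth-All (p ∷ ps) (suc i) (s≤s i<) = nth-All ps i i<

  -- Past the end of the list the default is met. The transversal paths of the cover rely on this
  -- where a bag has fewer vertices than there are paths.
  nth-total : {P : A → Set} {d : A} {us : List A} → P d → All P us → ∀ i → P (nth d us i)
  nth-total d []       i       = d
  nth-total d (p ∷ ps) zero    = p
  nth-total d (p ∷ ps) (suc i) = nth-total d ps i

  nth-AllPairs : {R : A → A → Set} {d : A} {us : List A} → AllPairs R us →
    ∀ i j → i < j → j < length us → R (nth d us i) (nth d us j)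
  nth-AllPairs (p ∷ ps) zero    (suc j) _         (s≤s j<) = nth-All p j j<
  nth-AllPairs (p ∷ ps) (suc i) (suc j) (s≤s i<j) (s≤s j<) = nth-AllPairs ps i j i<j j<

  nth-∈ : {d u : A} {us : List A} → u ∈ us → ∃[ i ] (i < length us) × nth d us i ≡ u
  nth-∈ (here eq) = 0 , s≤s z≤n , ≡.sym eq
  nth-∈ (there u∈) with nth-∈ u∈
  ... | i , i< , eq = suc i , s≤s i< , eq

-- Boolean equality, adjacency and cliques

suc-pred-pos : ∀ {m k} → k < m → suc (pred m) ≡ m
suc-pred-pos (s≤s _) = refl

≡ᵇ-true : ∀ {m n} → m ≡ n → (m ≡ᵇ n) ≡ true
≡ᵇ-true {m} refl = ≡ᵇ-refl m

≡ᵇ-false : ∀ {m n} → m ≢ n → (m ≡ᵇ n) ≡ false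
≡ᵇ-false {m} {n} m≢n with m ≡ᵇ n in eq
... | true  = contradiction (≡ᵇ⇒≡ m n (subst T (≡.sym eq) tt)) m≢n
... | false = refl

true⇒≡ : ∀ {m n} → (m ≡ᵇ n) ≡ true → m ≡ n
true⇒≡ {m} {n} eq = ≡ᵇ⇒≡ m n (subst T (≡.sym eq) tt)

module Adjacency (G : Graph) where

  V : Set
  V = Fin (size G)

  infix 4 _~_ _~?_

  _~_ : V → V → Set
  u ~ v = adj G u v ≡ true

  _~?_ : ∀ u v → Dec (u ~ v)
  u ~? v = adj G u v Boolₚ.≟ true

  ~-sym : ∀ {u v} → u ~ v → v ~ u
  ~-sym {u} {v} e = trans (Graph.sym G v u) e

  ~⇒≢ : ∀ {u v} → u ~ v → u ≢ v
  ~⇒≢ {u} e refl with () ← trans (≡.sym e) (irrefl G u)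

  ≁⇒false : ∀ {u v} → ¬ u ~ v → adj G u v ≡ false
  ≁⇒false = Boolₚ.¬-not

  false⇒≁ : ∀ {u v} → adj G u v ≡ false → ¬ u ~ v
  false⇒≁ eq e with () ← trans (≡.sym e) eq

  clique : (us : List V) → AllPairs _~_ us → Contains G (complete (length us))
  clique us h = record { map = lookup us ; inj = λ {i} {j} → lookup-injective (AllPairs.map ~⇒≢ h) i j ; pres = λ i j → pr h i j }
    where
    pr : ∀ {us} → AllPairs _~_ us → ∀ i j →
      adj G (lookup us i) (lookup us j) ≡ adj (complete (length us)) i j
    pr {us} p i j with Finₚ.<-cmp i j
    ... | tri< i<j i≢j _ rewrite ≡ᵇ-false (i≢j ∘ Finₚ.toℕ-injective) = lookup-AllPairs p i j i<j
    ... | tri≈ _ refl _ rewrite ≡ᵇ-refl (toℕ i) = irrefl G _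
    ... | tri> _ i≢j j<i rewrite ≡ᵇ-false (i≢j ∘ Finₚ.toℕ-injective) = ~-sym (lookup-AllPairs p j i j<i)

  ramsey-indep : ∀ a b → ¬ Contains G (complete a) → (us : List V) → ramsey a b ≤ length us →
    Homogeneous (λ u v → ¬ u ~ v) b us
  ramsey-indep a b kfree us h with ramsey-list _~?_ a b us h
  ... | inj₁ (vs , _ , refl , hom) = contradiction (clique vs hom) kfree
  ... | inj₂ r = r

Contains-trans : ∀ {G H K} → Contains G H → Contains H K → Contains G K
Contains-trans f g = record
  { map  = map f ∘ map g
  ; inj  = inj g ∘ inj f
  ; pres = λ i j → trans (pres f _ _) (pres g i j) }

-- The forbidden graphs

<ᵇ-true : ∀ {m n} → m < n → (m <ᵇ n) ≡ true
<ᵇ-true {m} {n} m<n with m <ᵇ n in eq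
... | true  = refl
... | false = ⊥-elim (subst T eq (<⇒<ᵇ m<n))

<ᵇ-false : ∀ {m n} → n ≤ m → (m <ᵇ n) ≡ false
<ᵇ-false {m} {n} n≤m with m <ᵇ n in eq
... | true  = contradiction (<ᵇ⇒< m n (subst T (≡.sym eq) tt)) (≤⇒≯ n≤m)
... | false = refl

data Valid (m n : ℕ) : Vtx → Set where
  vx : ∀ {i} → i < m → Valid m n (x (suc i))
  vy : ∀ {i} → i < n → Valid m n (y (suc i))
  vz : ∀ {i} → i < n → Valid m n (z (suc i))

module Coding (m n : ℕ) where

  encode : Vtx → ℕ
  encode (x i) = pred i
  encode (y i) = m + pred i
  encode (z i) = m + n + pred i

  decode-x : ∀ {a} → a < m → decode m n a ≡ x (suc a)
  decode-x a<m rewrite <ᵇ-true a<m = refl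

  decode-y : ∀ {i} → i < n → decode m n (m + i) ≡ y (suc i)
  decode-y {i} i<n rewrite <ᵇ-false {m + i} {m} (m≤m+n m i) | <ᵇ-true (+-monoʳ-< m i<n) | m+n∸m≡n m i = refl

  decode-z : ∀ {i} → decode m n (m + n + i) ≡ z (suc i)
  decode-z {i} rewrite <ᵇ-false {m + n + i} {m} (≤-trans (m≤m+n m n) (m≤m+n (m + n) i))
                     | <ᵇ-false {m + n + i} {m + n} (m≤m+n (m + n) i) | m+n∸m≡n (m + n) i = refl

  decode-encode : ∀ {u} → Valid m n u → decode m n (encode u) ≡ u
  decode-encode (vx i<) = decode-x i<
  decode-encode (vy i<) = decode-y i<
  decode-encode (vz i<) = decode-z

  encode-< : ∀ {u} → Valid m n u → encode u < m + (n + n)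
  encode-< (vx i<) = ≤-trans i< (m≤m+n m _)
  encode-< (vy i<) = +-monoʳ-< m (≤-trans i< (m≤m+n n n))
  encode-< (vz {i} i<) = subst (_< m + (n + n)) (≡.sym (+-assoc m n i)) (+-monoʳ-< m (+-monoʳ-< n i<))

  decoded : ∀ a → a < m + (n + n) → ∃[ u ] Valid m n u × encode u ≡ a
  decoded a a< with a <? m
  ... | yes a<m = x (suc a) , vx a<m , refl
  ... | no a≮m with a ∸ m <? n
  ...   | yes i<n = y (suc (a ∸ m)) , vy i<n , m+[n∸m]≡n (≮⇒≥ a≮m)
  ...   | no i≮n = z (suc (a ∸ (m + n))) , vz i<n , m+[n∸m]≡n m+n≤a
    where
    m+n≤a : m + n ≤ a
    m+n≤a = subst (m + n ≤_) (m+[n∸m]≡n (≮⇒≥ a≮m)) (+-monoʳ-≤ m (≮⇒≥ i≮n))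
    i<n : a ∸ (m + n) < n
    i<n = +-cancelˡ-< (m + n) _ _ (≡.subst₂ _<_ (≡.sym (m+[n∸m]≡n m+n≤a)) (≡.sym (+-assoc m n n)) a<)

  decode-valid : ∀ {a} → a < m + (n + n) → Valid m n (decode m n a)
  decode-valid a< with decoded _ a<
  ... | u , val , refl = subst (Valid m n) (≡.sym (decode-encode val)) val

  encode-decode : ∀ {a} → a < m + (n + n) → encode (decode m n a) ≡ a
  encode-decode a< with decoded _ a<
  ... | u , val , refl = cong encode (decode-encode val)

  label : Fin (m + (n + n)) → Vtx
  label a = decode m n (toℕ a)

  label-valid : ∀ a → Valid m n (label a)
  label-valid a = decode-valid (Finₚ.toℕ<n a)

  label-inj : ∀ {a b} → label a ≡ label b → a ≡ b
  label-inj {a} {b} eq = Finₚ.toℕ-injective (trans (≡.sym (encode-decode (Finₚ.toℕ<n a)))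
    (trans (cong encode eq) (encode-decode (Finₚ.toℕ<n b))))

  vertex : ∀ {u} → Valid m n u → Fin (m + (n + n))
  vertex val = fromℕ< (encode-< val)

  label-vertex : ∀ {u} (val : Valid m n u) → label (vertex val) ≡ u
  label-vertex val = trans (cong (decode m n) (Finₚ.toℕ-fromℕ< (encode-< val))) (decode-encode val)

  module _ (e : Vtx → Vtx → Bool) where

    adj-vtx : ∀ a b → a ≢ b → adj (vtxGraph m n e) a b ≡ e (label a) (label b) ∨ e (label b) (label a)
    adj-vtx a b a≢b rewrite ≡ᵇ-false (a≢b ∘ Finₚ.toℕ-injective) = refl

    embed-vtx : (G : Graph) (φ : Vtx → Fin (size G)) →
      (∀ {u v} → Valid m n u → Valid m n v → u ≢ v →
         (φ u ≢ φ v) × adj G (φ u) (φ v) ≡ e u v ∨ e v u) →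
      Contains G (vtxGraph m n e)
    embed-vtx G φ ok = record { map = φ ∘ label ; inj = λ {a} {b} → φ-inj a b ; pres = φ-pres }
      where
      distinct : ∀ {a b} → a ≢ b → _
      distinct {a} {b} a≢b = ok (label-valid a) (label-valid b) (a≢b ∘ label-inj)
      φ-inj : ∀ a b → φ (label a) ≡ φ (label b) → a ≡ b
      φ-inj a b eq with a Finₚ.≟ b
      ... | yes a≡b = a≡b
      ... | no  a≢b = contradiction eq (proj₁ (distinct a≢b))
      φ-pres : ∀ a b → adj G (φ (label a)) (φ (label b)) ≡ adj (vtxGraph m n e) a b
      φ-pres a b with a Finₚ.≟ b
      ... | yes refl = trans (irrefl G _) (≡.sym (irrefl (vtxGraph m n e) a))
      ... | no  a≢b  = trans (proj₂ (distinct a≢b)) (≡.sym (adj-vtx a b a≢b))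

    embed-into-vtx : (H : Graph) (f : Fin (size H) → Vtx) → (∀ i → Valid m n (f i)) →
      (∀ i j → f i ≡ f j → i ≡ j) →
      (∀ i j → i ≢ j → e (f i) (f j) ∨ e (f j) (f i) ≡ adj H i j) →
      Contains (vtxGraph m n e) H
    embed-into-vtx H f val f-inj f-adj = record
      { map = g ; inj = λ {i} {j} eq → f-inj i j (trans (≡.sym (lab i)) (trans (cong label eq) (lab j))) ; pres = pr }
      where
      g : Fin (size H) → Fin (m + (n + n))
      g i = vertex (val i)
      lab : ∀ i → label (g i) ≡ f i
      lab i = label-vertex (val i)
      pr : ∀ i j → adj (vtxGraph m n e) (g i) (g j) ≡ adj H i j
      pr i j with i Finₚ.≟ j
      ... | yes refl = trans (irrefl (vtxGraph m n e) (g i)) (≡.sym (irrefl H i))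
      ... | no i≢j = trans (adj-vtx (g i) (g j)
                (λ eq → i≢j (f-inj i j (trans (≡.sym (lab i)) (trans (cong label eq) (lab j))))))
              (trans (cong₂ (λ u v → e u v ∨ e v u) (lab i) (lab j)) (f-adj i j i≢j))

-- The six unordered pairs of vertex kinds suffice, by symmetry of adjacency.
embed-xyz : ∀ m n e (G : Graph) (X Y Z : ℕ → Fin (size G)) →
  let OK : Vtx → Vtx → Fin (size G) → Fin (size G) → Set
      OK u v a b = (a ≢ b) × adj G a b ≡ e u v ∨ e v u
  in
  (∀ i j → i < j → j < m → OK (x (suc i)) (x (suc j)) (X i) (X j)) →
  (∀ i j → i < m → j < n → OK (x (suc i)) (y (suc j)) (X i) (Y j)) →
  (∀ i j → i < m → j < n → OK (x (suc i)) (z (suc j)) (X i) (Z j)) →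
  (∀ i j → i < j → j < n → OK (y (suc i)) (y (suc j)) (Y i) (Y j)) →
  (∀ i j → i < n → j < n → OK (y (suc i)) (z (suc j)) (Y i) (Z j)) →
  (∀ i j → i < j → j < n → OK (z (suc i)) (z (suc j)) (Z i) (Z j)) →
  Contains G (vtxGraph m n e)
embed-xyz m n e G X Y Z xx xy xz yy yz zz = Coding.embed-vtx m n e G φ ok
  where
  φ : Vtx → Fin (size G)
  φ (x i) = X (pred i)
  φ (y i) = Y (pred i)
  φ (z i) = Z (pred i)
  OK : Vtx → Vtx → Set
  OK u v = (φ u ≢ φ v) × adj G (φ u) (φ v) ≡ e u v ∨ e v u
  flip : ∀ {u v} → OK u v → OK v u
  flip {u} {v} (ne , ad) = ne ∘ ≡.sym , trans (Graph.sym G _ _) (trans ad (∨-comm (e u v) (e v u)))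
  ok : ∀ {u v} → Valid m n u → Valid m n v → u ≢ v → OK u v
  ok (vx {i} p) (vx {j} q) ne with <-cmp i j
  ... | tri< i<j _ _ = xx i j i<j q
  ... | tri≈ _ refl _ = contradiction refl ne
  ... | tri> _ _ j<i = flip {x (suc j)} {x (suc i)} (xx j i j<i p)
  ok (vx p) (vy q) ne = xy _ _ p q
  ok (vx p) (vz q) ne = xz _ _ p q
  ok (vy {i} p) (vx {j} q) ne = flip {x (suc j)} {y (suc i)} (xy _ _ q p)
  ok (vy {i} p) (vy {j} q) ne with <-cmp i j
  ... | tri< i<j _ _ = yy i j i<j q
  ... | tri≈ _ refl _ = contradiction refl ne
  ... | tri> _ _ j<i = flip {y (suc j)} {y (suc i)} (yy j i j<i p)
  ok (vy p) (vz q) ne = yz _ _ p q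
  ok (vz {i} p) (vx {j} q) ne = flip {x (suc j)} {z (suc i)} (xz _ _ q p)
  ok (vz {i} p) (vy {j} q) ne = flip {y (suc j)} {z (suc i)} (yz _ _ q p)
  ok (vz {i} p) (vz {j} q) ne with <-cmp i j
  ... | tri< i<j _ _ = zz i j i<j q
  ... | tri≈ _ refl _ = contradiction refl ne
  ... | tri> _ _ j<i = flip {z (suc j)} {z (suc i)} (zz j i j<i p)

-- F1, …, F5 share one shape: a bag of x's (a clique iff γ) between two paths; all of the bag
-- (δ) or only x 1 is joined to y 1 and z 1, and η tells whether y 1 and z 1 are joined.
gadget : (γ δ η : Bool) → Vtx → Vtx → Bool
gadget γ δ η (x i) (x j) = γ
gadget γ δ η (x i) (y j) = (δ ∨ (i ≡ᵇ 1)) ∧ (j ≡ᵇ 1)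
gadget γ δ η (x i) (z j) = (δ ∨ (i ≡ᵇ 1)) ∧ (j ≡ᵇ 1)
gadget γ δ η (y i) (x j) = (δ ∨ (j ≡ᵇ 1)) ∧ (i ≡ᵇ 1)
gadget γ δ η (y i) (y j) = (j ≡ᵇ suc i) ∨ (i ≡ᵇ suc j)
gadget γ δ η (y i) (z j) = η ∧ ((i ≡ᵇ 1) ∧ (j ≡ᵇ 1))
gadget γ δ η (z i) (x j) = (δ ∨ (j ≡ᵇ 1)) ∧ (i ≡ᵇ 1)
gadget γ δ η (z i) (y j) = η ∧ ((j ≡ᵇ 1) ∧ (i ≡ᵇ 1))
gadget γ δ η (z i) (z j) = (j ≡ᵇ suc i) ∨ (i ≡ᵇ suc j)

-- Agreement is asked only of distinct valid labels and after symmetrising `e`: the edge relations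
-- of the statement are oriented, whereas `gadget` is symmetric and constant on pairs of x's.
HasShape : (γ δ η : Bool) (B n : ℕ) → (Vtx → Vtx → Bool) → Set
HasShape γ δ η B n e = ∀ {u v} → Valid B n u → Valid B n v → u ≢ v → e u v ∨ e v u ≡ gadget γ δ η u v

has-shape : ∀ {γ δ η B n} (e : Vtx → Vtx → Bool) →
  (∀ i j → i < j → j < B → e (x (suc i)) (x (suc j)) ∨ e (x (suc j)) (x (suc i)) ≡ γ) →
  (∀ i j → i < B → e (x (suc i)) (y (suc j)) ∨ e (y (suc j)) (x (suc i)) ≡ (δ ∨ (i ≡ᵇ 0)) ∧ (j ≡ᵇ 0)) →
  (∀ i j → i < B → e (x (suc i)) (z (suc j)) ∨ e (z (suc j)) (x (suc i)) ≡ (δ ∨ (i ≡ᵇ 0)) ∧ (j ≡ᵇ 0)) →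
  (∀ i j → e (y (suc i)) (y (suc j)) ∨ e (y (suc j)) (y (suc i)) ≡ (j ≡ᵇ suc i) ∨ (i ≡ᵇ suc j)) →
  (∀ i j → e (y (suc i)) (z (suc j)) ∨ e (z (suc j)) (y (suc i)) ≡ η ∧ ((i ≡ᵇ 0) ∧ (j ≡ᵇ 0))) →
  (∀ i j → e (z (suc i)) (z (suc j)) ∨ e (z (suc j)) (z (suc i)) ≡ (j ≡ᵇ suc i) ∨ (i ≡ᵇ suc j)) →
  HasShape γ δ η B n e
has-shape e xx xy xz yy yz zz = agree
  where
  swap : ∀ {u v b} → e u v ∨ e v u ≡ b → e v u ∨ e u v ≡ b
  swap {u} {v} eq = trans (∨-comm (e v u) (e u v)) eq
  agree : HasShape _ _ _ _ _ e
  agree (vx {i} p) (vx {j} q) ne with <-cmp i j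
  ... | tri< i<j _ _ = xx i j i<j q
  ... | tri≈ _ refl _ = contradiction refl ne
  ... | tri> _ _ j<i = swap {x (suc j)} (xx j i j<i p)
  agree (vx p) (vy _) ne = xy _ _ p
  agree (vx p) (vz _) ne = xz _ _ p
  agree (vy {i} _) (vx {j} q) ne = swap {x (suc j)} (xy j i q)
  agree (vy _) (vy _) ne = yy _ _
  agree (vy _) (vz _) ne = yz _ _
  agree (vz {i} _) (vx {j} q) ne = swap {x (suc j)} (xz j i q)
  agree (vz {i} _) (vy {j} _) ne = swap {y (suc j)} (yz j i)
  agree (vz _) (vz _) ne = zz _ _

pair-only : {P : ℕ → ℕ → Set} → P 0 1 → ∀ i j → i < j → j < 2 → P i j
pair-only p zero    (suc zero)    _         _ = p
pair-only p _       (suc (suc _)) _         (s≤s (s≤s ()))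
pair-only p (suc _) (suc zero)    (s≤s ())  _

F1-shape : ∀ n → HasShape true false false 2 n eF1
F1-shape n = has-shape eF1 (pair-only refl)
  (λ { zero zero _ → refl ; zero (suc _) _ → refl ; (suc _) _ _ → refl })
  (λ { zero zero _ → refl ; zero (suc _) _ → refl ; (suc _) _ _ → refl })
  (λ _ _ → refl) (λ _ _ → refl) (λ _ _ → refl)

F2-shape : ∀ n → HasShape false true true 1 n eF2
F2-shape n = has-shape eF2 (λ { _ zero () _ ; _ (suc _) _ (s≤s ()) })
  (λ { zero zero _ → refl ; zero (suc _) _ → refl ; (suc _) _ (s≤s ()) })
  (λ { zero zero _ → refl ; zero (suc _) _ → refl ; (suc _) _ (s≤s ()) })
  (λ { zero zero → refl ; zero (suc _) → refl ; (suc _) zero → refl ; (suc _) (suc _) → refl })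
  (λ { zero zero → refl ; zero (suc _) → refl ; (suc _) _ → refl })
  (λ _ _ → refl)

-- `B` is kept free because F3 and F4 differ only in the number of x's.
F3-shape : ∀ B n → HasShape false true false B n eF3
F3-shape B n = has-shape eF3 (λ _ _ _ _ → refl)
  (λ { _ zero _ → refl ; _ (suc _) _ → refl })
  (λ { _ zero _ → refl ; _ (suc _) _ → refl })
  (λ _ _ → refl) (λ _ _ → refl) (λ _ _ → refl)

F5-shape : ∀ n → HasShape true true false 2 n eF5
F5-shape n = has-shape eF5 (pair-only refl)
  (λ { zero zero _ → refl ; zero (suc _) _ → refl ; (suc _) zero _ → refl ; (suc _) (suc _) _ → refl })
  (λ { zero zero _ → refl ; zero (suc _) _ → refl ; (suc _) zero _ → refl ; (suc _) (suc _) _ → refl })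
  (λ _ _ → refl) (λ _ _ → refl) (λ _ _ → refl)

-- Levels and level paths

least : {P : ℕ → Set} → Decidable P → ∀ k → P k → ∃[ m ] P m × (∀ j → j < m → ¬ P j)
least P? zero p = 0 , p , λ _ ()
least P? (suc k) p with P? 0
... | yes p₀ = 0 , p₀ , λ _ ()
... | no ¬p₀ with least (P? ∘ suc) k p
...   | m , pm , below = suc m , pm , λ { zero _ → ¬p₀ ; (suc j) (s≤s j<) → below j j< }

module Distance (G : Graph) where
  open Adjacency G

  -- Walks grow at their far end, so a vertex at distance exactly suc m carries a predecessor at
  -- distance m, the future parent.
  Within : ℕ → V → V → Set
  Within zero    q v = q ≡ v
  Within (suc k) q v = Within k q v ⊎ (∃[ u ] Within k q u × u ~ v)

  within? : ∀ k q v → Dec (Within k q v)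
  within? zero    q v = q Finₚ.≟ v
  within? (suc k) q v = within? k q v ⊎-dec Finₚ.any? (λ u → within? k q u ×-dec (u ~? v))

  within-mono : ∀ {k l q v} → k ≤ l → Within k q v → Within l q v
  within-mono {l = zero}  z≤n w = w
  within-mono {k} {suc l} k≤ w with m≤n⇒m<n∨m≡n k≤
  ... | inj₁ (s≤s k≤l) = inj₁ (within-mono k≤l w)
  ... | inj₂ refl = w

  within-cons : ∀ k {u q v} → u ~ q → Within k q v → Within (suc k) u v
  within-cons zero    e refl = inj₂ (_ , refl , e)
  within-cons (suc k) e (inj₁ w) = inj₁ (within-cons k e w)
  within-cons (suc k) e (inj₂ (t , w , e′)) = inj₂ (t , within-cons k e w , e′)

  walk⇒within : ∀ {u v} → Walk G u v → ∃[ k ] Within k u v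
  walk⇒within here = 0 , refl
  walk⇒within (step e w) with walk⇒within w
  ... | k , wi = suc k , within-cons k e wi

  -- A breadth-first tree, reduced to what the later arguments use. `parent` is total: on level 0
  -- `pred` keeps the level, and adjacency to the parent is promised only from level 1 on.
  record Levelling : Set where
    field
      root       : V
      lev        : V → ℕ
      lev-within : ∀ v → Within (lev v) root v
      lev-step   : ∀ {u v} → u ~ v → lev v ≤ suc (lev u)
      parent     : V → V
      lev-parent : ∀ v → lev (parent v) ≡ pred (lev v)
      parent-~   : ∀ v {k} → lev v ≡ suc k → parent v ~ v

  levelling : Connected G → V → Levelling
  levelling (_ , conn) r = record
    { root = r ; lev = lev ; lev-within = λ v → proj₁ (proj₂ (dist v)) ; lev-step = lev-step
    ; parent = parent ; lev-parent = lev-parent ; parent-~ = parent-~ }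
    where
    dist : ∀ v → ∃[ m ] Within m r v × (∀ j → j < m → ¬ Within j r v)
    dist v = let (k , w) = walk⇒within (conn r v) in least (λ j → within? j r v) k w
    lev : V → ℕ
    lev v = proj₁ (dist v)
    lev-≤ : ∀ {k v} → Within k r v → lev v ≤ k
    lev-≤ {k} {v} w = ≮⇒≥ (λ k<lev → proj₂ (proj₂ (dist v)) k k<lev w)
    lev-step : ∀ {u v} → u ~ v → lev v ≤ suc (lev u)
    lev-step {u} e = lev-≤ (inj₂ (u , proj₁ (proj₂ (dist u)) , e))
    pre : ∀ v → ∃[ u ] (lev u ≡ pred (lev v)) × (∀ {k} → lev v ≡ suc k → u ~ v)
    pre v with dist v in eq
    ... | zero , _ = v , cong proj₁ eq , λ ()
    ... | suc m , inj₁ w , below = contradiction w (below m ≤-refl)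
    ... | suc m , inj₂ (u , w , e) , _ =
      u , ≤-antisym (lev-≤ w) (s≤s⁻¹ (≤-trans (≤-reflexive (≡.sym (cong proj₁ eq))) (lev-step e))) , λ _ → e
    parent : V → V
    parent v = proj₁ (pre v)
    lev-parent : ∀ v → lev (parent v) ≡ pred (lev v)
    lev-parent v = proj₁ (proj₂ (pre v))
    parent-~ : ∀ v {k} → lev v ≡ suc k → parent v ~ v
    parent-~ v = proj₂ (proj₂ (pre v))

≡ᵇ-cong : ∀ {a b c d} → (a ≡ b → c ≡ d) → (c ≡ d → a ≡ b) → (a ≡ᵇ b) ≡ (c ≡ᵇ d)
≡ᵇ-cong {a} {b} {c} {d} f g with a ≟ b
... | yes eq rewrite ≡ᵇ-true eq | ≡ᵇ-true (f eq) = refl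
... | no ne rewrite ≡ᵇ-false ne | ≡ᵇ-false (ne ∘ g) = refl

module LevelPaths (G : Graph) (L : Distance.Levelling G) where
  open Adjacency G
  open Distance G
  open Levelling L

  up : ℕ → V → V
  up zero    v = v
  up (suc d) v = parent (up d v)

  lev-up : ∀ d v → lev (up d v) ≡ lev v ∸ d
  lev-up zero    v = refl
  lev-up (suc d) v = trans (lev-parent (up d v)) (trans (cong pred (lev-up d v)) (pred[m∸n]≡m∸[1+n] (lev v) d))

  up-within : ∀ d v → d ≤ lev v → Within d (up d v) v
  up-within zero v _ = refl
  up-within (suc d) v d<lev = within-cons d (parent-~ (up d v)
    (trans (lev-up d v) (≡.sym (suc-pred-pos (m<n⇒0<n∸m d<lev))))) (up-within d v (<⇒≤ d<lev))

  anc : V → ℕ → V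
  anc v j = up (lev v ∸ j) v

  lev-anc : ∀ v {j} → j ≤ lev v → lev (anc v j) ≡ j
  lev-anc v {j} j≤ = trans (lev-up (lev v ∸ j) v) (m∸[m∸n]≡n j≤)

  anc-self : ∀ v → anc v (lev v) ≡ v
  anc-self v rewrite n∸n≡0 (lev v) = refl

  anc-suc : ∀ v {j} → suc j ≤ lev v → anc v j ≡ parent (anc v (suc j))
  anc-suc v {j} j< = cong (λ d → up d v) (≡.sym (suc[m∸[1+n]] j<))
    where
    suc[m∸[1+n]] : ∀ {m n} → suc n ≤ m → suc (m ∸ suc n) ≡ m ∸ n
    suc[m∸[1+n]] {suc m} {n} (s≤s h) = ≡.sym (+-∸-assoc 1 h)

  anc-~ : ∀ v {j} → suc j ≤ lev v → anc v j ~ anc v (suc j)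
  anc-~ v j< rewrite anc-suc v j< = parent-~ (anc v (suc _)) (lev-anc v j<)

  anc-within : ∀ v {j} → j ≤ lev v → Within (lev v ∸ j) (anc v j) v
  anc-within v {j} j≤ = up-within (lev v ∸ j) v (m∸n≤m (lev v) j)

  LevelPath : ℕ → (ℕ → V) → Set
  LevelPath m p = (∀ j → j ≤ m → lev (p j) ≡ j) × (∀ j → suc j ≤ m → p j ~ p (suc j))

  anc-path : ∀ v → LevelPath (lev v) (anc v)
  anc-path v = (λ j → lev-anc v) , (λ j → anc-~ v)

  lev-≢ : ∀ {u v} → lev u ≢ lev v → u ≢ v
  lev-≢ ne refl = ne refl

  -- A level path is induced because an edge changes the level by at most one and the index of a
  -- path vertex is its level.
  path-adj : ∀ {m p} → LevelPath m p → ∀ {j k} → j < k → k ≤ m →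
    (p j ≢ p k) × adj G (p j) (p k) ≡ (k ≡ᵇ suc j)
  path-adj {m} {p} (lp , pa) {j} {k} j<k k≤m =
    lev-≢ (λ eq → <⇒≢ j<k (trans (≡.sym (lp j j≤m)) (trans eq (lp k k≤m)))) , eq
    where
    j≤m = ≤-trans (<⇒≤ j<k) k≤m
    eq : adj G (p j) (p k) ≡ (k ≡ᵇ suc j)
    eq with k ≟ suc j
    ... | yes refl rewrite ≡ᵇ-refl j = pa j k≤m
    ... | no k≢ rewrite ≡ᵇ-false k≢ = ≁⇒false λ e →
      k≢ (≤-antisym (≡.subst₂ _≤_ (lp k k≤m) (cong suc (lp j j≤m)) (lev-step e)) j<k)

  offset : Bool → ℕ
  offset η = if η then 0 else 1

  -- The path is cut at `c`: the y's descend from p (c - 1) and the z's ascend from p (offset η +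
  -- c). For η true these two vertices are consecutive, hence y 1 and z 1 are joined; for η false p
  -- c is left out between them. The bounds on c and m give each side n vertices.
  place-gadget : ∀ {γ δ η B n e} → HasShape γ δ η B n e → ∀ {m p} → LevelPath m p →
    ∀ c → n ≤ c → offset η + c + n ≤ suc m → (X : ℕ → V) →
    (∀ i j → i < j → j < B → (X i ≢ X j) × adj G (X i) (X j) ≡ γ) →
    (∀ i k → i < B → k ≤ m → k < c ⊎ offset η + c ≤ k →
      (X i ≢ p k) × adj G (X i) (p k) ≡ (δ ∨ (i ≡ᵇ 0)) ∧ ((suc k ≡ᵇ c) ∨ (k ≡ᵇ offset η + c))) →
    Contains G (vtxGraph B n e)
  place-gadget {γ} {δ} {η} {B} {n} {e} shape {m} {p} P c n≤c fits X XX XP =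
    embed-xyz B n e G X Y Z
      (λ i j i<j j< → via (vx (<-trans i<j j<)) (vx j<) (λ { refl → <-irrefl refl i<j }) (XX i j i<j j<))
      (λ i j i< j< → via (vx i<) (vy j<) (λ ()) (xy i j i< j<))
      (λ i j i< j< → via (vx i<) (vz j<) (λ ()) (xz i j i< j<))
      (λ i j i<j j< → via (vy (<-trans i<j j<)) (vy j<) (λ { refl → <-irrefl refl i<j }) (yy i j i<j j<))
      (λ i j i< j< → via (vy i<) (vz j<) (λ ()) (yz i j i< j<))
      (λ i j i<j j< → via (vz (<-trans i<j j<)) (vz j<) (λ { refl → <-irrefl refl i<j }) (zz i j i<j j<))
    where
    o = offset η
    Y Z : ℕ → V
    Y j = p (c ∸ suc j)
    Z j = p (o + c + j)
    via : ∀ {u v a b} → Valid B n u → Valid B n v → u ≢ v → (a ≢ b) × adj G a b ≡ gadget γ δ η u v →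
      (a ≢ b) × adj G a b ≡ e u v ∨ e v u
    via p q ne (d , eq) = d , trans eq (≡.sym (shape p q ne))
    c∸ : ∀ {i} → i < n → suc i + (c ∸ suc i) ≡ c
    c∸ i< = m+[n∸m]≡n (≤-trans i< n≤c)
    Z≤ : ∀ {j} → j < n → o + c + j ≤ m
    Z≤ j< = s≤s⁻¹ (≤-trans (+-monoʳ-< (o + c) j<) fits)
    Y≤ : ∀ {j} → j < n → c ∸ suc j ≤ m
    Y≤ {j} j< = ≤-trans (m∸n≤m c (suc j)) (≤-trans (m≤n+m c o) (≤-trans (m≤m+n (o + c) j) (Z≤ j<)))
    Y<c : ∀ {j} → j < n → c ∸ suc j < c
    Y<c {j} j< = ≤-trans (s≤s (m≤n+m (c ∸ suc j) j)) (≤-reflexive (c∸ j<))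
    xy : ∀ i j → i < B → j < n → (X i ≢ Y j) × adj G (X i) (Y j) ≡ (δ ∨ (i ≡ᵇ 0)) ∧ (j ≡ᵇ 0)
    xy i j i< j< with XP i (c ∸ suc j) i< (Y≤ j<) (inj₁ (Y<c j<))
    ... | ne , eq = ne , trans eq (cong ((δ ∨ (i ≡ᵇ 0)) ∧_) (trans
      (cong₂ _∨_ (≡ᵇ-cong {c = j} {d = 0}
                   (λ h → +-cancelʳ-≡ (suc (c ∸ suc j)) j 0 (trans (+-suc j _) (trans (c∸ j<) (≡.sym h))))
                   (λ { refl → c∸ j< }))
                 (≡ᵇ-false (<⇒≢ (≤-trans (Y<c j<) (m≤n+m c o)))))
      (∨-identityʳ _)))
    xz : ∀ i j → i < B → j < n → (X i ≢ Z j) × adj G (X i) (Z j) ≡ (δ ∨ (i ≡ᵇ 0)) ∧ (j ≡ᵇ 0)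
    xz i j i< j< with XP i (o + c + j) i< (Z≤ j<) (inj₂ (m≤m+n (o + c) j))
    ... | ne , eq = ne , trans eq (cong ((δ ∨ (i ≡ᵇ 0)) ∧_)
      (cong₂ _∨_ (≡ᵇ-false (λ h → <⇒≢ (s≤s (≤-trans (m≤n+m c o) (m≤m+n (o + c) j))) (≡.sym h)))
        (≡ᵇ-cong {c = j} {d = 0} (λ h → +-cancelˡ-≡ (o + c) j 0 (trans h (≡.sym (+-identityʳ (o + c)))))
                 (λ { refl → +-identityʳ (o + c) }))))
    yy : ∀ i j → i < j → j < n → (Y i ≢ Y j) × adj G (Y i) (Y j) ≡ (j ≡ᵇ suc i) ∨ (i ≡ᵇ suc j)
    yy i j i<j j< with path-adj P {c ∸ suc j} {c ∸ suc i}
        (∸-monoʳ-< (s≤s i<j) (≤-trans j< n≤c)) (Y≤ (<-trans i<j j<))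
    ... | ne , eq = ne ∘ ≡.sym , trans (Graph.sym G _ _) (trans eq (trans
      (≡ᵇ-cong {c = j} {d = suc i}
        (λ h → suc-injective (+-cancelʳ-≡ (c ∸ suc j) (suc j) (suc (suc i))
           (trans (c∸ j<) (trans (≡.sym (c∸ (<-trans i<j j<))) (trans (cong (suc i +_) h) (+-suc (suc i) _))))))
        (λ { refl → +-cancelˡ-≡ (suc i) _ _ (trans (c∸ (<-trans i<j j<)) (trans (≡.sym (c∸ j<)) (≡.sym (+-suc (suc i) _)))) }))
      (≡.sym (trans (cong ((j ≡ᵇ suc i) ∨_) (≡ᵇ-false (<⇒≢ (<-trans i<j ≤-refl)))) (∨-identityʳ _)))))
    zz : ∀ i j → i < j → j < n → (Z i ≢ Z j) × adj G (Z i) (Z j) ≡ (j ≡ᵇ suc i) ∨ (i ≡ᵇ suc j)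
    zz i j i<j j< with path-adj P {o + c + i} {o + c + j} (+-monoʳ-< (o + c) i<j) (Z≤ j<)
    ... | ne , eq = ne , trans eq (trans
      (≡ᵇ-cong {c = j} {d = suc i} (λ h → +-cancelˡ-≡ (o + c) j (suc i) (trans h (≡.sym (+-suc (o + c) i))))
               (λ { refl → +-suc (o + c) i }))
      (≡.sym (trans (cong ((j ≡ᵇ suc i) ∨_) (≡ᵇ-false (<⇒≢ (<-trans i<j ≤-refl)))) (∨-identityʳ _))))
    yz : ∀ i j → i < n → j < n → (Y i ≢ Z j) × adj G (Y i) (Z j) ≡ η ∧ ((i ≡ᵇ 0) ∧ (j ≡ᵇ 0))
    yz i j i< j< with path-adj P {c ∸ suc i} {o + c + j}
        (≤-trans (Y<c i<) (≤-trans (m≤n+m c o) (m≤m+n (o + c) j))) (Z≤ j<)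
    ... | ne , eq = ne , trans eq (join η i j refl i<)
      where
      join : ∀ η′ i j → η′ ≡ η → i < n →
        (offset η′ + c + j ≡ᵇ suc (c ∸ suc i)) ≡ η′ ∧ ((i ≡ᵇ 0) ∧ (j ≡ᵇ 0))
      join false i j _ i< = ≡ᵇ-false (λ h → <⇒≢ (≤-trans (Y<c i<) (m≤m+n c j)) (≡.sym (suc-injective h)))
      join true zero j _ i< = ≡ᵇ-cong {c = j} {d = 0}
        (λ h → +-cancelˡ-≡ c j 0 (trans h (trans (c∸ i<) (≡.sym (+-identityʳ c)))))
        (λ { refl → trans (+-identityʳ c) (≡.sym (c∸ i<)) })
      join true (suc i) j _ i< = ≡ᵇ-false (λ h → <⇒≢
        (≤-trans (s≤s (s≤s (m≤n+m (c ∸ suc (suc i)) i))) (≤-trans (≤-reflexive (c∸ i<)) (m≤m+n c j))) (≡.sym h))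

-- Vertices attached to a level path

module Attachment (n : ℕ) (G : Graph) (L : Distance.Levelling G)
  (F1-free : ¬ Contains G (F1 n)) (F2-free : ¬ Contains G (F2 n)) where
  open Adjacency G
  open Distance G
  open Levelling L
  open LevelPaths G L

  -- Here p c is x 1 and v the pendant x 2 of an F1 whose legs are the two sides of the path.
  no-single : ∀ {m p} → LevelPath m p → ∀ {v} c → n ≤ c → c + n ≤ m → v ~ p c →
    (∀ k → k ≤ m → v ~ p k → k ≡ c) → (∀ k → k ≤ m → v ≢ p k) → ⊥
  no-single {m} {p} P {v} c n≤c c+n≤m v~c only off =
    F1-free (place-gadget {e = eF1} (F1-shape n) P c n≤c (s≤s c+n≤m) X XX XP)
    where
    c≤m = ≤-trans (m≤m+n c n) c+n≤m
    X : ℕ → V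
    X zero    = p c
    X (suc _) = v
    XX : ∀ i j → i < j → j < 2 → (X i ≢ X j) × adj G (X i) (X j) ≡ true
    XX = pair-only (off c c≤m ∘ ≡.sym , ~-sym v~c)
    XP : ∀ i k → i < 2 → k ≤ m → k < c ⊎ suc c ≤ k →
      (X i ≢ p k) × adj G (X i) (p k) ≡ (i ≡ᵇ 0) ∧ ((suc k ≡ᵇ c) ∨ (k ≡ᵇ suc c))
    XP zero k _ k≤m (inj₁ k<c) with path-adj P k<c c≤m
    ... | ne , eq = ne ∘ ≡.sym , trans (Graph.sym G _ _) (trans eq (trans
      (≡ᵇ-cong {c} {suc k} ≡.sym ≡.sym)
      (≡.sym (trans (cong ((suc k ≡ᵇ c) ∨_) (≡ᵇ-false (<⇒≢ (<-trans k<c ≤-refl)))) (∨-identityʳ _)))))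
    XP zero k _ k≤m (inj₂ c<k) with path-adj P c<k k≤m
    ... | ne , eq = ne , trans eq (≡.sym (cong (_∨ (k ≡ᵇ suc c)) (≡ᵇ-false (λ h → <⇒≢ (<-trans c<k ≤-refl) (≡.sym h)))))
    XP (suc i) k _ k≤m away = off k k≤m , ≁⇒false λ e → apart away (only k k≤m e)
      where
      apart : k < c ⊎ suc c ≤ k → k ≢ c
      apart (inj₁ k<c) = <⇒≢ k<c
      apart (inj₂ c<k) = <⇒≢ c<k ∘ ≡.sym

  -- Here v is x 1 of an F2, and its triangle is completed by p c and p (1 + c) as y 1 and z 1.
  no-double : ∀ {m p} → LevelPath m p → ∀ {v} c → n ≤ suc c → c + n ≤ m → v ~ p c → v ~ p (suc c) →
    (∀ k → k ≤ m → v ~ p k → k ≡ c ⊎ k ≡ suc c) → (∀ k → k ≤ m → v ≢ p k) → ⊥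
  no-double {m} {p} P {v} c n≤c c+n≤m v~c v~c′ only off =
    F2-free (place-gadget {e = eF2} (F2-shape n) P (suc c) n≤c (s≤s c+n≤m) (λ _ → v)
      (λ { i j i<j (s≤s z≤n) → contradiction i<j λ () })
      (λ { i k i< k≤m _ → off k k≤m , adj-v k k≤m }))
    where
    adj-v : ∀ k → k ≤ m → adj G v (p k) ≡ (k ≡ᵇ c) ∨ (k ≡ᵇ suc c)
    adj-v k k≤m with k ≟ c | k ≟ suc c
    ... | yes refl | _ rewrite ≡ᵇ-refl k = v~c
    ... | no ne | yes refl rewrite ≡ᵇ-false ne | ≡ᵇ-refl c = v~c′
    ... | no ne | no ne′ rewrite ≡ᵇ-false ne | ≡ᵇ-false ne′ = ≁⇒false λ e →
      [ ne , ne′ ]′ (only k k≤m e)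

  -- Index i stands for the bag at level suc i, the possible substitutes for p (suc i) on the path.
  -- Whether v sees p (suc i) itself is left open.
  record Bag (p : ℕ → V) (i : ℕ) (v : V) : Set where
    constructor bag
    field
      level : lev v ≡ suc i
      below : v ~ p i
      above : v ~ p (2 + i)
  open Bag public

  bag? : ∀ p i v → Dec (Bag p i v)
  bag? p i v = map′ (λ (a , b , c) → bag a b c) (λ b → level b , below b , above b)
    ((lev v ≟ suc i) ×-dec (v ~? p i) ×-dec (v ~? p (2 + i)))

  path-bag : ∀ {m p} → LevelPath m p → ∀ i → 2 + i ≤ m → Bag p i (p (suc i))
  path-bag (lp , pa) i i≤ = bag (lp _ (<⇒≤ i≤)) (~-sym (pa i (<⇒≤ i≤))) (pa (suc i) i≤)

  nearby : ∀ {m p} → LevelPath m p → ∀ {v i} → lev v ≡ suc i → ∀ k → k ≤ m → v ~ p k →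
    k ≡ i ⊎ k ≡ suc i ⊎ k ≡ 2 + i
  nearby (lp , _) {v} {i} lv k k≤m e = split (≡.subst₂ _≤_ (lp k k≤m) (cong suc lv) (lev-step e))
    (s≤s⁻¹ (≡.subst₂ _≤_ lv (cong suc (lp k k≤m)) (lev-step (~-sym e))))
    where
    split : k ≤ 2 + i → i ≤ k → k ≡ i ⊎ k ≡ suc i ⊎ k ≡ 2 + i
    split hi lo with k ≟ i | k ≟ suc i
    ... | yes eq | _ = inj₁ eq
    ... | no _ | yes eq = inj₂ (inj₁ eq)
    ... | no ne | no ne′ = inj₂ (inj₂ (≤-antisym hi (≤∧≢⇒< (≤∧≢⇒< lo (ne ∘ ≡.sym)) (ne′ ∘ ≡.sym))))

  -- By levels v sees at most p i, p (1 + i) and p (2 + i). Of the eight patterns, those with both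
  -- outer vertices give the bag, a single neighbour gives F1, two consecutive ones give F2, and
  -- none contradicts v ~ p j. The bounds leave n path vertices on either side of each of the three.
  attach : ∀ {m p} → LevelPath m p → ∀ {v i} → lev v ≡ suc i → n ≤ i → 2 + i + n ≤ m →
    ∀ j → j ≤ m → v ~ p j → Bag p i v
  attach {m} {p} P@(lp , pa) {v} {i} lv n≤i fits j j≤m v~j with v Finₚ.≟ p (suc i)
  ... | yes refl = path-bag P i (≤-trans (m≤m+n (2 + i) n) fits)
  ... | no v≢ = cases (adj G v (p i)) refl (adj G v (p (suc i))) refl (adj G v (p (2 + i))) refl
    where
    off : ∀ k → k ≤ m → v ≢ p k
    off k k≤m eq = v≢ (trans eq (cong p (trans (≡.sym (lp k k≤m)) (trans (cong lev (≡.sym eq)) lv))))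
    near = nearby P lv
    fits₁ : suc i + n ≤ m
    fits₁ = <⇒≤ fits
    fits₀ : i + n ≤ m
    fits₀ = <⇒≤ fits₁
    absent : ∀ {k l} → adj G v (p l) ≡ false → v ~ p k → k ≢ l
    absent eq e refl = false⇒≁ eq e
    cases : ∀ a → adj G v (p i) ≡ a → ∀ b → adj G v (p (suc i)) ≡ b → ∀ c → adj G v (p (2 + i)) ≡ c → Bag p i v
    cases true ea _ _ true ec = bag lv ea ec
    cases true ea true eb false ec = ⊥-elim (no-double P i (m≤n⇒m≤1+n n≤i) fits₀ ea eb
      (λ k k≤ e → [ inj₁ , [ inj₂ , ⊥-elim ∘ absent ec e ]′ ]′ (near k k≤ e)) off)
    cases true ea false eb false ec = ⊥-elim (no-single P i n≤i fits₀ ea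
      (λ k k≤ e → [ id , [ ⊥-elim ∘ absent eb e , ⊥-elim ∘ absent ec e ]′ ]′ (near k k≤ e)) off)
    cases false ea true eb true ec = ⊥-elim (no-double P (suc i) (≤-trans n≤i (m≤n+m i 2)) fits₁ eb ec
      (λ k k≤ e → [ ⊥-elim ∘ absent ea e , id ]′ (near k k≤ e)) off)
    cases false ea true eb false ec = ⊥-elim (no-single P (suc i) (m≤n⇒m≤1+n n≤i) fits₁ eb
      (λ k k≤ e → [ ⊥-elim ∘ absent ea e , [ id , ⊥-elim ∘ absent ec e ]′ ]′ (near k k≤ e)) off)
    cases false ea false eb true ec = ⊥-elim (no-single P (2 + i) (≤-trans n≤i (m≤n+m i 2)) fits ec
      (λ k k≤ e → [ ⊥-elim ∘ absent ea e , [ ⊥-elim ∘ absent eb e , id ]′ ]′ (near k k≤ e)) off)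
    cases false ea false eb false ec =
      ⊥-elim ([ absent ea v~j , [ absent eb v~j , absent ec v~j ]′ ]′ (near j j≤m v~j))

  reroute : (ℕ → V) → ℕ → V → ℕ → V
  reroute p i v k with k ≟ i
  ... | yes _ = v
  ... | no  _ = p k

  reroute-at : ∀ p i v → reroute p i v i ≡ v
  reroute-at p i v with i ≟ i
  ... | yes _ = refl
  ... | no ne = contradiction refl ne

  reroute-off : ∀ p i v {k} → k ≢ i → reroute p i v k ≡ p k
  reroute-off p i v {k} ne with k ≟ i
  ... | yes eq = contradiction eq ne
  ... | no _ = refl

  reroute-path : ∀ {m p} → LevelPath m p → ∀ {v i} → Bag p i v → LevelPath m (reroute p (suc i) v)
  reroute-path {m} {p} (lp , pa) {v} {i} b = lp′ , pa′
    where
    lp′ : ∀ j → j ≤ m → lev (reroute p (suc i) v j) ≡ j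
    lp′ j j≤ with j ≟ suc i
    ... | yes refl = level b
    ... | no _ = lp j j≤
    pa′ : ∀ j → suc j ≤ m → reroute p (suc i) v j ~ reroute p (suc i) v (suc j)
    pa′ j j< with j ≟ suc i | suc j ≟ suc i
    ... | yes refl | yes ()
    ... | yes refl | no _ = above b
    ... | no _ | yes refl = ~-sym (below b)
    ... | no _ | no _ = pa j j<

  -- Rerouting p through v turns a neighbour of v into a vertex attached to a level path.
  bag-closed : ∀ {m p} → LevelPath m p → ∀ {i v} → suc n ≤ i → 3 + i + n ≤ m → Bag p i v →
    ∀ {u k} → v ~ u → lev u ≡ suc k → Bag p k u
  bag-closed {m} {p} P {i} {v} n<i fits b {u} {k} v~u lu = by (nearby P′ lu (suc i) i<m u~v′)
    where
    P′ = reroute-path P b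
    i<m : suc i ≤ m
    i<m = ≤-trans (≤-trans (m≤n+m (suc i) 2) (m≤m+n (3 + i) n)) fits
    u~v′ : u ~ reroute p (suc i) v (suc i)
    u~v′ rewrite reroute-at p (suc i) v = ~-sym v~u
    by : suc i ≡ k ⊎ suc i ≡ suc k ⊎ suc i ≡ 2 + k → Bag p k u
    -- A neighbour of u on the rerouted path, other than v, is still a vertex of p. So u is attached
    -- to p as well, and its bag on p follows.
    by (inj₁ refl) = attach P lu (≤-trans (n≤1+n n) (m≤n⇒m≤1+n n<i)) fits (3 + i)
      (≤-trans (m≤m+n (3 + i) n) fits)
      (subst (u ~_) (reroute-off p (suc i) v (λ ())) (above
        (attach P′ lu (≤-trans (n≤1+n n) (m≤n⇒m≤1+n n<i)) fits (suc i) i<m u~v′)))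
    by (inj₂ (inj₁ refl)) = bag lu
      (subst (u ~_) (reroute-off p (suc i) v (λ ())) (below b′))
      (subst (u ~_) (reroute-off p (suc i) v (λ ())) (above b′))
      where b′ = attach P′ lu (<⇒≤ n<i) (<⇒≤ fits) (suc i) i<m u~v′
    by (inj₂ (inj₂ refl)) = attach P lu (s≤s⁻¹ n<i) (<⇒≤ (<⇒≤ fits)) k (<⇒≤ (<⇒≤ i<m))
      (subst (u ~_) (reroute-off p (suc i) v (λ ())) (below
        (attach P′ lu (s≤s⁻¹ n<i) (<⇒≤ (<⇒≤ fits)) (suc i) i<m u~v′)))

  -- On the path rerouted through v the vertex u is still attached, by its upper neighbour. Its
  -- lower neighbour there is v.
  bag-complete : ∀ {m p} → LevelPath m p → ∀ {i v u} → n ≤ suc i → 3 + i + n ≤ m →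
    Bag p i v → Bag p (suc i) u → v ~ u
  bag-complete {m} {p} P {i} {v} {u} n≤ fits b c =
    ~-sym (subst (u ~_) (reroute-at p (suc i) v) (below
      (attach (reroute-path P b) (level c) n≤ fits (3 + i) (≤-trans (m≤m+n (3 + i) n) fits)
        (subst (u ~_) (≡.sym (reroute-off p (suc i) v (λ ()))) (above c)))))

-- Induced matchings and domination

length-deduplicate-≤ : ∀ {m} (us : List (Fin m)) → length (List.deduplicate Finₚ._≟_ us) ≤ length us
length-deduplicate-≤ [] = z≤n
length-deduplicate-≤ (u ∷ us) = s≤s (≤-trans
  (Listₚ.length-filter (λ v → ¬? (u Finₚ.≟ v)) (List.deduplicate Finₚ._≟_ us)) (length-deduplicate-≤ us))

length-concatMap-≤ : {ℓ : Level} {A : Set} {B : Set ℓ} {f : A → List B} {b : ℕ} → (∀ a → length (f a) ≤ b) →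
  ∀ us → length (concatMap f us) ≤ length us * b
length-concatMap-≤ h [] = z≤n
length-concatMap-≤ {f = f} h (u ∷ us) = ≤-trans (≤-reflexive (Listₚ.length-++ (f u)))
  (+-mono-≤ (h u) (length-concatMap-≤ h us))

-- Ramsey is applied twice: first to make the left ends of a private system independent, then the
-- right ends of what remains.
matchBound : ℕ → ℕ
matchBound n = ramsey n (ramsey n n)

abstract
  -- Increasing the radius by one replaces each dominator by itself and at most `matchBound n` of
  -- its neighbours.
  ballBound : ℕ → ℕ → ℕ
  ballBound n k = suc (matchBound n) ^ k

module InducedMatching (n : ℕ) (G : Graph) (K-free : ¬ Contains G (complete n)) where
  open Adjacency G
  open Distance G

  Private : V × V → V × V → Set
  Private (a , t) (a′ , t′) = ¬ a ~ t′ × ¬ a′ ~ t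

  record Matching (A T : V → Set) : Set where
    field
      edges   : List (V × V)
      size≡   : length edges ≡ n
      ends    : All (λ (a , t) → A a × T t × a ~ t) edges
      private-ends : AllPairs Private edges
      left-indep   : AllPairs (λ s s′ → ¬ proj₁ s ~ proj₁ s′) edges
      right-indep  : AllPairs (λ s s′ → ¬ proj₂ s ~ proj₂ s′) edges

  module _ {A T : V → Set} where

    matching : (ps : List (V × V)) → All (λ (a , t) → A a × T t × a ~ t) ps → AllPairs Private ps →
      matchBound n ≤ length ps → Matching A T
    matching ps ends priv big with ramsey-list (λ s s′ → proj₁ s ~? proj₁ s′) n (ramsey n n) ps big
    ... | inj₁ (qs , _ , len , hom) = contradiction
          (subst (Contains G ∘ complete) (trans (Listₚ.length-map proj₁ qs) len) (clique _ (AllPairsₚ.map⁺ hom))) K-free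
    ... | inj₂ (qs , qs⊆ , len , hom)
        with ramsey-list (λ s s′ → proj₂ s ~? proj₂ s′) n n qs (≤-reflexive (≡.sym len))
    ...   | inj₁ (rs , _ , len′ , hom′) = contradiction
            (subst (Contains G ∘ complete) (trans (Listₚ.length-map proj₂ rs) len′) (clique _ (AllPairsₚ.map⁺ hom′))) K-free
    ...   | inj₂ (rs , rs⊆ , len′ , hom′) = record
            { edges = rs ; size≡ = len′ ; ends = All-resp-⊆ (⊆-trans rs⊆ qs⊆) ends
            ; private-ends = AllPairs-resp-⊆ (⊆-trans rs⊆ qs⊆) priv
            ; left-indep = AllPairs-resp-⊆ rs⊆ hom ; right-indep = hom′ }

    -- A minimal dominating set, found greedily: a candidate is dropped when the others dominate all
    -- that it does, and otherwise kept with a target that only it dominates. The third invariant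
    -- shields the targets already chosen from the candidates still to come.
    private-system : Decidable T → (done : List (V × V)) (todo : List V) →
      All (λ (a , t) → A a × T t × a ~ t) done → AllPairs Private done →
      All (λ (_ , t) → All (λ a → ¬ a ~ t) todo) done → All A todo →
      (∀ t → T t → Any (_~ t) todo ⊎ Any (λ s → proj₁ s ~ t) done) →
      ∃[ ps ] All (λ (a , t) → A a × T t × a ~ t) ps × AllPairs Private ps ×
              (∀ t → T t → Any (λ s → proj₁ s ~ t) ps)
    private-system T? done [] ends priv _ _ cov = done , ends , priv , λ t Tt → unempty (cov t Tt)
      where
      unempty : ∀ {t} → Any (_~ t) [] ⊎ Any (λ s → proj₁ s ~ t) done → Any (λ s → proj₁ s ~ t) done
      unempty (inj₂ h) = h
    private-system T? done (a ∷ todo) ends priv out (Aa ∷ As) cov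
      with Finₚ.any? (λ t → T? t ×-dec ¬? (Any.any? (_~? t) todo) ×-dec ¬? (Any.any? (λ s → proj₁ s ~? t) done))
    ... | yes (t , Tt , ¬todo , ¬done) =
          private-system T? ((a , t) ∷ done) todo ((Aa , Tt , a~t) ∷ ends)
            (All.map (λ { (a≁ , a′≁) → a≁ , a′≁ }) (All.zip (All.map All.head out , Allₚ.¬Any⇒All¬ done ¬done)) ∷ priv)
            (Allₚ.¬Any⇒All¬ todo ¬todo ∷ All.map All.tail out) As
            (λ t′ Tt′ → shift (cov t′ Tt′))
      where
      a~t : a ~ t
      a~t with cov t Tt
      ... | inj₁ (here e) = e
      ... | inj₁ (there h) = contradiction h ¬todo
      ... | inj₂ h = contradiction h ¬done
      shift : ∀ {t′} → Any (_~ t′) (a ∷ todo) ⊎ Any (λ s → proj₁ s ~ t′) done →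
        Any (_~ t′) todo ⊎ Any (λ s → proj₁ s ~ t′) ((a , t) ∷ done)
      shift (inj₁ (here e)) = inj₂ (here e)
      shift (inj₁ (there h)) = inj₁ h
      shift (inj₂ h) = inj₂ (there h)
    ... | no redundant = private-system T? done todo ends priv (All.map All.tail out) As cov′
      where
      cov′ : ∀ t → T t → Any (_~ t) todo ⊎ Any (λ s → proj₁ s ~ t) done
      cov′ t Tt with Any.any? (_~? t) todo | Any.any? (λ s → proj₁ s ~? t) done
      ... | yes h | _ = inj₁ h
      ... | no _ | yes h = inj₂ h
      ... | no h | no h′ = contradiction (t , Tt , h , h′) redundant

    few-dominate : Decidable A → Decidable T → (∀ t → T t → ∃[ a ] A a × a ~ t) → ¬ Matching A T →
      ∃[ D ] (length D ≤ matchBound n) × All A D × (∀ t → T t → Any (_~ t) D)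
    few-dominate A? T? nbr no-matching
      with private-system T? [] (filter A? (allFin _)) [] [] [] (Allₚ.all-filter A? (allFin _))
             (λ t Tt → let (a , Aa , e) = nbr t Tt in inj₁ (Any.map (λ { refl → e }) (∈-filter⁺ A? (∈-allFin a) Aa)))
    ... | ps , ends , priv , cov with matchBound n ≤? length ps
    ...   | yes big = contradiction (matching ps ends priv big) no-matching
    ...   | no small = List.map proj₁ ps
            , ≤-trans (≤-reflexive (Listₚ.length-map proj₁ ps)) (≰⇒≥ small)
            , Allₚ.map⁺ (All.map proj₁ ends) , λ t Tt → Anyₚ.map⁺ (cov t Tt)

    -- One construction for S* and S~: `b` says whether the centre sees the far ends. Privacy gives
    -- the non-edges between Y i and Z j, and also that the Y's, and likewise the Z's, are distinct.
    spider : ∀ e b → (∀ j → e (x 1) (y (suc j)) ∨ e (y (suc j)) (x 1) ≡ true) →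
      (∀ j → e (x 1) (z (suc j)) ∨ e (z (suc j)) (x 1) ≡ b) →
      (∀ i j → e (y i) (y j) ∨ e (y j) (y i) ≡ false) →
      (∀ i j → e (y i) (z j) ∨ e (z j) (y i) ≡ (i ≡ᵇ j)) →
      (∀ i j → e (z i) (z j) ∨ e (z j) (z i) ≡ false) →
      ∀ d → (∀ a → A a → d ~ a) → (∀ t → T t → (d ≢ t) × adj G d t ≡ b) →
      Matching A T → Contains G (vtxGraph 1 n e)
    spider e b xy xz yy yz zz d dA dT M = embed-xyz 1 n e G (λ _ → d) Y Z
      (λ { i j i<j (s≤s z≤n) → contradiction i<j λ () })
      (λ { zero j _ j< → ~⇒≢ (d~Y j j<) , trans (d~Y j j<) (≡.sym (xy j)) ; (suc _) _ (s≤s ()) })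
      (λ { zero j _ j< → proj₁ (d-Z j j<) , trans (proj₂ (d-Z j j<)) (≡.sym (xz j)) ; (suc _) _ (s≤s ()) })
      (λ i j i<j j< → (λ eq → proj₂ (priv i j i<j j<) (subst (_~ Z i) eq (Y~Z i (<-trans i<j j<))))
                    , trans (≁⇒false (at left-indep i j i<j j<)) (≡.sym (yy _ _)))
      (λ i j i< j< → let (ne , eq) = YZ i j i< j< in ne , trans eq (≡.sym (yz _ _)))
      (λ i j i<j j< → (λ eq → proj₁ (priv i j i<j j<) (subst (Y i ~_) eq (Y~Z i (<-trans i<j j<))))
                    , trans (≁⇒false (at right-indep i j i<j j<)) (≡.sym (zz _ _)))
      where
      open Matching M
      S : ℕ → V × V
      S = nth (d , d) edges
      Y Z : ℕ → V
      Y i = proj₁ (S i)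
      Z i = proj₂ (S i)
      len : ∀ {i} → i < n → i < length edges
      len = subst (_ <_) (≡.sym size≡)
      end : ∀ i → i < n → A (Y i) × T (Z i) × Y i ~ Z i
      end i i< = nth-All ends i (len i<)
      Y~Z : ∀ i → i < n → Y i ~ Z i
      Y~Z i i< = proj₂ (proj₂ (end i i<))
      d~Y : ∀ i → i < n → d ~ Y i
      d~Y i i< = dA _ (proj₁ (end i i<))
      d-Z : ∀ i → i < n → (d ≢ Z i) × adj G d (Z i) ≡ b
      d-Z i i< = dT _ (proj₁ (proj₂ (end i i<)))
      at : {R : V × V → V × V → Set} → AllPairs R edges → ∀ i j → i < j → j < n → R (S i) (S j)
      at rs i j i<j j< = nth-AllPairs rs i j i<j (len j<)
      priv : ∀ i j → i < j → j < n → Private (S i) (S j)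
      priv = at private-ends
      YZ≁ : ∀ i j → i < n → j < n → i ≢ j → ¬ Y i ~ Z j
      YZ≁ i j i< j< i≢j with <-cmp i j
      ... | tri< i<j _ _ = proj₁ (priv i j i<j j<)
      ... | tri≈ _ eq _ = contradiction eq i≢j
      ... | tri> _ _ j<i = proj₂ (priv j i j<i i<)
      YY≁ : ∀ i j → i < n → j < n → i ≢ j → ¬ Y i ~ Y j
      YY≁ i j i< j< i≢j with <-cmp i j
      ... | tri< i<j _ _ = at left-indep i j i<j j<
      ... | tri≈ _ eq _ = contradiction eq i≢j
      ... | tri> _ _ j<i = at left-indep j i j<i i< ∘ ~-sym
      YZ : ∀ i j → i < n → j < n → (Y i ≢ Z j) × adj G (Y i) (Z j) ≡ (i ≡ᵇ j)
      YZ i j i< j< with i ≟ j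
      ... | yes refl rewrite ≡ᵇ-refl i = ~⇒≢ (Y~Z i i<) , Y~Z i i<
      ... | no i≢j rewrite ≡ᵇ-false i≢j =
            (λ eq → YY≁ j i j< i< (i≢j ∘ ≡.sym) (subst (Y j ~_) (≡.sym eq) (Y~Z j j<)))
          , ≁⇒false (YZ≁ i j i< j< i≢j)

  abstract
    -- For the step to radius k + 1, `few-dominate` is applied at each dominator d, with the
    -- neighbours of d as candidates and the vertices at distance two as targets; an induced
    -- matching between them is an S* with centre d. A vertex next to a neighbour of d is d, a
    -- neighbour of d or such a target.
    dominate-ball : ¬ Contains G (S* n) → ∀ k q →
      ∃[ D ] (length D ≤ ballBound n k) × (∀ t → Within k q t → Any (λ d → d ≡ t ⊎ d ~ t) D)
    dominate-ball S*-free zero q = q ∷ [] , ≤-refl , λ { t refl → here (inj₁ refl) }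
    dominate-ball S*-free (suc k) q with dominate-ball S*-free k q
    ... | D , len , dom = concatMap cluster D
          , ≤-trans (length-concatMap-≤ (λ d → s≤s (proj₁ (proj₂ (second d)))) D)
              (≤-trans (*-monoˡ-≤ (suc (matchBound n)) len) (≤-reflexive (*-comm (suc (matchBound n) ^ k) _)))
          , dom′
      where
      Far : V → V → Set
      Far d t = (d ≢ t) × ¬ d ~ t × ∃[ a ] d ~ a × a ~ t
      second : ∀ d → ∃[ D ] (length D ≤ matchBound n) × All (d ~_) D × (∀ t → Far d t → Any (_~ t) D)
      second d = few-dominate (d ~?_)
        (λ t → ¬? (d Finₚ.≟ t) ×-dec ¬? (d ~? t) ×-dec Finₚ.any? (λ a → (d ~? a) ×-dec (a ~? t)))
        (λ t f → proj₂ (proj₂ f))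
        (λ M → S*-free (spider eS* false (λ _ → refl) (λ _ → refl) (λ _ _ → refl)
          (λ _ _ → ∨-identityʳ _) (λ _ _ → refl) d (λ _ e → e) (λ _ (ne , d≁ , _) → ne , ≁⇒false d≁) M))
      cluster : V → List V
      cluster d = d ∷ proj₁ (second d)
      reach : ∀ d u t → d ≡ u ⊎ d ~ u → u ~ t → Any (λ d → d ≡ t ⊎ d ~ t) (cluster d)
      reach d u t (inj₁ refl) e = here (inj₂ e)
      reach d u t (inj₂ d~u) e with d Finₚ.≟ t | d ~? t
      ... | yes eq | _ = here (inj₁ eq)
      ... | no _ | yes d~t = here (inj₂ d~t)
      ... | no d≢t | no d≁t = there (Any.map inj₂ (proj₂ (proj₂ (proj₂ (second d))) t (d≢t , d≁t , u , d~u , e)))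
      dom′ : ∀ t → Within (suc k) q t → Any (λ d → d ≡ t ⊎ d ~ t) (concatMap cluster D)
      dom′ t (inj₁ w) = Anyₚ.concatMap⁺ cluster (Any.map near (dom t w))
        where
        near : ∀ {d} → d ≡ t ⊎ d ~ t → Any (λ d → d ≡ t ⊎ d ~ t) (cluster d)
        near h = here h
      dom′ t (inj₂ (u , w , e)) = Anyₚ.concatMap⁺ cluster (Any.map (λ {d} h → reach d u t h e) (dom u w))

-- Decomposition into a dominated part and strands

-- A ball of radius `7 + n + n` about the root, and for each strand a ball of radius `3 + n` for
-- what lies beyond its last usable bag.
dominatorBound : ℕ → ℕ
dominatorBound n = ballBound n (7 + n + n) + ballBound n (7 + n + n) * ballBound n (3 + n)

record Decomposed (n : ℕ) (G : Graph) (L : Distance.Levelling G)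
  (F1-free : ¬ Contains G (F1 n)) (F2-free : ¬ Contains G (F2 n)) : Set where
  open Adjacency G
  open Distance G
  open Levelling L
  open LevelPaths G L
  open Attachment n G L F1-free F2-free

  Near : V → V → Set
  Near d t = d ≡ t ⊎ d ~ t

  -- The bounds on k leave enough of the path on both sides of level suc k for the closure and
  -- completeness of bags.
  OnStrand : V → V → Set
  OnStrand t w = ∃[ k ] (2 + n ≤ k) × (3 + k + n ≤ lev w) × Bag (anc w) k t

  field
    dominators        : List V
    length-dominators : length dominators ≤ dominatorBound n
    strands           : List V
    length-strands    : length strands ≤ ballBound n (7 + n + n)
    strands-unique    : Unique strands
    strands-long      : All (λ w → 7 + n + n ≤ lev w) strands
    same-start        : ∀ {w w′} → w ∈ strands → w′ ∈ strands → anc w (3 + n) ≡ anc w′ (3 + n) → w ≡ w′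
    covered           : ∀ t → Any (λ d → Near d t) dominators ⊎ Any (OnStrand t) strands

module Decomposition (n : ℕ) (G : Graph) (L : Distance.Levelling G)
  (K-free : ¬ Contains G (complete n)) (S*-free : ¬ Contains G (S* n))
  (F1-free : ¬ Contains G (F1 n)) (F2-free : ¬ Contains G (F2 n)) where
  open Adjacency G
  open Distance G
  open InducedMatching n G K-free

  open Levelling L
  open LevelPaths G L
  open Attachment n G L F1-free F2-free

  Near : V → V → Set
  Near d t = d ≡ t ⊎ d ~ t

  near? : ∀ d t → Dec (Near d t)
  near? d t = (d Finₚ.≟ t) ⊎-dec (d ~? t)

  module _ {P : V → Set} (P? : Decidable P) where

    abstract
      deepestOf : V → List V → V
      deepestOf v []       = v
      deepestOf v (u ∷ us) = argmax lev u us

      deepest : V → V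
      deepest v = deepestOf v (filter P? (allFin _))

      deepest-satisfies : ∀ v {t} → P t → P (deepest v)
      deepest-satisfies v {t} Pt with filter P? (allFin _) | Allₚ.all-filter P? (allFin (size G)) | ∈-filter⁺ P? (∈-allFin t) Pt
      ... | u ∷ us | Pu ∷ Pus | _ = argmax-all lev {P = P} Pu Pus

      deepest-max : ∀ v {t} → P t → lev t ≤ lev (deepest v)
      deepest-max v {t} Pt with filter P? (allFin _) | ∈-filter⁺ P? (∈-allFin t) Pt
      ... | u ∷ us | here refl = f[⊥]≤f[argmax] {f = lev} u us
      ... | u ∷ us | there t∈ = All.lookup (f[xs]≤f[argmax] {f = lev} u us) t∈

  -- Below level `start` and within n + 3 levels of the deepest vertex, a level path is not
  -- long enough for the attachment argument; `depth` is what the argument consumes in total.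
  start depth : ℕ
  start = 3 + n
  depth = 7 + n + n

  Below : V → V → Set
  Below a t = start ≤ lev t × anc t start ≡ a

  below? : ∀ a → Decidable (Below a)
  below? a t = (start ≤? lev t) ×-dec (anc t start Finₚ.≟ a)

  NearBelow : V → V → Set
  NearBelow d t = start ≤ lev t × Near d (anc t start)

  nearBelow? : ∀ d → Decidable (NearBelow d)
  nearBelow? d t = (start ≤? lev t) ×-dec near? d (anc t start)

  tip : V → V
  tip a = deepest (below? a) a

  top : Σ (List V) λ D → (length D ≤ ballBound n depth) × (∀ t → Within depth root t → Any (λ d → Near d t) D)
  top = dominate-ball S*-free depth root

  -- A deepest vertex near d decides how far the strand must reach, but the strand ends in the tip
  -- below the ancestor of that vertex at level `start`, which is at least as deep. The end then
  -- depends on the ancestor alone, whence `same-start`.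
  tipNear : V → V
  tipNear d = tip (anc (deepest (nearBelow? d) root) start)

  tips : List V
  tips = List.map tipNear (proj₁ top)

  Long : V → Set
  Long w = depth ≤ lev w × tip (anc w start) ≡ w

  long? : Decidable Long
  long? w = (depth ≤? lev w) ×-dec (tip (anc w start) Finₚ.≟ w)

  strands : List V
  strands = List.deduplicate Finₚ._≟_ (filter long? tips)

  strands-unique : Unique strands
  strands-unique = deduplicate-! Finₚ._≟_ (filter long? tips)

  strands-long : All Long strands
  strands-long = Allₚ.deduplicate⁺ Finₚ._≟_ (Allₚ.all-filter long? tips)

  length-strands : length strands ≤ ballBound n depth
  length-strands = ≤-trans (length-deduplicate-≤ (filter long? tips)) (≤-trans (Listₚ.length-filter long? tips)
    (≤-trans (≤-reflexive (Listₚ.length-map tipNear (proj₁ top))) (proj₁ (proj₂ top))))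

  bottom : ∀ w → Σ (List V) λ D → (length D ≤ ballBound n start) ×
    (∀ t → Within start (anc w (lev w ∸ (3 + n))) t → Any (λ d → Near d t) D)
  bottom w = dominate-ball S*-free start _

  dominators : List V
  dominators = proj₁ top ++ concatMap (proj₁ ∘ bottom) strands

  length-dominators : length dominators ≤ dominatorBound n
  length-dominators = ≤-trans (≤-reflexive (Listₚ.length-++ (proj₁ top))) (+-mono-≤ (proj₁ (proj₂ top))
    (≤-trans (length-concatMap-≤ (proj₁ ∘ proj₂ ∘ bottom) strands) (*-monoˡ-≤ _ length-strands)))

  OnStrand : V → V → Set
  OnStrand t w = ∃[ k ] (2 + n ≤ k) × (3 + k + n ≤ lev w) × Bag (anc w) k t

  -- Let a be the ancestor of a deep t at level `start`, and d a top dominator near a. The strand w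
  -- of d is at least as deep as t, and its own ancestor q at that level is near d too. Closure of
  -- bags leads from q over d to a and then along the tree path towards t. If t is too close in
  -- level to w, the descent stops early and t falls into the ball at the bottom.
  covered : ∀ t → Any (λ d → Near d t) dominators ⊎ Any (OnStrand t) strands
  covered t with lev t ≤? depth
  ... | yes lt≤ = inj₁ (Anyₚ.++⁺ˡ (proj₂ (proj₂ top) t (within-mono lt≤ (lev-within t))))
  ... | no lt≰ = search (find∈ (proj₂ (proj₂ top) a (within-mono (≤-trans (≤-reflexive lev-a) start≤depth) (lev-within a))))
    where
    find∈ : {P : V → Set} {us : List V} → Any P us → ∃[ u ] u ∈ us × P u
    find∈ (here p) = _ , here refl , p
    find∈ (there h) = let (u , u∈ , p) = find∈ h in u , there u∈ , p
    deep : depth < lev t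
    deep = ≰⇒> lt≰
    start≤depth : start ≤ depth
    start≤depth = s≤s (s≤s (s≤s (≤-trans (m≤n+m n 4) (m≤m+n (4 + n) n))))
    start≤t : start ≤ lev t
    start≤t = ≤-trans start≤depth (<⇒≤ deep)
    a = anc t start
    lev-a : lev a ≡ start
    lev-a = lev-anc t start≤t
    search : (∃[ d ] d ∈ proj₁ top × Near d a) → Any (λ d → Near d t) dominators ⊎ Any (OnStrand t) strands
    search (d , d∈ , d-a) = finish (3 + k + n ≤? m)
      where
      w₁ = deepest (nearBelow? d) root
      near-w₁ : NearBelow d w₁
      near-w₁ = deepest-satisfies (nearBelow? d) root (start≤t , d-a)
      t≤w₁ : lev t ≤ lev w₁
      t≤w₁ = deepest-max (nearBelow? d) root (start≤t , d-a)
      w = tipNear d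
      m = lev w
      below-w : Below (anc w₁ start) w
      below-w = deepest-satisfies (below? (anc w₁ start)) (anc w₁ start) (proj₁ near-w₁ , refl)
      t≤w : lev t ≤ m
      t≤w = ≤-trans t≤w₁ (deepest-max (below? (anc w₁ start)) (anc w₁ start) (proj₁ near-w₁ , refl))
      depth≤m : depth ≤ m
      depth≤m = ≤-trans (<⇒≤ deep) t≤w
      w∈ : w ∈ strands
      w∈ = Anyₚ.deduplicate⁺ Finₚ._≟_ (λ { refl e → e })
        (∈-filter⁺ long? (∈-map⁺ tipNear d∈) (depth≤m , cong tip (proj₂ below-w)))
      m-large : 6 + n + n ≤ m
      m-large = <⇒≤ depth≤m
      p = anc w
      P = anc-path w
      q = anc w start
      d-q : Near d q
      d-q = subst (Near d) (≡.sym (proj₂ below-w)) (proj₂ near-w₁)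
      link : ∀ {i u v k} → suc n ≤ i → 3 + i + n ≤ m → Bag p i u → Near u v → lev v ≡ suc k → Bag p k v
      link n<i fits b (inj₁ refl) lv = subst (λ k → Bag p k _) (suc-injective (trans (≡.sym (level b)) lv)) b
      link n<i fits b (inj₂ e) lv = bag-closed P n<i fits b e lv
      near-sym : ∀ {u v} → Near u v → Near v u
      near-sym = [ inj₁ ∘ ≡.sym , inj₂ ∘ ~-sym ]′
      q-bag : Bag p (2 + n) q
      q-bag = path-bag P (2 + n) (≤-trans (s≤s (s≤s (s≤s (s≤s (≤-trans (m≤n+m n 2) (m≤m+n (2 + n) n)))))) m-large)
      lev-q : lev q ≡ start
      lev-q = level q-bag
      -- The level of d may be one off that of q. With `start` equal to 3 + n the bag of d still has
      -- index at least n + 1, as `bag-closed` demands.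
      lev-d : 2 + n ≤ lev d × lev d ≤ 4 + n
      lev-d = bounds d-q
        where
        bounds : Near d q → 2 + n ≤ lev d × lev d ≤ 4 + n
        bounds (inj₁ eq) = ≤-trans (n≤1+n _) (≤-reflexive (≡.sym lev-d≡)) , ≤-trans (≤-reflexive lev-d≡) (n≤1+n _)
          where lev-d≡ = trans (cong lev eq) lev-q
        bounds (inj₂ e) = s≤s⁻¹ (≤-trans (≤-reflexive (≡.sym lev-q)) (lev-step e))
                        , ≤-trans (lev-step (~-sym e)) (≤-reflexive (cong suc lev-q))
      lev-d-suc : lev d ≡ suc (pred (lev d))
      lev-d-suc = ≡.sym (suc-pred-pos (proj₁ lev-d))
      d-bag : Bag p (pred (lev d)) d
      d-bag = link (n≤1+n (suc n)) (≤-trans (+-monoˡ-≤ n (s≤s (s≤s (s≤s (s≤s (s≤s (n≤1+n n))))))) m-large)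
        q-bag (near-sym d-q) lev-d-suc
      a-bag : Bag p (2 + n) a
      a-bag = link (s≤s⁻¹ (subst (2 + n ≤_) lev-d-suc (proj₁ lev-d)))
        (≤-trans (+-monoˡ-≤ n (s≤s (s≤s (s≤s (s≤s⁻¹ (subst (_≤ 4 + n) lev-d-suc (proj₂ lev-d))))))) m-large)
        d-bag d-a lev-a
      descend : ∀ e → 2 + (e + (2 + n)) + n ≤ m → suc (e + (2 + n)) ≤ lev t → Bag p (e + (2 + n)) (anc t (suc (e + (2 + n))))
      descend zero _ _ = a-bag
      descend (suc e) fits deep′ = bag-closed P (≤-trans (n≤1+n (suc n)) (m≤n+m (2 + n) e)) fits
        (descend e (<⇒≤ fits) (<⇒≤ deep′)) (anc-~ t deep′) (lev-anc t deep′)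
      descend-to : ∀ {j} → 2 + n ≤ j → 2 + j + n ≤ m → suc j ≤ lev t → Bag p j (anc t (suc j))
      descend-to {j} lo = subst (λ j → 2 + j + n ≤ m → suc j ≤ lev t → Bag p j (anc t (suc j)))
        (m∸n+n≡m lo) (descend (j ∸ (2 + n)))
      k = pred (lev t)
      lev-t : suc k ≡ lev t
      lev-t = suc-pred-pos deep
      finish : Dec (3 + k + n ≤ m) → Any (λ d → Near d t) dominators ⊎ Any (OnStrand t) strands
      finish (yes fits) = inj₂ (Any.map (λ { refl → k , lo , fits , t-bag }) w∈)
        where
        lo : 2 + n ≤ k
        lo = s≤s⁻¹ (subst (start ≤_) (≡.sym lev-t) start≤t)
        t-bag : Bag p k t
        t-bag = subst (Bag p k) (trans (cong (anc t) lev-t) (anc-self t)) (descend-to lo (<⇒≤ fits) (≤-reflexive lev-t))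
      finish (no ¬fits) = inj₁ (Anyₚ.++⁺ʳ (proj₁ top) (Anyₚ.concatMap⁺ (proj₁ ∘ bottom)
          (Any.map (λ { refl → proj₂ (proj₂ (bottom w)) t close }) w∈)))
        where
        j = m ∸ (3 + n)
        3+n≤m : 3 + n ≤ m
        3+n≤m = ≤-trans start≤depth depth≤m
        j+3+n : j + (3 + n) ≡ m
        j+3+n = m∸n+n≡m 3+n≤m
        3+j+n : 3 + j + n ≡ m
        3+j+n = trans (≡.sym (trans (+-suc j (2 + n)) (cong suc (trans (+-suc j (suc n)) (cong suc (+-suc j n)))))) j+3+n
        j<t : suc j ≤ lev t
        j<t = subst (suc j ≤_) lev-t (m≤n⇒m≤1+n (+-cancelʳ-≤ n (suc j) k
          (s≤s⁻¹ (s≤s⁻¹ (s≤s⁻¹ (subst (λ v → suc v ≤ 3 + k + n) (≡.sym 3+j+n) (≰⇒> ¬fits)))))))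
        lo : 2 + n ≤ j
        lo = +-cancelʳ-≤ (3 + n) (2 + n) j (≤-trans
          (≤-reflexive (cong (2 +_) (trans (+-suc n (2 + n)) (cong suc (trans (+-suc n (suc n)) (cong suc (+-suc n n)))))))
          (≤-trans (≤-trans (m≤n+m (5 + n + n) 2) depth≤m) (≤-reflexive (≡.sym j+3+n))))
        j-bag : Bag p j (anc t (suc j))
        j-bag = descend-to lo (≤-trans (n≤1+n _) (≤-reflexive 3+j+n)) j<t
        m∸1+j : m ∸ suc j ≡ 2 + n
        m∸1+j = trans (cong (_∸ suc j) (trans (≡.sym j+3+n) (+-suc j (2 + n)))) (m+n∸m≡n (suc j) (2 + n))
        -- As w is at least as deep as t, at most 2 + n levels separate t from its ancestor at level
        -- suc j, which is a neighbour of p j.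
        close : Within start (p j) t
        close = within-mono (s≤s (≤-trans (∸-monoˡ-≤ (suc j) t≤w) (≤-reflexive m∸1+j)))
          (within-cons (lev t ∸ suc j) (~-sym (below j-bag)) (anc-within t j<t))

  same-start : ∀ {w w′} → Long w → Long w′ → anc w start ≡ anc w′ start → w ≡ w′
  same-start (_ , tip≡) (_ , tip≡′) eq = trans (≡.sym tip≡) (trans (cong tip eq) tip≡′)

  decomposed : Decomposed n G L F1-free F2-free
  decomposed = record
    { dominators = dominators ; length-dominators = length-dominators
    ; strands = strands ; length-strands = length-strands ; strands-unique = strands-unique
    ; strands-long = All.map proj₁ strands-long
    ; same-start = λ w∈ w∈′ → same-start (All.lookup strands-long w∈) (All.lookup strands-long w∈′)
    ; covered = covered }

-- Pieces

module Pieces (G : Graph) where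
  open Adjacency G

  -- The vertex set of a piece as a predicate, so that covering and disjointness can be argued
  -- without the embedding.
  record PieceOf (S : V → Set) : Set where
    field
      piece    : SPPiece G
      complete-piece : ∀ v → S v → InPiece piece v
      sound-piece    : ∀ v → InPiece piece v → S v
  open PieceOf public

  path-piece : (f : ℕ → V) (k : ℕ) → 1 ≤ k →
    (∀ i j → i < j → j < k → (f i ≢ f j) × adj G (f i) (f j) ≡ (j ≡ᵇ suc i)) →
    PieceOf (λ v → ∃[ i ] (i < k) × f i ≡ v)
  path-piece f k 1≤k ok = record
    { piece = record { shape = pathS k ; pos = 1≤k ; emb = record
        { map = f ∘ toℕ ; inj = λ {i} {j} → f-inj i j ; pres = f-pres } }
    ; complete-piece = λ { v (i , i< , refl) → fromℕ< i< , cong f (Finₚ.toℕ-fromℕ< i<) }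
    ; sound-piece = λ { v (i , refl) → toℕ i , Finₚ.toℕ<n i , refl } }
    where
    f-inj : ∀ (i j : Fin k) → f (toℕ i) ≡ f (toℕ j) → i ≡ j
    f-inj i j eq with Finₚ.<-cmp i j
    ... | tri< i<j _ _ = contradiction eq (proj₁ (ok _ _ i<j (Finₚ.toℕ<n j)))
    ... | tri≈ _ i≡j _ = i≡j
    ... | tri> _ _ j<i = contradiction (≡.sym eq) (proj₁ (ok _ _ j<i (Finₚ.toℕ<n i)))
    f-pres : ∀ (i j : Fin k) → adj G (f (toℕ i)) (f (toℕ j)) ≡ adj (path k) i j
    f-pres i j with Finₚ.<-cmp i j
    ... | tri< i<j i≢j _ rewrite ≡ᵇ-false (i≢j ∘ Finₚ.toℕ-injective) = trans (proj₂ (ok _ _ i<j (Finₚ.toℕ<n j)))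
            (≡.sym (trans (cong ((toℕ j ≡ᵇ suc (toℕ i)) ∨_) (≡ᵇ-false (<⇒≢ (<-trans i<j ≤-refl)))) (∨-identityʳ _)))
    ... | tri≈ _ refl _ rewrite ≡ᵇ-refl (toℕ i) = irrefl G _
    ... | tri> _ i≢j j<i rewrite ≡ᵇ-false (i≢j ∘ Finₚ.toℕ-injective) = trans (Graph.sym G _ _)
            (trans (proj₂ (ok _ _ j<i (Finₚ.toℕ<n i)))
              (≡.sym (cong (_∨ (toℕ i ≡ᵇ suc (toℕ j))) (≡ᵇ-false (<⇒≢ (<-trans j<i ≤-refl))))))

  star-piece : ∀ c (leaves : List V) → Unique leaves → All (c ~_) leaves → AllPairs (λ u v → ¬ u ~ v) leaves →
    PieceOf (λ v → v ≡ c ⊎ v ∈ leaves)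
  -- A star must have a leaf; a lone centre is the path of order 1.
  star-piece c [] _ _ _ = record
    { piece = piece P ; complete-piece = λ { v (inj₁ refl) → complete-piece P v (0 , s≤s z≤n , refl) }
    ; sound-piece = λ v h → inj₁ (≡.sym (proj₂ (proj₂ (sound-piece P v h)))) }
    where P = path-piece (λ _ → c) 1 (s≤s z≤n) (λ { i j i<j (s≤s z≤n) → contradiction i<j λ () })
  star-piece c leaves@(_ ∷ _) uniq near indep = record
    { piece = record { shape = starS (length leaves) ; pos = s≤s z≤n ; emb = record
        { map = f ; inj = λ {i} {j} → f-inj i j ; pres = f-pres } }
    ; complete-piece = λ { v (inj₁ refl) → Fin.zero , refl
                         ; v (inj₂ v∈) → Fin.suc (Any.index v∈) , ≡.sym (Anyₚ.lookup-index v∈) }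
    ; sound-piece = λ { v (Fin.zero , refl) → inj₁ refl ; v (Fin.suc i , refl) → inj₂ (∈-lookup i) } }
    where
    f : Fin (suc (length leaves)) → V
    f Fin.zero = c
    f (Fin.suc i) = lookup leaves i
    spoke : ∀ i → c ~ lookup leaves i
    spoke i = All.lookup near (∈-lookup i)
    f-inj : ∀ i j → f i ≡ f j → i ≡ j
    f-inj Fin.zero Fin.zero _ = refl
    f-inj Fin.zero (Fin.suc j) eq = contradiction eq (~⇒≢ (spoke j))
    f-inj (Fin.suc i) Fin.zero eq = contradiction (≡.sym eq) (~⇒≢ (spoke i))
    f-inj (Fin.suc i) (Fin.suc j) eq = cong Fin.suc (lookup-injective uniq i j eq)
    apart : ∀ {us} → AllPairs (λ u v → ¬ u ~ v) us → ∀ i j → ¬ lookup us i ~ lookup us j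
    apart (p ∷ ps) Fin.zero Fin.zero e = ~⇒≢ e refl
    apart (p ∷ ps) Fin.zero (Fin.suc j) e = All.lookup p (∈-lookup j) e
    apart (p ∷ ps) (Fin.suc i) Fin.zero e = All.lookup p (∈-lookup i) (~-sym e)
    apart (p ∷ ps) (Fin.suc i) (Fin.suc j) e = apart ps i j e
    f-pres : ∀ i j → adj G (f i) (f j) ≡ adj (star (length leaves)) i j
    f-pres Fin.zero Fin.zero = irrefl G c
    f-pres Fin.zero (Fin.suc j) = spoke j
    f-pres (Fin.suc i) Fin.zero = ~-sym (spoke i)
    f-pres (Fin.suc i) (Fin.suc j) = trans (≁⇒false (apart indep i j)) (≡.sym (∧-zeroʳ _))

  star-of : ∀ c {I : V → Set} → Decidable I → (∀ v → I v → c ~ v) → (∀ u v → I u → I v → ¬ u ~ v) →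
    PieceOf (λ v → v ≡ c ⊎ I v)
  star-of c {I} I? near indep = record
    { piece = piece P
    ; complete-piece = λ { v (inj₁ eq) → complete-piece P v (inj₁ eq)
                         ; v (inj₂ Iv) → complete-piece P v (inj₂ (∈-filter⁺ I? (∈-allFin v) Iv)) }
    ; sound-piece = λ v h → map₂ (λ v∈ → proj₂ (∈-filter⁻ I? {xs = allFin _} v∈)) (sound-piece P v h) }
    where
    leaves = filter I? (allFin _)
    all-I : All I leaves
    all-I = Allₚ.all-filter I? (allFin _)
    pairs : ∀ {us} → All I us → AllPairs (λ u v → ¬ u ~ v) us
    pairs [] = []
    pairs (i ∷ is) = All.map (indep _ _ i) is ∷ pairs is
    P = star-piece c leaves (Uniqueₚ.filter⁺ I? (Uniqueₚ.allFin⁺ _)) (All.map (near _) all-I) (pairs all-I)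

  covering : (Ps : List (Σ (V → Set) PieceOf)) → (∀ v → Any (λ P → proj₁ P v) Ps) →
    Covers {G} (List.map (λ P → piece (proj₂ P)) Ps)
  covering Ps cov v = Anyₚ.map⁺ (Any.map (λ {P} → complete-piece (proj₂ P) v) (cov v))

-- Bags along a strand

module Bags (n : ℕ) (G : Graph) (L : Distance.Levelling G)
  (F1-free : ¬ Contains G (F1 n)) (F2-free : ¬ Contains G (F2 n)) where
  open Adjacency G
  open Distance G
  open Levelling L
  open LevelPaths G L
  open Attachment n G L F1-free F2-free
  open Pieces G

  -- Bag members take the place of p (suc k) as the x's of F3, F4 or F5: y 1 is p k, z 1 is p (2 +
  -- k), and both see the whole bag.
  bag-gadget : ∀ {γ B} e → HasShape γ true false B n e → ∀ {m p} → LevelPath m p →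
    ∀ k → n ≤ suc k → 2 + k + n ≤ m → (X : ℕ → V) → (∀ i → i < B → Bag p k (X i)) →
    (∀ i j → i < j → j < B → (X i ≢ X j) × adj G (X i) (X j) ≡ γ) → Contains G (vtxGraph B n e)
  bag-gadget e shape {m} {p} P k n≤ fits X X-bag XX = place-gadget {e = e} shape P (suc k) n≤ (m≤n⇒m≤1+n fits) X XX
    (λ i j i< j≤m away → off i j i< j≤m away , value i j i< j≤m away)
    where
    off : ∀ i j → i < _ → j ≤ m → j < suc k ⊎ 2 + k ≤ j → X i ≢ p j
    off i j i< j≤m away eq = apart away (trans (≡.sym (proj₁ P j j≤m)) (trans (cong lev (≡.sym eq)) (level (X-bag i i<))))
      where
      apart : j < suc k ⊎ 2 + k ≤ j → j ≢ suc k
      apart (inj₁ lt) = <⇒≢ lt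
      apart (inj₂ gt) = <⇒≢ gt ∘ ≡.sym
    value : ∀ i j → i < _ → j ≤ m → j < suc k ⊎ 2 + k ≤ j → adj G (X i) (p j) ≡ (j ≡ᵇ k) ∨ (j ≡ᵇ 2 + k)
    value i j i< j≤m away with j ≟ k | j ≟ 2 + k
    ... | yes refl | _ rewrite ≡ᵇ-refl j = below (X-bag i i<)
    ... | no ne | yes refl rewrite ≡ᵇ-refl k | ∨-zeroʳ (2 + k ≡ᵇ k) = above (X-bag i i<)
    ... | no ne | no ne′ rewrite ≡ᵇ-false ne | ≡ᵇ-false ne′ = ≁⇒false λ e →
          impossible away (nearby P (level (X-bag i i<)) j j≤m e)
      where
      impossible : j < suc k ⊎ 2 + k ≤ j → j ≡ k ⊎ j ≡ suc k ⊎ j ≡ 2 + k → ⊥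
      impossible _ (inj₁ h) = ne h
      impossible _ (inj₂ (inj₂ h)) = ne′ h
      impossible (inj₁ lt) (inj₂ (inj₁ refl)) = <-irrefl refl lt
      impossible (inj₂ gt) (inj₂ (inj₁ refl)) = <-irrefl refl gt

  bagList : (ℕ → V) → ℕ → List V
  bagList p k = filter (bag? p k) (allFin _)

  -- Among `ramsey n n` members n would be independent, and they are the x's of an F3.
  bag-small : ¬ Contains G (complete n) → ¬ Contains G (F3 n) → ∀ {m p} → LevelPath m p →
    ∀ k → n ≤ suc k → 2 + k + n ≤ m → length (bagList p k) ≤ ramsey n n
  bag-small K-free F3-free {m} {p} P k n≤ fits with ramsey n n ≤? length (bagList p k)
  ... | no small = ≰⇒≥ small
  ... | yes big with ramsey-indep n n K-free (bagList p k) big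
  ...   | vs , vs⊆ , len , indep = contradiction
          (bag-gadget eF3 (F3-shape n n) P k n≤ fits (nth (p 0) vs)
            (λ i i< → nth-All (All-resp-⊆ vs⊆ (Allₚ.all-filter (bag? p k) (allFin _))) i (lt i<))
            (λ i j i<j j< → nth-AllPairs (AllPairs-resp-⊆ vs⊆ (Uniqueₚ.filter⁺ (bag? p k) (Uniqueₚ.allFin⁺ _))) i j i<j (lt j<)
                          , ≁⇒false (nth-AllPairs indep i j i<j (lt j<))))
          F3-free
    where
    lt : ∀ {i} → i < n → i < length vs
    lt = subst (_ <_) (≡.sym len)

  -- A second member of the bag and p (suc k) are the two x's of an F5 if they are adjacent, and of
  -- an F4 if not.
  bag-trivial : ¬ Contains G (F4 n) → ¬ Contains G (F5 n) → ∀ {m p} → LevelPath m p →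
    ∀ {k v} → n ≤ suc k → 2 + k + n ≤ m → Bag p k v → v ≡ p (suc k)
  bag-trivial F4-free F5-free {m} {p} P {k} {v} n≤ fits b with v Finₚ.≟ p (suc k)
  ... | yes eq = eq
  ... | no ne = ⊥-elim (by (adj G (p (suc k)) v) refl)
    where
    twins : ℕ → V
    twins zero    = p (suc k)
    twins (suc _) = v
    in-bag : ∀ i → i < 2 → Bag p k (twins i)
    in-bag zero _ = path-bag P k (≤-trans (m≤m+n (2 + k) n) fits)
    in-bag (suc _) _ = b
    pairs : ∀ {β} → adj G (p (suc k)) v ≡ β → ∀ i j → i < j → j < 2 → (twins i ≢ twins j) × adj G (twins i) (twins j) ≡ β
    pairs eq = pair-only (ne ∘ ≡.sym , eq)
    by : ∀ β → adj G (p (suc k)) v ≡ β → ⊥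
    by true  eq = F5-free (bag-gadget eF5 (F5-shape n) P k n≤ fits twins in-bag (pairs eq))
    by false eq = F4-free (bag-gadget eF3 (F3-shape 2 n) P k n≤ fits twins in-bag (pairs eq))

  -- One vertex from each bag gives an induced path: `bag-complete` joins consecutive choices and
  -- levels keep the others apart. Index 0 is the bag at level 3 + n, and `len` counts the bags that
  -- still leave room above them on the path.
  transversal-piece : ∀ {m p} → LevelPath m p → 6 + n + n ≤ m → (f : ℕ → V) →
    (∀ i → 2 + (i + (2 + n)) + n ≤ m → Bag p (i + (2 + n)) (f i)) →
    PieceOf (λ v → ∃[ i ] (2 + (i + (2 + n)) + n ≤ m) × f i ≡ v)
  transversal-piece {m} {p} P long f f-bag = record
    { piece = piece Q
    ; complete-piece = λ { v (i , fits , eq) → complete-piece Q v (i , from-fits i fits , eq) }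
    ; sound-piece = λ v h → let (i , i< , eq) = sound-piece Q v h in i , to-fits i i< , eq }
    where
    len = m ∸ (3 + n + n)
    total : len + (3 + n + n) ≡ m
    total = m∸n+n≡m (≤-trans (+-monoˡ-≤ n (+-monoˡ-≤ n {3} {6} (s≤s (s≤s (s≤s z≤n))))) long)
    arith : ∀ i → suc i + (3 + n + n) ≡ 2 + (i + (2 + n)) + n
    arith i = trans (cong suc (trans (≡.sym (+-assoc i (3 + n) n)) (cong (_+ n) (+-suc i (2 + n))))) refl
    to-fits : ∀ i → i < len → 2 + (i + (2 + n)) + n ≤ m
    to-fits i i< = subst (_≤ m) (arith i) (≤-trans (+-monoˡ-≤ (3 + n + n) i<) (≤-reflexive total))
    from-fits : ∀ i → 2 + (i + (2 + n)) + n ≤ m → i < len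
    from-fits i fits = +-cancelʳ-≤ (3 + n + n) (suc i) len
      (≤-trans (≤-reflexive (arith i)) (≤-trans fits (≤-reflexive (≡.sym total))))
    n≤ : ∀ i → n ≤ suc (i + (2 + n))
    n≤ i = m≤n⇒m≤1+n (≤-trans (m≤n+m n 2) (m≤n+m (2 + n) i))
    ok : ∀ i j → i < j → j < len → (f i ≢ f j) × adj G (f i) (f j) ≡ (j ≡ᵇ suc i)
    ok i j i<j j< = lev-≢ (λ eq → <⇒≢ i<j (+-cancelʳ-≡ (2 + n) i j (suc-injective
                      (trans (≡.sym (level bi)) (trans eq (level bj)))))) , value
      where
      bi = f-bag i (to-fits i (<-trans i<j j<))
      bj = f-bag j (to-fits j j<)
      value : adj G (f i) (f j) ≡ (j ≡ᵇ suc i)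
      value with j ≟ suc i
      ... | yes refl rewrite ≡ᵇ-refl i = bag-complete P (n≤ i) (to-fits j j<) bi bj
      ... | no ne rewrite ≡ᵇ-false ne = ≁⇒false λ e → ne (≤-antisym
              (+-cancelʳ-≤ (2 + n) j (suc i) (s≤s⁻¹ (≡.subst₂ _≤_ (level bj) (cong suc (level bi)) (lev-step e)))) i<j)
    Q = path-piece f len (+-cancelʳ-≤ (3 + n + n) 1 len (≤-trans
          (≤-trans (+-monoˡ-≤ n (+-monoˡ-≤ n {4} {6} (s≤s (s≤s (s≤s (s≤s z≤n)))))) long) (≤-reflexive (≡.sym total)))) ok

-- Colouring

Colorable : Graph → ℕ → Set
Colorable G c = Σ (Fin (size G) → Fin c) λ col → ∀ u v → adj G u v ≡ true → col u ≢ col v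

induced : (G : Graph) → List (Fin (size G)) → Graph
induced G us = record
  { size = length us
  ; adj = λ i j → adj G (lookup us i) (lookup us j)
  ; sym = λ i j → Graph.sym G _ _
  ; irrefl = λ i → irrefl G _ }

induced-embeds : ∀ G us → Unique us → Contains G (induced G us)
induced-embeds G us uniq = record
  { map = lookup us ; inj = λ {i} {j} → lookup-injective uniq i j ; pres = λ _ _ → refl }

module Components (G : Graph) where
  open Adjacency G

  walk-trans : ∀ {u v w} → Walk G u v → Walk G v w → Walk G u w
  walk-trans here q = q
  walk-trans (step e p) q = step e (walk-trans p q)

  walk-sym : ∀ {u v} → Walk G u v → Walk G v u
  walk-sym here = here
  walk-sym (step e p) = walk-trans (walk-sym p) (step (~-sym e) here)

  -- Union-find: an edge redirects the class of its second end to the representative of its first.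
  -- The walks to representatives are carried along to make the classes connected.
  merge : (ps : List (V × V)) → Σ (V → V) λ rep → (∀ v → Walk G v (rep v)) ×
    (∀ u v → (u , v) ∈ ps → u ~ v → rep u ≡ rep v)
  merge [] = id , (λ _ → here) , λ _ _ ()
  merge ((a , b) ∷ ps) with merge ps | a ~? b
  ... | rep , walks , joined | no a≁b = rep , walks , λ { u v (here refl) e → contradiction e a≁b ; u v (there h) → joined u v h }
  ... | rep , walks , joined | yes a~b = rep′ , walks′ , joined′
    where
    redirect : V → V
    redirect r with r Finₚ.≟ rep b
    ... | yes _ = rep a
    ... | no  _ = r
    rep′ : V → V
    rep′ = redirect ∘ rep
    walks′ : ∀ v → Walk G v (rep′ v)
    walks′ v with rep v Finₚ.≟ rep b
    ... | yes eq = walk-trans (walks v) (walk-trans (subst (λ r → Walk G r b) (≡.sym eq) (walk-sym (walks b)))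
                     (step (~-sym a~b) (walks a)))
    ... | no _ = walks v
    redirect-b : redirect (rep b) ≡ rep a
    redirect-b with rep b Finₚ.≟ rep b
    ... | yes _ = refl
    ... | no ne = contradiction refl ne
    redirect-a : redirect (rep a) ≡ rep a
    redirect-a with rep a Finₚ.≟ rep b
    ... | yes _ = refl
    ... | no _ = refl
    joined′ : ∀ u v → (u , v) ∈ ((a , b) ∷ ps) → u ~ v → rep′ u ≡ rep′ v
    joined′ u v (here refl) e = trans redirect-a (≡.sym redirect-b)
    joined′ u v (there h) e = cong redirect (joined u v h e)

  merged = merge (List.cartesianProduct (allFin (size G)) (allFin (size G)))

  rep : V → V
  rep = proj₁ merged

  rep-adj : ∀ {u v} → u ~ v → rep u ≡ rep v
  rep-adj {u} {v} = proj₂ (proj₂ merged) u v (∈-cartesianProduct⁺ (∈-allFin u) (∈-allFin v))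

  class : V → List V
  class r = filter (λ v → rep v Finₚ.≟ r) (allFin _)

  class-unique : ∀ r → Unique (class r)
  class-unique r = Uniqueₚ.filter⁺ _ (Uniqueₚ.allFin⁺ _)

  ∈-class : ∀ {r v} → rep v ≡ r → v ∈ class r
  ∈-class {r} {v} = ∈-filter⁺ (λ v → rep v Finₚ.≟ r) (∈-allFin v)

  -- Representatives are constant along edges, so a walk never leaves its class and survives in the
  -- induced subgraph.
  class-walk : ∀ {r u v} → Walk G u v → (i : u ∈ class r) (j : v ∈ class r) →
    Walk (induced G (class r)) (Any.index i) (Any.index j)
  class-walk {r} here i j = subst (λ k → Walk (induced G (class r)) (Any.index i) k)
    (lookup-injective (class-unique r) _ _ (trans (≡.sym (Anyₚ.lookup-index i)) (Anyₚ.lookup-index j))) here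
  class-walk {r} (step {u} {w} e p) i j =
    step (≡.subst₂ _~_ (Anyₚ.lookup-index i) (Anyₚ.lookup-index w∈) e) (class-walk p w∈ j)
    where w∈ = ∈-class (trans (≡.sym (rep-adj e)) (proj₂ (∈-filter⁻ (λ v → rep v Finₚ.≟ r) {xs = allFin _} i)))

  class-connected : ∀ r i j → Walk (induced G (class r)) i j
  class-connected r i j = ≡.subst₂ (Walk (induced G (class r))) (index-∈-lookup i) (index-∈-lookup j)
    (class-walk (walk-trans (to-rep i) (walk-sym (to-rep j))) (∈-lookup i) (∈-lookup j))
    where
    index-∈-lookup : ∀ k → Any.index (∈-lookup {xs = class r} k) ≡ k
    index-∈-lookup k = lookup-injective (class-unique r) _ _ (≡.sym (Anyₚ.lookup-index (∈-lookup {xs = class r} k)))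
    to-rep : ∀ k → Walk G (lookup (class r) k) r
    to-rep k = subst (Walk G _) (proj₂ (∈-filter⁻ (λ v → rep v Finₚ.≟ r) {xs = allFin _} (∈-lookup k)))
      (proj₁ (proj₂ merged) _)

  color-components : ∀ {c} → (∀ us → Unique us → Connected (induced G us) → Colorable (induced G us) c) → Colorable G c
  color-components {c} color = col , λ u v e → differ (rep-adj e) (∈-class refl) (∈-class refl) e
    where
    classColor : ∀ r → Colorable (induced G (class r)) c
    classColor r with 0 <? length (class r)
    ... | yes nonempty = color (class r) (class-unique r) (nonempty , class-connected r)
    ... | no empty = (λ i → contradiction (≤-trans (s≤s z≤n) (Finₚ.toℕ<n i)) empty)
                   , λ i → contradiction (≤-trans (s≤s z≤n) (Finₚ.toℕ<n i)) empty
    col : V → Fin c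
    col v = proj₁ (classColor (rep v)) (Any.index (∈-class {v = v} refl))
    differ : ∀ {r s u v} → r ≡ s → (i : u ∈ class r) (j : v ∈ class s) → u ~ v →
      proj₁ (classColor r) (Any.index i) ≢ proj₁ (classColor s) (Any.index j)
    differ {r} refl i j e = proj₂ (classColor r) _ _ (≡.subst₂ _~_ (Anyₚ.lookup-index i) (Anyₚ.lookup-index j) e)

InClass : ℕ → Graph → Set
InClass n G = ¬ Contains G (complete n) × ¬ Contains G (S* n) × ¬ Contains G (F1 n) × ¬ Contains G (F2 n)

InClass-hereditary : ∀ {n G H} → Contains G H → InClass n G → InClass n H
InClass-hereditary g (k , s , f , f′) =
  k ∘ Contains-trans g , s ∘ Contains-trans g , f ∘ Contains-trans g , f′ ∘ Contains-trans g

module Neighbourhoods (G : Graph) where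
  open Adjacency G

  -- Colourings of closed neighbourhoods, defined on all of V with no demand elsewhere; the extra
  -- colour is spent on d itself.
  LocallyColorable : ℕ → Set
  LocallyColorable c = ∀ d → Σ (V → Fin (suc c)) λ col →
    ∀ u v → d ≡ u ⊎ d ~ u → d ≡ v ⊎ d ~ v → u ~ v → col u ≢ col v

  nbrs : V → List V
  nbrs d = filter (d ~?_) (allFin _)

  nbrs-unique : ∀ d → Unique (nbrs d)
  nbrs-unique d = Uniqueₚ.filter⁺ _ (Uniqueₚ.allFin⁺ _)

  locally-colorable : ∀ {c} → (∀ d → Colorable (induced G (nbrs d)) c) → LocallyColorable c
  locally-colorable {c} color d = col , proper
    where
    mem : ∀ {v} → d ~ v → v ∈ nbrs d
    mem {v} = ∈-filter⁺ (d ~?_) (∈-allFin v)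
    paint : ∀ {v} → Dec (d ~ v) → Fin (suc c)
    paint (yes e) = Fin.suc (proj₁ (color d) (Any.index (mem e)))
    paint (no _) = Fin.zero
    col : V → Fin (suc c)
    col v = paint (d ~? v)
    proper : ∀ u v → d ≡ u ⊎ d ~ u → d ≡ v ⊎ d ~ v → u ~ v → col u ≢ col v
    proper u v nu nv e with d ~? u | d ~? v
    proper u v nu nv e | yes eu | yes ev = λ eq → proj₂ (color d) _ _
      (≡.subst₂ _~_ (Anyₚ.lookup-index (mem eu)) (Anyₚ.lookup-index (mem ev)) e) (Finₚ.suc-injective eq)
    proper u v nu nv e | yes eu | no _ = λ ()
    proper u v nu nv e | no _ | yes ev = λ ()
    proper u v (inj₁ refl) (inj₁ refl) e | no _ | no _ = contradiction refl (~⇒≢ e)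
    proper u v (inj₂ eu) _ e | no ne | no _ = contradiction eu ne
    proper u v (inj₁ _) (inj₂ ev) e | no _ | no ne = contradiction ev ne

  cone : ∀ {ω} d → Contains (induced G (nbrs d)) (complete ω) → Contains G (complete (suc ω))
  cone {ω} d g = record { map = f ; inj = λ {i} {j} → f-inj i j ; pres = f-pres }
    where
    f : Fin (suc ω) → V
    f Fin.zero = d
    f (Fin.suc i) = lookup (nbrs d) (map g i)
    spoke : ∀ i → d ~ lookup (nbrs d) (map g i)
    spoke i = proj₂ (∈-filter⁻ (d ~?_) {xs = allFin _} (∈-lookup (map g i)))
    f-inj : ∀ i j → f i ≡ f j → i ≡ j
    f-inj Fin.zero Fin.zero _ = refl
    f-inj Fin.zero (Fin.suc j) eq = contradiction eq (~⇒≢ (spoke j))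
    f-inj (Fin.suc i) Fin.zero eq = contradiction (≡.sym eq) (~⇒≢ (spoke i))
    f-inj (Fin.suc i) (Fin.suc j) eq = cong Fin.suc (inj g (lookup-injective (nbrs-unique d) _ _ eq))
    f-pres : ∀ i j → adj G (f i) (f j) ≡ adj (complete (suc ω)) i j
    f-pres Fin.zero Fin.zero = irrefl G d
    f-pres Fin.zero (Fin.suc j) = spoke j
    f-pres (Fin.suc i) Fin.zero = ~-sym (spoke i)
    f-pres (Fin.suc i) (Fin.suc j) = pres g i j

levelParity : ℕ → Fin 2
levelParity zero          = Fin.zero
levelParity (suc zero)    = Fin.suc Fin.zero
levelParity (suc (suc k)) = levelParity k

levelParity-suc : ∀ k → levelParity k ≢ levelParity (suc k)
levelParity-suc zero = λ ()
levelParity-suc (suc zero) = λ ()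
levelParity-suc (suc (suc k)) = levelParity-suc k

-- A colour consists of a dominator or strand, a parity of the level, and a colour from one closed
-- neighbourhood.
chiBound : ℕ → ℕ → ℕ
chiBound n zero = 0
chiBound n (suc ω) = (dominatorBound n + ballBound n (7 + n + n)) * (2 * suc (chiBound n ω))

module ConnectedColoring (n : ℕ) (G : Graph) (L : Distance.Levelling G)
  (F1-free : ¬ Contains G (F1 n)) (F2-free : ¬ Contains G (F2 n)) (D : Decomposed n G L F1-free F2-free) where
  open Adjacency G
  open Distance G
  open Levelling L
  open LevelPaths G L
  open Attachment n G L F1-free F2-free
  open Decomposed D
  open Neighbourhoods G

  Label : Set
  Label = Fin (length dominators) ⊎ Fin (length strands)

  -- A vertex of level k labelled by a strand lies in a bag there, and the whole bag sees the strand
  -- vertex at level k - 1.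
  centre : Label → ℕ → V
  centre (inj₁ i) k = lookup dominators i
  centre (inj₂ j) k = anc (lookup strands j) (pred k)

  label-of : ∀ {t} → Any (λ d → Near d t) dominators ⊎ Any (OnStrand t) strands → Label
  label-of = Sum.map Any.index Any.index

  label-near : ∀ {t} (h : Any (λ d → Near d t) dominators ⊎ Any (OnStrand t) strands) → Near (centre (label-of h) (lev t)) t
  label-near (inj₁ h) = Anyₚ.lookup-index h
  label-near {t} (inj₂ h) with lookup strands (Any.index h) | Anyₚ.lookup-index h
  ... | w | k , _ , _ , b rewrite level b = inj₂ (~-sym (below b))

  label : V → Label
  label t = label-of (covered t)

  -- Every level is dominated by boundedly many vertices, since a bag lies in the
  -- neighbourhood of one path vertex; levels of equal parity do not interfere.
  connected-color : ∀ {c} → LocallyColorable c → Colorable G ((dominatorBound n + ballBound n (7 + n + n)) * (2 * suc c))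
  connected-color {c} local = col , proper
    where
    code : Label → Fin (dominatorBound n + ballBound n (7 + n + n))
    code l = Fin.inject≤ (Fin.join _ _ l) (+-mono-≤ length-dominators length-strands)
    code-inj : ∀ {l l′} → code l ≡ code l′ → l ≡ l′
    code-inj {l} {l′} eq = trans (≡.sym (Finₚ.splitAt-join _ _ l)) (trans
      (cong (Fin.splitAt _) (Finₚ.inject≤-injective _ _ _ _ eq)) (Finₚ.splitAt-join _ _ l′))
    shade : V → Fin (suc c)
    shade t = proj₁ (local (centre (label t) (lev t))) t
    col : V → Fin ((dominatorBound n + ballBound n (7 + n + n)) * (2 * suc c))
    col t = Fin.combine (code (label t)) (Fin.combine (levelParity (lev t)) (shade t))
    same-level : ∀ {u v} → u ~ v → levelParity (lev u) ≡ levelParity (lev v) → lev u ≡ lev v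
    same-level {u} {v} e eq with <-cmp (lev u) (lev v)
    ... | tri≈ _ h _ = h
    ... | tri< lt _ _ = contradiction (trans eq (cong levelParity (≤-antisym (lev-step e) lt))) (levelParity-suc (lev u))
    ... | tri> _ _ gt = contradiction (trans (≡.sym eq) (cong levelParity (≤-antisym (lev-step (~-sym e)) gt))) (levelParity-suc (lev v))
    proper : ∀ u v → u ~ v → col u ≢ col v
    proper u v e eq with Finₚ.combine-injective (code (label u)) (Fin.combine (levelParity (lev u)) (shade u)) (code (label v)) (Fin.combine (levelParity (lev v)) (shade v)) eq
    ... | eq₁ , eq₂ with Finₚ.combine-injective (levelParity (lev u)) (shade u) (levelParity (lev v)) (shade v) eq₂
    ...   | eq₃ , eq₄ = proj₂ (local (centre (label v) (lev v))) u v
              (subst (λ d → Near d u) same-centre (label-near (covered u))) (label-near (covered v)) e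
              (trans (cong (λ d → proj₁ (local d) u) (≡.sym same-centre)) eq₄)
      where
      same-centre : centre (label u) (lev u) ≡ centre (label v) (lev v)
      same-centre = cong₂ centre (code-inj {label u} {label v} eq₁) (same-level e eq₃)

decomposition : ∀ n G (L : Distance.Levelling G) (free : InClass n G) →
  Decomposed n G L (proj₁ (proj₂ (proj₂ free))) (proj₂ (proj₂ (proj₂ free)))
decomposition n G L (K-free , S*-free , F1-free , F2-free) =
  Decomposition.decomposed n G L K-free S*-free F1-free F2-free

connected-colorable : ∀ n {c} G → Connected G → InClass n G → Neighbourhoods.LocallyColorable G c →
  Colorable G ((dominatorBound n + ballBound n (7 + n + n)) * (2 * suc c))
connected-colorable n G conn free = ConnectedColoring.connected-color n G L _ _ (decomposition n G L free)
  where L = Distance.levelling G conn (fromℕ< (proj₁ conn))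

-- Induction on the clique number: neighbourhoods lose a clique vertex, but may be disconnected.
colorable : ∀ n ω G → ¬ Contains G (complete ω) → InClass n G → Colorable G (chiBound n ω)
colorable n zero G K-free _ = contradiction (record { map = λ () ; inj = λ { {()} } ; pres = λ () }) K-free
colorable n (suc ω) G K-free free = Components.color-components G λ us uniq conn →
  let emb′ = induced-embeds G us uniq
      H = induced G us
      open Neighbourhoods H in
  connected-colorable n H conn (InClass-hereditary {n} emb′ free)
    (locally-colorable λ d → let sub = induced-embeds H (nbrs d) (nbrs-unique d) in
      colorable n ω (induced H (nbrs d)) (λ g → K-free (Contains-trans emb′ (cone d g)))
        (InClass-hereditary {n} (Contains-trans emb′ sub) free))

-- The cover

-- Each dominator gets one star per colour of its closed neighbourhood; each strand gets as many
-- transversal paths as a bag can have vertices.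
coverBound : ℕ → ℕ
coverBound n = dominatorBound n * suc (chiBound n n) + ballBound n (7 + n + n) * ramsey n n

module CoverPieces (n : ℕ) (G : Graph) (L : Distance.Levelling G)
  (F1-free : ¬ Contains G (F1 n)) (F2-free : ¬ Contains G (F2 n)) (D : Decomposed n G L F1-free F2-free)
  (K-free : ¬ Contains G (complete n)) (F3-free : ¬ Contains G (F3 n))
  (c : ℕ) (local : Neighbourhoods.LocallyColorable G c) where
  open Adjacency G
  open Distance G
  open Levelling L
  open LevelPaths G L
  open Attachment n G L F1-free F2-free
  open Bags n G L F1-free F2-free
  open Decomposed D
  open Pieces G

  SomePiece : Set₁
  SomePiece = Σ (V → Set) PieceOf

  starPiece : V → Fin (suc c) → SomePiece
  starPiece d s = _ , star-of d {I = λ v → d ~ v × proj₁ (local d) v ≡ s}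
    (λ v → (d ~? v) ×-dec (proj₁ (local d) v Finₚ.≟ s))
    (λ v → proj₁)
    (λ { u v (du , cu) (dv , cv) e → proj₂ (local d) u v (inj₂ du) (inj₂ dv) e (trans cu (≡.sym cv)) })

  starPieces : V → List SomePiece
  starPieces d = List.map (starPiece d) (allFin (suc c))

  -- The path numbered j takes the vertex numbered j of every bag, or the strand vertex where the
  -- bag is smaller. Such paths may overlap, as a cover permits.
  choice : V → ℕ → ℕ → V
  choice w j i = nth (anc w (suc (i + (2 + n)))) (bagList (anc w) (i + (2 + n))) j

  choice-bag : ∀ w j i → 2 + (i + (2 + n)) + n ≤ lev w → Bag (anc w) (i + (2 + n)) (choice w j i)
  choice-bag w j i fits = nth-total (path-bag (anc-path w) _ (≤-trans (m≤m+n _ n) fits))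
    (Allₚ.all-filter (bag? (anc w) (i + (2 + n))) (allFin _)) j

  strandPieces : ∀ w → Dec (7 + n + n ≤ lev w) → List SomePiece
  strandPieces w (no _) = []
  strandPieces w (yes long) = List.map (λ j → _ , transversal-piece (anc-path w) (<⇒≤ long) (choice w (toℕ j)) (choice-bag w (toℕ j)))
    (allFin (ramsey n n))

  pieces : List SomePiece
  pieces = concatMap starPieces dominators ++ concatMap (λ w → strandPieces w (_ ≤? _)) strands

  length-pieces : length pieces ≤ dominatorBound n * suc c + ballBound n (7 + n + n) * ramsey n n
  length-pieces = ≤-trans (≤-reflexive (Listₚ.length-++ (concatMap starPieces dominators))) (+-mono-≤
    (≤-trans (length-concatMap-≤ (λ d → ≤-reflexive (trans (Listₚ.length-map (starPiece d) (allFin (suc c))) (Listₚ.length-tabulate {n = suc c} id))) dominators)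
      (*-monoˡ-≤ (suc c) length-dominators))
    (≤-trans (length-concatMap-≤ (λ w → strand-length w (_ ≤? _)) strands) (*-monoˡ-≤ (ramsey n n) length-strands)))
    where
    strand-length : ∀ w h → length (strandPieces w h) ≤ ramsey n n
    strand-length w (no _) = z≤n
    strand-length w (yes _) = ≤-reflexive (trans (Listₚ.length-map _ (allFin (ramsey n n))) (Listₚ.length-tabulate {n = ramsey n n} id))

  star-covers : ∀ {t d} → Near d t → Any (λ P → proj₁ P t) (starPieces d)
  star-covers {t} {d} h = Anyₚ.map⁺ (Any.map (λ { refl → on h }) (∈-allFin (proj₁ (local d) t)))
    where
    on : Near d t → t ≡ d ⊎ (d ~ t × proj₁ (local d) t ≡ proj₁ (local d) t)
    on (inj₁ eq) = inj₁ (≡.sym eq)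
    on (inj₂ e) = inj₂ (e , refl)

  strand-covers : ∀ {t w} h → 7 + n + n ≤ lev w → OnStrand t w → Any (λ P → proj₁ P t) (strandPieces w h)
  strand-covers (no short) long _ = contradiction long short
  strand-covers {t} {w} (yes long) _ (k , lo , fits , b) with nth-∈ {d = anc w (suc k)} (∈-filter⁺ (bag? (anc w) k) (∈-allFin t) b)
  ... | j , j< , eq = Anyₚ.map⁺ (Any.map (λ { refl → k ∸ (2 + n) , at-fits , at-eq }) (∈-allFin (fromℕ< j<R)))
    where
    j<R : j < ramsey n n
    j<R = ≤-trans j< (bag-small K-free F3-free (anc-path w) k (≤-trans (m≤n+m n 3) (s≤s lo)) (<⇒≤ fits))
    k≡ : k ∸ (2 + n) + (2 + n) ≡ k
    k≡ = m∸n+n≡m lo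
    at-fits : 2 + (k ∸ (2 + n) + (2 + n)) + n ≤ lev w
    at-fits = subst (λ l → 2 + l + n ≤ lev w) (≡.sym k≡) (<⇒≤ fits)
    at-eq : choice w (toℕ (fromℕ< j<R)) (k ∸ (2 + n)) ≡ t
    at-eq = trans (cong₂ (λ i l → nth (anc w (suc l)) (bagList (anc w) l) i) (Finₚ.toℕ-fromℕ< j<R) k≡) eq

  covers : ∀ t → Any (λ P → proj₁ P t) pieces
  covers t with covered t
  ... | inj₁ h = Anyₚ.++⁺ˡ (Anyₚ.concatMap⁺ starPieces (Any.map star-covers h))
  ... | inj₂ h = Anyₚ.++⁺ʳ (concatMap starPieces dominators) (Anyₚ.concatMap⁺ (λ w → strandPieces w (_ ≤? _))
        (Any.map (λ {w} (long , on) → strand-covers {t} {w} (_ ≤? _) long on) (both strands-long h)))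
    where
    both : ∀ {P Q : V → Set} {us} → All P us → Any Q us → Any (λ u → P u × Q u) us
    both (p ∷ _) (here q) = here (p , q)
    both (_ ∷ ps) (there h) = there (both ps h)

bounded-cover : ∀ n G → Connected G → InClass n G → ¬ Contains G (F3 n) → inspc≤ G (coverBound n)
bounded-cover n G conn free F3-free = List.map (λ P → piece (proj₂ P)) pieces
  , ≤-trans (≤-reflexive (Listₚ.length-map _ pieces)) length-pieces , Pieces.covering G pieces covers
  where
  L = Distance.levelling G conn (fromℕ< (proj₁ conn))
  open Neighbourhoods G
  local : LocallyColorable (chiBound n n)
  local = locally-colorable λ d → let sub = induced-embeds G (nbrs d) (nbrs-unique d) in
    colorable n n (induced G (nbrs d)) (proj₁ (InClass-hereditary {n} sub free)) (InClass-hereditary {n} sub free)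
  open CoverPieces n G L _ _ (decomposition n G L free) (proj₁ free) F3-free (chiBound n n) local
  open Pieces G using (piece)

-- The partition

-- At most `matchBound n` centres, each with its own star and a recursive split of its
-- neighbourhood, where cliques are smaller.
splitBound : ℕ → ℕ → ℕ
splitBound n zero    = 0
splitBound n (suc m) = matchBound n * suc (splitBound n m)

module Partitions (G : Graph) where
  open Adjacency G
  open Pieces G

  record Partition (S : V → Set) (c : ℕ) : Set where
    field
      members  : List (SPPiece G)
      few      : length members ≤ c
      disjoint : AllPairs Disjoint members
      inside   : All (λ p → ∀ v → InPiece p v → S v) members
      covering-all : ∀ v → S v → Any (λ p → InPiece p v) members
  open Partition public

  empty-partition : ∀ {S} → (∀ v → ¬ S v) → Partition S 0
  empty-partition none = record
    { members = [] ; few = z≤n ; disjoint = [] ; inside = [] ; covering-all = λ v s → contradiction s (none v) }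

  piece-partition : ∀ {S} → PieceOf S → Partition S 1
  piece-partition P = record
    { members = piece P ∷ [] ; few = s≤s z≤n ; disjoint = [] ∷ [] ; inside = sound-piece P ∷ []
    ; covering-all = λ v s → here (complete-piece P v s) }

  union-partition : ∀ {S T a b} → Partition S a → Partition T b → (∀ v → S v → T v → ⊥) →
    Partition (λ v → S v ⊎ T v) (a + b)
  union-partition P Q apart = record
    { members = members P ++ members Q
    ; few = ≤-trans (≤-reflexive (Listₚ.length-++ (members P))) (+-mono-≤ (few P) (few Q))
    ; disjoint = AllPairsₚ.++⁺ (disjoint P) (disjoint Q)
        (All.map (λ p⊆ → All.map (λ q⊆ v p q → apart v (p⊆ v p) (q⊆ v q)) (inside Q)) (inside P))
    ; inside = Allₚ.++⁺ (All.map (λ p⊆ v h → inj₁ (p⊆ v h)) (inside P)) (All.map (λ q⊆ v h → inj₂ (q⊆ v h)) (inside Q))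
    ; covering-all = λ { v (inj₁ s) → Anyₚ.++⁺ˡ (covering-all P v s)
                       ; v (inj₂ t) → Anyₚ.++⁺ʳ (members P) (covering-all Q v t) } }

  resp-partition : ∀ {S T a b} → a ≤ b → (∀ v → S v → T v) → (∀ v → T v → S v) → Partition S a → Partition T b
  resp-partition a≤b to from P = record
    { members = members P ; few = ≤-trans (few P) a≤b ; disjoint = disjoint P
    ; inside = All.map (λ p⊆ v h → to v (p⊆ v h)) (inside P) ; covering-all = λ v t → covering-all P v (from v t) }

  -- `I` is meant for the leaves of a star whose centre sees all of W; `star-partition` supplies
  -- that centre from outside W.
  record Split (b : ℕ) (W : V → Set) : Set₁ where
    field
      I     : V → Set
      I?    : Decidable I
      I⊆W   : ∀ v → I v → W v
      indep : ∀ u v → I u → I v → ¬ u ~ v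
      rest  : Partition (λ v → W v × ¬ I v) b

  _∈?_ : ∀ v (us : List V) → Dec (v ∈ us)
  v ∈? us = Any.any? (v Finₚ.≟_) us

  -- Each centre in turn claims the neighbours not yet claimed. The independent part of their split
  -- becomes its leaves and the rest brings its own partition. The split is assumed for every
  -- decidable part of a neighbourhood, since earlier claims leave only a part.
  star-partition : ∀ b (Y : List V) → Unique Y → {S : V → Set} → Decidable S →
    (∀ v → S v → ¬ v ∈ Y) → (∀ v → S v → Any (_~ v) Y) →
    (∀ c W → Decidable W → c ∈ Y → (∀ v → W v → S v × c ~ v) → Split b W) →
    Partition (λ v → v ∈ Y ⊎ S v) (length Y * suc b)
  star-partition b [] _ S? outside nbr split = empty-partition λ { v (inj₂ s) → contradiction (nbr v s) λ () }
  star-partition b (c ∷ Y) (c∉Y ∷ uniq) {S} S? outside nbr split =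
    resp-partition ≤-refl to from
      (union-partition (piece-partition hub)
        (union-partition rest tail (λ { v (w , _) (inj₁ v∈) → outside v (proj₁ w) (there v∈)
                                      ; v (w , _) (inj₂ (_ , c≁)) → c≁ (proj₂ w) }))
        hub-apart)
    where
    W : V → Set
    W v = S v × c ~ v
    open Split (split c W (λ v → S? v ×-dec (c ~? v)) (here refl) (λ v w → w))
    hub : PieceOf (λ v → v ≡ c ⊎ I v)
    hub = star-of c I? (λ v i → proj₂ (I⊆W v i)) indep
    S′ : V → Set
    S′ v = S v × ¬ c ~ v
    nbr′ : ∀ v → S′ v → Any (_~ v) Y
    nbr′ v (s , c≁) with nbr v s
    ... | here e = contradiction e c≁
    ... | there h = h
    tail : Partition (λ v → v ∈ Y ⊎ S′ v) (length Y * suc b)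
    tail = star-partition b Y uniq (λ v → S? v ×-dec ¬? (c ~? v)) (λ v (s , _) v∈ → outside v s (there v∈)) nbr′
      (λ d W′ W′? d∈ W′⊆ → split d W′ W′? (there d∈) (λ v w → proj₁ (proj₁ (W′⊆ v w)) , proj₂ (W′⊆ v w)))
    hub-apart : ∀ v → v ≡ c ⊎ I v → (W v × ¬ I v) ⊎ (v ∈ Y ⊎ S′ v) → ⊥
    hub-apart v (inj₁ refl) (inj₁ ((s , _) , _)) = outside v s (here refl)
    hub-apart v (inj₁ refl) (inj₂ (inj₁ v∈)) = All.lookup c∉Y v∈ refl
    hub-apart v (inj₁ refl) (inj₂ (inj₂ (s , _))) = outside v s (here refl)
    hub-apart v (inj₂ i) (inj₁ (_ , ¬i)) = ¬i i
    hub-apart v (inj₂ i) (inj₂ (inj₁ v∈)) = outside v (proj₁ (I⊆W v i)) (there v∈)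
    hub-apart v (inj₂ i) (inj₂ (inj₂ (_ , c≁))) = c≁ (proj₂ (I⊆W v i))
    to : ∀ v → (v ≡ c ⊎ I v) ⊎ ((W v × ¬ I v) ⊎ (v ∈ Y ⊎ S′ v)) → v ∈ (c ∷ Y) ⊎ S v
    to v (inj₁ (inj₁ eq)) = inj₁ (here eq)
    to v (inj₁ (inj₂ i)) = inj₂ (proj₁ (I⊆W v i))
    to v (inj₂ (inj₁ (w , _))) = inj₂ (proj₁ w)
    to v (inj₂ (inj₂ (inj₁ v∈))) = inj₁ (there v∈)
    to v (inj₂ (inj₂ (inj₂ (s , _)))) = inj₂ s
    from : ∀ v → v ∈ (c ∷ Y) ⊎ S v → (v ≡ c ⊎ I v) ⊎ ((W v × ¬ I v) ⊎ (v ∈ Y ⊎ S′ v))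
    from v (inj₁ (here eq)) = inj₁ (inj₁ eq)
    from v (inj₁ (there v∈)) = inj₂ (inj₂ (inj₁ v∈))
    from v (inj₂ s) with c ~? v | I? v
    ... | no c≁ | _ = inj₂ (inj₂ (inj₂ (s , c≁)))
    ... | yes e | yes i = inj₁ (inj₂ i)
    ... | yes e | no ¬i = inj₂ (inj₁ ((s , e) , ¬i))

  module _ (n : ℕ) (K-free : ¬ Contains G (complete n)) (S~-free : ¬ Contains G (S~ n)) where
    open InducedMatching n G K-free

    -- The non-isolated vertices of W are dominated by few vertices Y of W, because an induced
    -- matching in N(d) gives S~; the clique number drops on passing to W ∩ N(y) for y ∈ Y.
    neighbourhood-split : ∀ m d W → Decidable W → (∀ v → W v → d ~ v) →
      (∀ us → length us ≡ m → All W us → AllPairs _~_ us → ⊥) → Split (splitBound n m) W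
    neighbourhood-split zero d W W? near clique-free = ⊥-elim (clique-free [] refl [] [])
    neighbourhood-split (suc m) d W W? near clique-free
      with few-dominate {A = W} {T = λ v → W v × ∃[ u ] W u × u ~ v} W?
             (λ v → W? v ×-dec Finₚ.any? (λ u → W? u ×-dec (u ~? v))) (λ v → proj₂)
             (λ M → S~-free (spider eS~ true (λ _ → refl) (λ _ → refl) (λ { zero _ → refl ; (suc _) _ → refl })
               (λ _ _ → ∨-identityʳ _) (λ _ _ → refl) d near (λ v (w , _) → ~⇒≢ (near v w) , near v w) M))
    ... | Y₀ , len , Y₀⊆W , dom = record
        { I = λ v → W v × ¬ Busy v × ¬ v ∈ Y
        ; I? = λ v → W? v ×-dec ¬? (Busy? v) ×-dec ¬? (v ∈? Y)
        ; I⊆W = λ v → proj₁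
        ; indep = λ u v (wu , _ , _) (wv , ¬t , _) e → ¬t (wv , u , wu , e)
        ; rest = resp-partition (*-monoˡ-≤ (suc (splitBound n m)) length-Y) to from
            (star-partition (splitBound n m) Y (deduplicate-! Finₚ._≟_ Y₀)
              (λ v → Busy? v ×-dec ¬? (v ∈? Y)) (λ v → proj₂)
              (λ v (t , _) → Anyₚ.deduplicate⁺ Finₚ._≟_ (λ { refl e → e }) (dom v t))
              (λ c W′ W′? c∈ W′⊆ → neighbourhood-split m c W′ W′? (λ v w → proj₂ (W′⊆ v w))
                (λ us eq in-W′ pairs → clique-free (c ∷ us) (cong suc eq)
                  (All.lookup Y⊆W c∈ ∷ All.map (λ {v} w → proj₁ (proj₁ (proj₁ (W′⊆ v w)))) in-W′)
                  (All.map (λ {v} w → proj₂ (W′⊆ v w)) in-W′ ∷ pairs)))) }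
      where
      Busy : V → Set
      Busy v = W v × ∃[ u ] W u × u ~ v
      Busy? : Decidable Busy
      Busy? v = W? v ×-dec Finₚ.any? (λ u → W? u ×-dec (u ~? v))
      Y : List V
      Y = List.deduplicate Finₚ._≟_ Y₀
      Y⊆W : All W Y
      Y⊆W = Allₚ.deduplicate⁺ Finₚ._≟_ Y₀⊆W
      length-Y : length Y ≤ matchBound n
      length-Y = ≤-trans (length-deduplicate-≤ Y₀) len
      to : ∀ v → v ∈ Y ⊎ (Busy v × ¬ v ∈ Y) → W v × ¬ (W v × ¬ Busy v × ¬ v ∈ Y)
      to v (inj₁ v∈) = All.lookup Y⊆W v∈ , λ (_ , _ , v∉) → v∉ v∈
      to v (inj₂ (t , v∉)) = proj₁ t , λ (_ , ¬t , _) → ¬t t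
      from : ∀ v → W v × ¬ (W v × ¬ Busy v × ¬ v ∈ Y) → v ∈ Y ⊎ (Busy v × ¬ v ∈ Y)
      from v (w , ¬i) with v ∈? Y | Busy? v
      ... | yes v∈ | _ = inj₁ v∈
      ... | no v∉ | yes t = inj₂ (t , v∉)
      ... | no v∉ | no ¬t = contradiction (w , ¬t , v∉) ¬i

-- One path per strand. Each dominator yields as centres itself and two vertices on every strand,
-- and each centre costs a star and the pieces of a split.
partitionBound : ℕ → ℕ
partitionBound n = ballBound n (7 + n + n) +
  dominatorBound n * suc (ballBound n (7 + n + n) * 2) * suc (splitBound n n)

module PartitionPieces (n : ℕ) (G : Graph) (L : Distance.Levelling G)
  (F1-free : ¬ Contains G (F1 n)) (F2-free : ¬ Contains G (F2 n)) (D : Decomposed n G L F1-free F2-free)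
  (K-free : ¬ Contains G (complete n)) (S~-free : ¬ Contains G (S~ n))
  (F4-free : ¬ Contains G (F4 n)) (F5-free : ¬ Contains G (F5 n)) where
  open Adjacency G
  open Distance G
  open Levelling L
  open LevelPaths G L
  open Attachment n G L F1-free F2-free
  open Bags n G L F1-free F2-free
  open Decomposed D
  open Pieces G
  open Partitions G

  -- What `OnStrand` becomes when bags are trivial, with lev v for suc k and the same bounds.
  record On (w v : V) : Set where
    constructor on
    field
      lower   : 3 + n ≤ lev v
      upper   : 2 + lev v + n ≤ lev w
      on-path : anc w (lev v) ≡ v
  open On

  on? : ∀ w v → Dec (On w v)
  on? w v = map′ (λ (a , b , c) → on a b c) (λ o → lower o , upper o , on-path o)
    ((3 + n ≤? lev v) ×-dec (2 + lev v + n ≤? lev w) ×-dec (anc w (lev v) Finₚ.≟ v))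

  OnSome : List V → V → Set
  OnSome ws v = Any (λ w → On w v) ws

  Off : V → Set
  Off v = ¬ OnSome strands v

  off? : Decidable Off
  off? v = ¬? (Any.any? (λ w → on? w v) strands)

  descend-eq : ∀ w w′ d {j} → d + j ≤ lev w → d + j ≤ lev w′ → anc w (d + j) ≡ anc w′ (d + j) → anc w j ≡ anc w′ j
  descend-eq w w′ zero _ _ eq = eq
  descend-eq w w′ (suc d) h h′ eq = descend-eq w w′ d (<⇒≤ h) (<⇒≤ h′)
    (trans (anc-suc w h) (trans (cong parent eq) (≡.sym (anc-suc w′ h′))))

  -- Tree paths through v agree at every level below that of v. Together with `same-start` this
  -- makes the strands disjoint.
  on-start : ∀ {w w′ v} → On w v → On w′ v → anc w (3 + n) ≡ anc w′ (3 + n)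
  on-start {w} {w′} {v} o o′ = descend-eq w w′ (lev v ∸ (3 + n)) (below-top o) (below-top o′)
    (subst (λ l → anc w l ≡ anc w′ l) (≡.sym (m∸n+n≡m (lower o))) (trans (on-path o) (≡.sym (on-path o′))))
    where
    below-top : ∀ {w} → On w v → lev v ∸ (3 + n) + (3 + n) ≤ lev w
    below-top o′ = ≤-trans (≤-reflexive (m∸n+n≡m (lower o))) (≤-trans (≤-trans (m≤n+m _ 2) (m≤m+n _ n)) (upper o′))

  strand-piece : ∀ w → 7 + n + n ≤ lev w → PieceOf (On w)
  strand-piece w long = record
    { piece = piece Q
    ; complete-piece = λ v o → complete-piece Q v (index v o , fits v o , trans (cong (anc w) (index-eq v o)) (on-path o))
    ; sound-piece = λ v h → sound v (sound-piece Q v h) }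
    where
    -- The last path vertex is dropped, so that the transversal ends exactly where `On` does.
    m = pred (lev w)
    suc-m : suc m ≡ lev w
    suc-m = suc-pred-pos long
    P : LevelPath m (anc w)
    P = (λ j j≤ → lev-anc w (≤-trans j≤ (pred[n]≤n {lev w}))) , (λ j j< → anc-~ w (≤-trans j< (pred[n]≤n {lev w})))
    f : ℕ → V
    f i = anc w (suc (i + (2 + n)))
    Q = transversal-piece P (s≤s⁻¹ (≤-trans long (≤-reflexive (≡.sym suc-m)))) f
      (λ i fits → path-bag P (i + (2 + n)) (≤-trans (m≤m+n _ n) fits))
    index : ∀ v → On w v → ℕ
    index v o = lev v ∸ (3 + n)
    index-eq : ∀ v o → suc (index v o + (2 + n)) ≡ lev v
    index-eq v o = trans (≡.sym (+-suc (index v o) (2 + n))) (m∸n+n≡m (lower o))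
    fits : ∀ v o → 2 + (index v o + (2 + n)) + n ≤ m
    fits v o = s≤s⁻¹ (≡.subst₂ _≤_ (cong (λ l → 2 + l + n) (≡.sym (index-eq v o))) (≡.sym suc-m) (upper o))
    sound : ∀ v → (∃[ i ] (2 + (i + (2 + n)) + n ≤ m) × f i ≡ v) → On w v
    sound v (i , fits , refl) = on (≤-trans (s≤s (m≤n+m (2 + n) i)) (≤-reflexive (≡.sym lev-v)))
      (subst (λ l → 2 + l + n ≤ lev w) (≡.sym lev-v) (≤-trans (s≤s fits) (≤-reflexive suc-m)))
      (cong (anc w) lev-v)
      where
      lev-v : lev (f i) ≡ suc (i + (2 + n))
      lev-v = lev-anc w (≤-trans (≤-trans (n≤1+n _) (≤-trans (m≤m+n _ n) fits)) (pred[n]≤n {lev w}))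

  strand-partition : ∀ ws → All (λ w → 7 + n + n ≤ lev w) ws → Unique ws →
    (∀ {w w′ v} → w ∈ ws → w′ ∈ ws → On w v → On w′ v → w ≡ w′) → Partition (OnSome ws) (length ws)
  strand-partition [] _ _ _ = empty-partition λ v ()
  strand-partition (w ∷ ws) (long ∷ longs) (w∉ ∷ uniq) inj = resp-partition ≤-refl
    (λ v → [ here , there ]′) (λ { v (here o) → inj₁ o ; v (there h) → inj₂ h })
    (union-partition (piece-partition (strand-piece w long))
      (strand-partition ws longs uniq (λ a b → inj (there a) (there b)))
      λ v o h → apart o h)
    where
    apart : ∀ {v} → On w v → OnSome ws v → ⊥
    apart {v} o h = let (w′ , w′∈ , o′) = find h in
      All.lookup w∉ w′∈ (inj (here refl) (there w′∈) o o′)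

  beside : V → V → List V
  beside d w = anc w (pred (lev d)) ∷ anc w (suc (lev d)) ∷ []

  -- For d on a strand the useful entries are its two neighbours on that path. As `centres` filters
  -- out strand vertices, they matter only just beyond the ends of the strand.
  candidates : V → List V
  candidates d = d ∷ concatMap (beside d) strands

  centres : List V
  centres = List.deduplicate Finₚ._≟_ (filter off? (concatMap candidates dominators))

  length-centres : length centres ≤ dominatorBound n * suc (ballBound n (7 + n + n) * 2)
  length-centres = ≤-trans (length-deduplicate-≤ (filter off? (concatMap candidates dominators)))
    (≤-trans (Listₚ.length-filter off? (concatMap candidates dominators))
    (≤-trans (length-concatMap-≤ (λ d → s≤s (≤-trans (length-concatMap-≤ (λ w → ≤-refl) strands) (*-monoˡ-≤ 2 length-strands))) dominators)
      (*-monoˡ-≤ _ length-dominators)))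

  centre : ∀ {P : V → Set} → Any (Any P ∘ candidates) dominators → (∀ {v} → P v → Off v) → Any P centres
  centre {P} h P⊆ = Anyₚ.deduplicate⁺ Finₚ._≟_ (λ { refl e → e })
    (let (v , v∈ , p) = find (Anyₚ.concatMap⁺ candidates h) in
      lose (∈-filter⁺ off? v∈ (P⊆ p)) p)

  -- Closure puts t into a bag of the path to w, and bags are trivial. So t is itself a path vertex,
  -- one level from d.
  beside-strand : ∀ {d w t} → On w d → d ~ t → t ∈ beside d w
  beside-strand {d} {w} {t} o e = place (nearby P (level d-bag) (lev t) (bound-t) (subst (d ~_) (≡.sym t≡) e))
    where
    P = anc-path w
    k = pred (lev d)
    lev-d : lev d ≡ suc k
    lev-d = ≡.sym (suc-pred-pos (lower o))
    lo : 2 + n ≤ k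
    lo = s≤s⁻¹ (subst (3 + n ≤_) lev-d (lower o))
    hi : 3 + k + n ≤ lev w
    hi = subst (λ l → 2 + l + n ≤ lev w) lev-d (upper o)
    d-bag : Bag (anc w) k d
    d-bag = subst (Bag (anc w) k) (trans (cong (anc w) (≡.sym lev-d)) (on-path o))
      (path-bag P k (≤-trans (≤-trans (m≤n+m (2 + k) 1) (m≤m+n (3 + k) n)) hi))
    k≤t : k ≤ lev t
    k≤t = s≤s⁻¹ (≤-trans (≤-reflexive (≡.sym lev-d)) (lev-step (~-sym e)))
    t≤k : lev t ≤ 2 + k
    t≤k = ≤-trans (lev-step e) (≤-reflexive (cong suc lev-d))
    lev-t : lev t ≡ suc (pred (lev t))
    lev-t = ≡.sym (suc-pred-pos (≤-trans lo k≤t))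
    bound-t : lev t ≤ lev w
    bound-t = ≤-trans t≤k (≤-trans (≤-trans (m≤n+m (2 + k) 1) (m≤m+n (3 + k) n)) hi)
    t≡ : anc w (lev t) ≡ t
    t≡ = ≡.sym (trans (bag-trivial F4-free F5-free P (≤-trans (≤-trans (m≤n+m n 2) lo) (≤-trans k≤t (≤-reflexive lev-t)))
        (≤-trans (+-monoˡ-≤ n (s≤s (≤-trans (≤-reflexive (≡.sym lev-t)) t≤k))) hi)
        (bag-closed P (≤-trans (n≤1+n _) lo) hi d-bag e lev-t))
      (cong (anc w) (≡.sym lev-t)))
    place : lev t ≡ k ⊎ lev t ≡ suc k ⊎ lev t ≡ 2 + k → t ∈ beside d w
    place (inj₁ eq) = here (trans (≡.sym t≡) (cong (anc w) eq))
    place (inj₂ (inj₁ eq)) = contradiction (trans (≡.sym (on-path o)) (trans (cong (anc w) (trans lev-d (≡.sym eq))) t≡)) (~⇒≢ e)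
    place (inj₂ (inj₂ eq)) = there (here (trans (≡.sym t≡) (cong (anc w) (trans eq (cong suc (≡.sym lev-d))))))

  -- A dominator on a strand is replaced by its neighbours, all of which are strand vertices.
  centres-dominate : ∀ t → Off t → t ∈ centres ⊎ Any (_~ t) centres
  centres-dominate t off with covered t
  ... | inj₂ h = contradiction (Any.map on-strand h) off
    where
    on-strand : ∀ {w} → OnStrand t w → On w t
    on-strand {w} (k , lo , hi , b) = on (≤-trans (s≤s lo) (≤-reflexive (≡.sym (level b))))
      (subst (λ l → 2 + l + n ≤ lev w) (≡.sym (level b)) hi)
      (trans (cong (anc w) (level b)) (≡.sym (bag-trivial F4-free F5-free (anc-path w) (≤-trans (m≤n+m n 3) (s≤s lo)) (<⇒≤ hi) b)))
  ... | inj₁ h with find h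
  ...   | d , d∈ , inj₁ refl = inj₁ (centre (lose d∈ (here refl)) (λ { refl → off }))
  ...   | d , d∈ , inj₂ e with off? d
  ...     | yes d-off = inj₂ (Any.map (λ { (refl , e′) → e′ })
              (centre {P = λ v → d ≡ v × v ~ t} (lose d∈ (here (refl , e))) (λ { (refl , _) → d-off })))
  ...     | no ¬off with Any.any? (λ w → on? w d) strands
  ...       | no none = contradiction none ¬off
  ...       | yes some = inj₁ (centre (lose d∈
                (there (Anyₚ.concatMap⁺ (beside d) (Any.map (λ o → beside-strand o e) some)))) (λ { refl → off }))

  off-partition : Partition Off (length centres * suc (splitBound n n))
  off-partition = resp-partition ≤-refl to from
    (star-partition (splitBound n n) centres (deduplicate-! Finₚ._≟_ _) {S = λ v → Off v × ¬ v ∈ centres}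
      (λ v → off? v ×-dec ¬? (v ∈? centres)) (λ v → proj₂) nbr
      (λ c W W? _ W⊆ → neighbourhood-split n K-free S~-free n c W W? (λ v w → proj₂ (W⊆ v w))
        (λ us eq _ pairs → K-free (subst (Contains G ∘ complete) eq (clique us pairs)))))
    where
    nbr : ∀ v → Off v × ¬ v ∈ centres → Any (_~ v) centres
    nbr v (off , v∉) with centres-dominate v off
    ... | inj₁ v∈ = contradiction v∈ v∉
    ... | inj₂ h = h
    centres-off : All Off centres
    centres-off = Allₚ.deduplicate⁺ Finₚ._≟_ (Allₚ.all-filter off? (concatMap candidates dominators))
    to : ∀ v → v ∈ centres ⊎ (Off v × ¬ v ∈ centres) → Off v
    to v (inj₁ v∈) = All.lookup centres-off v∈
    to v (inj₂ (off , _)) = off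
    from : ∀ v → Off v → v ∈ centres ⊎ (Off v × ¬ v ∈ centres)
    from v off with v ∈? centres
    ... | yes v∈ = inj₁ v∈
    ... | no v∉ = inj₂ (off , v∉)

  partition : Partition (λ v → OnSome strands v ⊎ Off v) (partitionBound n)
  partition = resp-partition
    (+-mono-≤ length-strands (*-monoˡ-≤ (suc (splitBound n n)) length-centres)) (λ v h → h) (λ v h → h)
    (union-partition
      (strand-partition strands strands-long strands-unique (λ w∈ w′∈ o o′ → same-start w∈ w′∈ (on-start o o′)))
      off-partition (λ v h off → off h))

  inspp : inspp≤ G (partitionBound n)
  inspp = members partition , few partition , (λ v → covering-all partition v (somewhere v)) , disjoint partition
    where
    somewhere : ∀ v → OnSome strands v ⊎ Off v
    somewhere v with Any.any? (λ w → on? w v) strands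
    ... | yes h = inj₁ h
    ... | no off = inj₂ off

bounded-partition : ∀ n G → Connected G → InClass n G → ¬ Contains G (S~ n) → ¬ Contains G (F4 n) → ¬ Contains G (F5 n) →
  inspp≤ G (partitionBound n)
bounded-partition n G conn free = PartitionPieces.inspp n G L _ _ (decomposition n G L free) (proj₁ free)
  where L = Distance.levelling G conn (fromℕ< (proj₁ conn))

-- Pieces as trees, and simplicial vertices

any-vec? : ∀ {m} k {P : Vec (Fin m) k → Set} → Decidable P → Dec (∃ P)
any-vec? zero P? = map′ (λ p → Vec.[] , p) (λ { (Vec.[] , p) → p }) (P? Vec.[])
any-vec? (suc k) P? = map′ (λ (a , v , p) → a Vec.∷ v , p) (λ { (a Vec.∷ v , p) → a , v , p })
  (Finₚ.any? λ a → any-vec? k (λ v → P? (a Vec.∷ v)))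

-- Decidability allows the necessity argument to exhibit a member of ℋ inside an unbounded graph, by
-- searching all maps as vectors.
contains? : ∀ G H → Dec (Contains G H)
contains? G H = map′ to from (any-vec? (size H) (λ v →
    Finₚ.all? (λ i → Finₚ.all? (λ j → (Vec.lookup v i Finₚ.≟ Vec.lookup v j) →-dec (i Finₚ.≟ j)))
    ×-dec Finₚ.all? (λ i → Finₚ.all? (λ j → adj G (Vec.lookup v i) (Vec.lookup v j) Boolₚ.≟ adj H i j))))
  where
  IsEmbedding : Vec (Fin (size G)) (size H) → Set
  IsEmbedding v = (∀ i j → Vec.lookup v i ≡ Vec.lookup v j → i ≡ j) ×
                  (∀ i j → adj G (Vec.lookup v i) (Vec.lookup v j) ≡ adj H i j)
  to : ∃ IsEmbedding → Contains G H
  to (v , v-inj , v-pres) = record { map = Vec.lookup v ; inj = λ {i} {j} → v-inj i j ; pres = v-pres }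
  from : Contains G H → ∃ IsEmbedding
  from g = v , (λ i j eq → inj g (trans (≡.sym (at i)) (trans eq (at j))))
             , (λ i j → trans (cong₂ (adj G) (at i) (at j)) (pres g i j))
    where
    v = Vec.tabulate (map g)
    at : ∀ i → Vec.lookup v i ≡ map g i
    at = lookup∘tabulate (map g)

-- Each `a` spoils at most two values of k, so one value survives when there are more than twice as
-- many. Here `a` is a piece, and k a simplicial vertex, a gap or a leg of a spider.
few-bad : ∀ {A : Set} {K} {Bad : A → Fin K → Set} → (∀ a k → Dec (Bad a k)) →
  (∀ a {k₁ k₂ k₃} → k₁ Fin.< k₂ → k₂ Fin.< k₃ → Bad a k₁ → Bad a k₂ → Bad a k₃ → ⊥) →
  ∀ as → length as * 2 < K → ∃[ k ] All (λ a → ¬ Bad a k) as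
few-bad {A} {K} {Bad} bad? thrice as big = let (k , _ , good) = search as (allFin K) (AllPairsₚ.tabulate⁺-< id)
                                                     (subst (length as * 2 <_) (≡.sym (Listₚ.length-tabulate {n = K} id)) big)
                                            in k , good
  where
  at-most-two : ∀ a ks → AllPairs Fin._<_ ks → All (Bad a) ks → length ks ≤ 2
  at-most-two a [] _ _ = z≤n
  at-most-two a (_ ∷ []) _ _ = s≤s z≤n
  at-most-two a (_ ∷ _ ∷ []) _ _ = s≤s (s≤s z≤n)
  at-most-two a (_ ∷ _ ∷ _ ∷ _) ((lt ∷ _) ∷ (lt′ ∷ _) ∷ _) (b₁ ∷ b₂ ∷ b₃ ∷ _) = ⊥-elim (thrice a lt lt′ b₁ b₂ b₃)
  search : ∀ as ks → AllPairs Fin._<_ ks → length as * 2 < length ks → ∃[ k ] k ∈ ks × All (λ a → ¬ Bad a k) as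
  search [] (k ∷ ks) _ _ = k , here refl , []
  search (a ∷ as) ks sorted big with search as (filter (¬? ∘ bad? a) ks) (AllPairsₚ.filter⁺ (¬? ∘ bad? a) sorted)
      (+-cancelˡ-< 2 _ _ (≤-trans big (≤-trans (≤-reflexive (length-filter-split (bad? a) ks)) (+-monoˡ-≤ _
        (at-most-two a (filter (bad? a) ks) (AllPairsₚ.filter⁺ (bad? a) sorted) (Allₚ.all-filter (bad? a) ks))))))
  ... | k , k∈ , good = let (k∈ks , ¬bad) = ∈-filter⁻ (¬? ∘ bad? a) {xs = ks} k∈ in k , k∈ks , ¬bad ∷ good

no-loop : ∀ G i → ¬ adj G i i ≡ true
no-loop G i e = Adjacency.~⇒≢ G e refl

path-adj⇒ : ∀ m (i j : Fin m) → adj (path m) i j ≡ true → toℕ j ≡ suc (toℕ i) ⊎ toℕ i ≡ suc (toℕ j)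
path-adj⇒ m i j e with toℕ i ≡ᵇ toℕ j | toℕ j ≡ᵇ suc (toℕ i) in eq | toℕ i ≡ᵇ suc (toℕ j) in eq′
... | false | true  | _    = inj₁ (true⇒≡ eq)
... | false | false | true = inj₂ (true⇒≡ eq′)

path-adj-suc : ∀ m (i j : Fin m) → toℕ j ≡ suc (toℕ i) → adj (path m) i j ≡ true
path-adj-suc m i j eq rewrite ≡ᵇ-true eq | ≡ᵇ-false {toℕ i} {toℕ j} (λ h → 1+n≢n (≡.sym (trans h eq))) = refl

star-adj⇒ : ∀ m (i j : Fin (suc m)) → adj (star m) i j ≡ true → i ≡ Fin.zero ⊎ j ≡ Fin.zero
star-adj⇒ m Fin.zero j e = inj₁ refl
star-adj⇒ m (Fin.suc i) Fin.zero e = inj₂ refl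
star-adj⇒ m (Fin.suc i) (Fin.suc j) e with toℕ i ≡ᵇ toℕ j
star-adj⇒ m (Fin.suc i) (Fin.suc j) () | false
star-adj⇒ m (Fin.suc i) (Fin.suc j) () | true

Consecutive : ℕ → ℕ → Set
Consecutive a b = b ≡ suc a ⊎ a ≡ suc b

between : ∀ {a b i} → Consecutive a i → Consecutive b i → a ≢ b →
  (i ≡ suc a × b ≡ suc i) ⊎ (i ≡ suc b × a ≡ suc i)
between (inj₁ p) (inj₁ q) ne = contradiction (suc-injective (trans (≡.sym p) q)) ne
between (inj₁ p) (inj₂ q) ne = inj₁ (p , q)
between (inj₂ p) (inj₁ q) ne = inj₂ (q , p)
between (inj₂ p) (inj₂ q) ne = contradiction (trans p (≡.sym q)) ne

-- A common neighbour of two vertices of a path lies midway between them, so it is unique. In a star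
-- each of the edges a i and b j would have to contain the centre, forcing a coincidence or a loop.
shape-no-square : ∀ s (a b i j : Fin (size (shapeGraph s))) → a ≢ b → i ≢ j →
  adj (shapeGraph s) a i ≡ true → adj (shapeGraph s) b i ≡ true →
  adj (shapeGraph s) a j ≡ true → adj (shapeGraph s) b j ≡ true → ⊥
shape-no-square (starS m) a b i j a≢b i≢j ai bi aj bj with star-adj⇒ m a i ai
... | inj₁ refl with star-adj⇒ m b j bj
...   | inj₁ refl = a≢b refl
...   | inj₂ refl = no-loop (star m) Fin.zero aj
shape-no-square (starS m) a b i j a≢b i≢j ai bi aj bj | inj₂ refl with star-adj⇒ m b j bj
...   | inj₁ refl = no-loop (star m) Fin.zero bi
...   | inj₂ refl = i≢j refl
shape-no-square (pathS m) a b i j a≢b i≢j ai bi aj bj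
  with between (path-adj⇒ m a i ai) (path-adj⇒ m b i bi) (a≢b ∘ Finₚ.toℕ-injective)
     | between (path-adj⇒ m a j aj) (path-adj⇒ m b j bj) (a≢b ∘ Finₚ.toℕ-injective)
... | inj₁ (p , _) | inj₁ (q , _) = i≢j (Finₚ.toℕ-injective (trans p (≡.sym q)))
... | inj₂ (p , _) | inj₂ (q , _) = i≢j (Finₚ.toℕ-injective (trans p (≡.sym q)))
... | inj₁ (p , p′) | inj₂ (q , q′) = <-asym {toℕ a} {toℕ b}
      (≤-trans (≤-reflexive (≡.sym p)) (≤-trans (n≤1+n _) (≤-reflexive (≡.sym p′))))
      (≤-trans (≤-reflexive (≡.sym q)) (≤-trans (n≤1+n _) (≤-reflexive (≡.sym q′))))
... | inj₂ (p , p′) | inj₁ (q , q′) = <-asym {toℕ a} {toℕ b}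
      (≤-trans (≤-reflexive (≡.sym q)) (≤-trans (n≤1+n _) (≤-reflexive (≡.sym q′))))
      (≤-trans (≤-reflexive (≡.sym p)) (≤-trans (n≤1+n _) (≤-reflexive (≡.sym p′))))

shape-no-triangle : ∀ s (a b i : Fin (size (shapeGraph s))) →
  adj (shapeGraph s) a b ≡ true → adj (shapeGraph s) a i ≡ true → adj (shapeGraph s) b i ≡ true → ⊥
shape-no-triangle (starS m) a b i ab ai bi with star-adj⇒ m a b ab
... | inj₁ refl = [ (λ { refl → no-loop (star m) Fin.zero ab }) , (λ { refl → no-loop (star m) Fin.zero ai }) ]′ (star-adj⇒ m b i bi)
... | inj₂ refl = [ (λ { refl → no-loop (star m) Fin.zero ab }) , (λ { refl → no-loop (star m) Fin.zero bi }) ]′ (star-adj⇒ m a i ai)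
shape-no-triangle (pathS m) a b i ab ai bi
  with between (path-adj⇒ m a i ai) (path-adj⇒ m b i bi) (Adjacency.~⇒≢ (path m) ab ∘ Finₚ.toℕ-injective) | path-adj⇒ m a b ab
... | inj₁ (p , q) | inj₁ r = 1+n≢n (trans (≡.sym q) (trans r (≡.sym p)))
... | inj₁ (p , q) | inj₂ r = <-asym {toℕ a} {toℕ b} (≤-trans (≤-reflexive (≡.sym p)) (≤-trans (n≤1+n _) (≤-reflexive (≡.sym q)))) (≤-reflexive (≡.sym r))
... | inj₂ (p , q) | inj₁ r = <-asym {toℕ b} {toℕ a} (≤-trans (≤-reflexive (≡.sym p)) (≤-trans (n≤1+n _) (≤-reflexive (≡.sym q)))) (≤-reflexive (≡.sym r))
... | inj₂ (p , q) | inj₂ r = 1+n≢n (trans (≡.sym q) (trans r (≡.sym p)))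

shape-connected : ∀ s → 1 ≤ shapeParam s → ∀ i j → Walk (shapeGraph s) i j
shape-connected s pos i j = walk-trans (to-hub s pos i) (walk-sym (to-hub s pos j))
  where
  open Components (shapeGraph s)
  hub : ∀ s → 1 ≤ shapeParam s → Fin (size (shapeGraph s))
  hub (starS m) _ = Fin.zero
  hub (pathS (suc m)) _ = Fin.zero
  descend : ∀ {m} k (i : Fin (suc m)) → toℕ i ≡ k → Walk (path (suc m)) i Fin.zero
  descend zero Fin.zero _ = here
  descend (suc k) (Fin.suc i) eq = step
    (Adjacency.~-sym (path _) {Fin.inject₁ i} {Fin.suc i} (path-adj-suc _ (Fin.inject₁ i) (Fin.suc i) (cong suc (≡.sym (Finₚ.toℕ-inject₁ i)))))
    (descend k (Fin.inject₁ i) (trans (Finₚ.toℕ-inject₁ i) (suc-injective eq)))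
  to-hub : ∀ s pos i → Walk (shapeGraph s) i (hub s pos)
  to-hub (starS m) _ Fin.zero = here
  to-hub (starS m) _ (Fin.suc i) = step refl here
  to-hub (pathS (suc m)) _ i = descend (toℕ i) i refl

module PieceFacts (G : Graph) where
  open Adjacency G

  inPiece? : ∀ (p : SPPiece G) v → Dec (InPiece p v)
  inPiece? p v = Finₚ.any? (λ i → map (emb p) i Finₚ.≟ v)

  pull : ∀ (p : SPPiece G) {i j} → map (emb p) i ~ map (emb p) j → adj (shapeGraph (shape p)) i j ≡ true
  pull p {i} {j} e = trans (≡.sym (pres (emb p) i j)) e

  no-square : ∀ (p : SPPiece G) {a b u v} → InPiece p a → InPiece p b → InPiece p u → InPiece p v → a ≢ b → u ≢ v →
    a ~ u → b ~ u → a ~ v → b ~ v → ⊥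
  no-square p (a , refl) (b , refl) (u , refl) (v , refl) a≢b u≢v au bu av bv =
    shape-no-square (shape p) a b u v (a≢b ∘ cong _) (u≢v ∘ cong _) (pull p au) (pull p bu) (pull p av) (pull p bv)

  no-triangle : ∀ (p : SPPiece G) {a b u} → InPiece p a → InPiece p b → InPiece p u → a ~ b → a ~ u → b ~ u → ⊥
  no-triangle p (a , refl) (b , refl) (u , refl) ab au bu =
    shape-no-triangle (shape p) a b u (pull p ab) (pull p au) (pull p bu)

  -- A discrete intermediate value argument along a walk inside the connected piece. Chosen cuts
  -- show which vertices the piece is forced to contain.
  crossing : ∀ (p : SPPiece G) {Left : V → Set} → Decidable Left → ∀ {u v} → InPiece p u → InPiece p v → Left u → ¬ Left v →
    ∃[ u′ ] ∃[ v′ ] InPiece p u′ × InPiece p v′ × Left u′ × ¬ Left v′ × u′ ~ v′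
  crossing p {Left} left? (i , refl) (j , refl) = along (shape-connected (shape p) (pos p) i j)
    where
    along : ∀ {i j} → Walk (shapeGraph (shape p)) i j → Left (map (emb p) i) → ¬ Left (map (emb p) j) →
      ∃[ u′ ] ∃[ v′ ] InPiece p u′ × InPiece p v′ × Left u′ × ¬ Left v′ × u′ ~ v′
    along here l ¬l = contradiction l ¬l
    along (step {u} {w} e walk) l ¬l with left? (map (emb p) w)
    ... | yes l′ = along walk l′ ¬l
    ... | no ¬l′ = _ , _ , (u , refl) , (w , refl) , l , ¬l′ , trans (pres (emb p) u w) e

  same-piece : ∀ {ps : List (SPPiece G)} → AllPairs Disjoint ps → ∀ {p q v} → p ∈ ps → q ∈ ps → InPiece p v → InPiece q v → p ≡ q
  same-piece (_ ∷ _) (here refl) (here refl) _ _ = refl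
  same-piece (d ∷ _) (here refl) (there q∈) pv qv = contradiction qv (All.lookup d q∈ _ pv)
  same-piece (d ∷ _) (there p∈) (here refl) pv qv = contradiction pv (All.lookup d p∈ _ qv)
  same-piece (_ ∷ ds) (there p∈) (there q∈) pv qv = same-piece ds p∈ q∈ pv qv

  module _ {K} (Q : Fin K → V) (Q-inj : ∀ {i j} → Q i ≡ Q j → i ≡ j)
    (simplicial : ∀ k {u v} → u ~ Q k → v ~ Q k → u ≢ v → u ~ v)
    (far : ∀ {i j u} → i ≢ j → ¬ Q i ~ Q j → u ~ Q i → u ~ Q j → ⊥) where

    -- A simplicial vertex cannot be interior to an induced path, and a path has only two ends. In a
    -- star two of the three would be leaves, non-adjacent with the centre as common neighbour,
    -- against `far`.
    piece-thrice : ∀ (p : SPPiece G) {k₁ k₂ k₃} → k₁ ≢ k₂ → k₁ ≢ k₃ → k₂ ≢ k₃ →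
      InPiece p (Q k₁) → InPiece p (Q k₂) → InPiece p (Q k₃) → ⊥
    piece-thrice record { shape = starS m ; pos = _ ; emb = f } ne₁₂ ne₁₃ ne₂₃ (i₁ , eq₁) (i₂ , eq₂) (i₃ , eq₃) = cases i₁ i₂ i₃ eq₁ eq₂ eq₃
      where
      leaves : ∀ {k l} i j → k ≢ l → map f (Fin.suc i) ≡ Q k → map f (Fin.suc j) ≡ Q l → ⊥
      leaves {k} {l} i j k≢l eq eq′ = far k≢l
        (false⇒≁ (trans (cong₂ (adj G) (≡.sym eq) (≡.sym eq′)) (trans (pres f (Fin.suc i) (Fin.suc j)) (∧-zeroʳ (not (toℕ i ≡ᵇ toℕ j))))))
        (subst (map f Fin.zero ~_) eq (pres f Fin.zero (Fin.suc i))) (subst (map f Fin.zero ~_) eq′ (pres f Fin.zero (Fin.suc j)))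
      cases : ∀ i₁ i₂ i₃ → map f i₁ ≡ Q _ → map f i₂ ≡ Q _ → map f i₃ ≡ Q _ → ⊥
      cases Fin.zero Fin.zero _ e₁ e₂ e₃ = ne₁₂ (Q-inj (trans (≡.sym e₁) e₂))
      cases Fin.zero (Fin.suc _) Fin.zero e₁ e₂ e₃ = ne₁₃ (Q-inj (trans (≡.sym e₁) e₃))
      cases Fin.zero (Fin.suc i) (Fin.suc j) e₁ e₂ e₃ = leaves i j ne₂₃ e₂ e₃
      cases (Fin.suc i) (Fin.suc j) _ e₁ e₂ e₃ = leaves i j ne₁₂ e₁ e₂
      cases (Fin.suc i) Fin.zero (Fin.suc j) e₁ e₂ e₃ = leaves i j ne₁₃ e₁ e₃
      cases (Fin.suc _) Fin.zero Fin.zero e₁ e₂ e₃ = ne₂₃ (Q-inj (trans (≡.sym e₂) e₃))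
    piece-thrice record { shape = pathS m ; pos = _ ; emb = f } {k₁} {k₂} {k₃} ne₁₂ ne₁₃ ne₂₃ (i₁ , eq₁) (i₂ , eq₂) (i₃ , eq₃) =
      cases (end i₁ eq₁) (end i₂ eq₂) (end i₃ eq₃)
      where
      end : ∀ {k} i → map f i ≡ Q k → toℕ i ≡ 0 ⊎ suc (toℕ i) ≡ m
      end {k} i eq = go (toℕ i) refl (suc (toℕ i) ≟ m)
        where
        go : ∀ t → toℕ i ≡ t → Dec (suc (toℕ i) ≡ m) → toℕ i ≡ 0 ⊎ suc (toℕ i) ≡ m
        go zero ti _ = inj₁ ti
        go (suc t) ti (yes last) = inj₂ last
        go (suc t) ti (no ¬last) = contradiction apart (subst (λ b → ¬ b ≡ true) (≡.sym not-adj) λ ())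
          where
          t< : t < m
          t< = <-trans (n<1+n t) (subst (_< m) ti (Finₚ.toℕ<n i))
          t+2< : 2 + t < m
          t+2< = ≤∧≢⇒< (subst (_< m) ti (Finₚ.toℕ<n i)) (λ h → ¬last (trans (cong suc ti) h))
          i⁻ i⁺ : Fin m
          i⁻ = fromℕ< t<
          i⁺ = fromℕ< t+2<
          e⁻ : adj (path m) i⁻ i ≡ true
          e⁻ = path-adj-suc m i⁻ i (trans ti (cong suc (≡.sym (Finₚ.toℕ-fromℕ< t<))))
          e⁺ : adj (path m) i⁺ i ≡ true
          e⁺ = Adjacency.~-sym (path m) {i} {i⁺} (path-adj-suc m i i⁺ (trans (Finₚ.toℕ-fromℕ< t+2<) (cong suc (≡.sym ti))))
          distinct : i⁻ ≢ i⁺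
          distinct h = <⇒≢ (<-trans (n<1+n t) (n<1+n (suc t))) (trans (≡.sym (Finₚ.toℕ-fromℕ< t<)) (trans (cong toℕ h) (Finₚ.toℕ-fromℕ< t+2<)))
          apart : adj (path m) i⁻ i⁺ ≡ true
          apart = trans (≡.sym (pres f i⁻ i⁺)) (simplicial k
            (subst (map f i⁻ ~_) eq (trans (pres f i⁻ i) e⁻)) (subst (map f i⁺ ~_) eq (trans (pres f i⁺ i) e⁺)) (distinct ∘ inj f))
          not-adj : adj (path m) i⁻ i⁺ ≡ false
          not-adj = Adjacency.≁⇒false (path m) {i⁻} {i⁺} λ e → impossible (path-adj⇒ m i⁻ i⁺ e)
            where
            impossible : Consecutive (toℕ i⁻) (toℕ i⁺) → ⊥
            impossible rewrite Finₚ.toℕ-fromℕ< t< | Finₚ.toℕ-fromℕ< t+2< =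
              [ (λ h → 1+n≢n (suc-injective h)) , (λ h → <⇒≢ (≤-trans (n<1+n t) (m≤n+m (suc t) 2)) h) ]′
      same : ∀ {k l} i j → map f i ≡ Q k → map f j ≡ Q l → toℕ i ≡ toℕ j → k ≡ l
      same i j eq eq′ h = Q-inj (trans (≡.sym eq) (trans (cong (map f) (Finₚ.toℕ-injective h)) eq′))
      cases : toℕ i₁ ≡ 0 ⊎ suc (toℕ i₁) ≡ m → toℕ i₂ ≡ 0 ⊎ suc (toℕ i₂) ≡ m → toℕ i₃ ≡ 0 ⊎ suc (toℕ i₃) ≡ m → ⊥
      cases (inj₁ a) (inj₁ b) _ = ne₁₂ (same i₁ i₂ eq₁ eq₂ (trans a (≡.sym b)))
      cases (inj₂ a) (inj₂ b) _ = ne₁₂ (same i₁ i₂ eq₁ eq₂ (suc-injective (trans a (≡.sym b))))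
      cases (inj₁ a) (inj₂ b) (inj₁ c) = ne₁₃ (same i₁ i₃ eq₁ eq₃ (trans a (≡.sym c)))
      cases (inj₁ a) (inj₂ b) (inj₂ c) = ne₂₃ (same i₂ i₃ eq₂ eq₃ (suc-injective (trans b (≡.sym c))))
      cases (inj₂ a) (inj₁ b) (inj₁ c) = ne₂₃ (same i₂ i₃ eq₂ eq₃ (trans b (≡.sym c)))
      cases (inj₂ a) (inj₁ b) (inj₂ c) = ne₁₃ (same i₁ i₃ eq₁ eq₃ (suc-injective (trans a (≡.sym c))))

    -- The applications take for Q all vertices of a complete graph, the far ends of S*, the pendant
    -- vertices of the chain for F1 and the bag vertices of the chain for F2.
    simplicial-uncoverable : ∀ {c} → c * 2 < K → ¬ inspc≤ G c
    simplicial-uncoverable big (ps , few , cov) with few-bad (λ p k → inPiece? p (Q k))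
        (λ p {k₁} {k₂} {k₃} lt lt′ → piece-thrice p (Finₚ.<⇒≢ lt) (Finₚ.<⇒≢ (Finₚ.<-trans {i = k₁} {k₂} {k₃} lt lt′)) (Finₚ.<⇒≢ lt′))
        ps (≤-<-trans (*-monoˡ-≤ 2 few) big)
    ... | k , none = Allₚ.All¬⇒¬Any none (cov (Q k))

-- Chains of gadgets

y-injective : ∀ {i j} → y i ≡ y j → i ≡ j
y-injective refl = refl

z-injective : ∀ {i j} → z i ≡ z j → i ≡ j
z-injective refl = refl

data Site : Set where
  sp hang : ℕ → ℕ → Site

-- n blocks, each a spine path sp k 0, …, sp k (n ∸ 1); the bag hang k 0, …, hang k (B ∸ 1)
-- sits between the last spine vertex of block k ∸ 1 and the first of block k, so that
-- every window of the chain shorter than a block looks like `gadget γ δ η`.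
module Chain (n B : ℕ) (γ δ η : Bool) where

  next : ℕ → ℕ → ℕ → ℕ → Bool
  next k t k′ t′ = ((k ≡ᵇ k′) ∧ (t′ ≡ᵇ suc t)) ∨ (η ∧ ((suc k ≡ᵇ k′) ∧ ((suc t ≡ᵇ n) ∧ (t′ ≡ᵇ 0))))

  hook : ℕ → ℕ → ℕ → ℕ → Bool
  hook k i k′ t = (δ ∨ (i ≡ᵇ 0)) ∧ (((k′ ≡ᵇ k) ∧ (t ≡ᵇ 0)) ∨ ((suc k′ ≡ᵇ k) ∧ (suc t ≡ᵇ n)))

  link : Site → Site → Bool
  link (hang k i) (hang k′ j) = (k ≡ᵇ k′) ∧ γ
  link (hang k i) (sp k′ t)   = hook k i k′ t
  link (sp k′ t)  (hang k i)  = hook k i k′ t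
  link (sp k t)   (sp k′ t′)  = next k t k′ t′ ∨ next k′ t′ k t

  link-sym : ∀ s s′ → link s s′ ≡ link s′ s
  link-sym (hang k i) (hang k′ j) = cong (_∧ γ) (≡ᵇ-sym k k′)
  link-sym (hang k i) (sp k′ t)   = refl
  link-sym (sp k′ t)  (hang k i)  = refl
  link-sym (sp k t)   (sp k′ t′)  = ∨-comm (next k t k′ t′) (next k′ t′ k t)

  spine-site : Fin (n * n) → Site
  spine-site a = let (k , t) = Fin.remQuot {n} n a in sp (toℕ k) (toℕ t)

  hang-site : Fin (n * B) → Site
  hang-site a = let (k , i) = Fin.remQuot {n} B a in hang (toℕ k) (toℕ i)

  site : Fin (n * n + n * B) → Site
  site a = [ spine-site , hang-site ]′ (Fin.splitAt (n * n) a)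

  chain : Graph
  chain = record
    { size   = n * n + n * B
    ; adj    = λ a b → not (toℕ a ≡ᵇ toℕ b) ∧ link (site a) (site b)
    ; sym    = λ a b → cong₂ (λ p q → not p ∧ q) (≡ᵇ-sym (toℕ a) (toℕ b)) (link-sym (site a) (site b))
    ; irrefl = λ a → cong (λ p → not p ∧ link (site a) (site a)) (≡ᵇ-refl (toℕ a)) }

  open Adjacency chain

  data ValidSite : Site → Set where
    vs : ∀ {k t} → k < n → t < n → ValidSite (sp k t)
    vh : ∀ {k i} → k < n → i < B → ValidSite (hang k i)

  at : ∀ {s} → ValidSite s → V
  at (vs k< t<) = Fin.combine (fromℕ< k<) (fromℕ< t<) Fin.↑ˡ (n * B)
  at (vh k< i<) = (n * n) Fin.↑ʳ Fin.combine (fromℕ< k<) (fromℕ< i<)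

  site-at : ∀ {s} (v : ValidSite s) → site (at v) ≡ s
  site-at (vs k< t<) = trans (cong [ spine-site , hang-site ]′ (Finₚ.splitAt-↑ˡ (n * n) (Fin.combine (fromℕ< k<) (fromℕ< t<)) (n * B)))
    (trans (cong (λ (k , t) → sp (toℕ k) (toℕ t)) (Finₚ.remQuot-combine (fromℕ< k<) (fromℕ< t<)))
      (cong₂ sp (Finₚ.toℕ-fromℕ< k<) (Finₚ.toℕ-fromℕ< t<)))
  site-at (vh k< i<) = trans (cong [ spine-site , hang-site ]′ (Finₚ.splitAt-↑ʳ (n * n) (n * B) (Fin.combine (fromℕ< k<) (fromℕ< i<))))
    (trans (cong (λ (k , i) → hang (toℕ k) (toℕ i)) (Finₚ.remQuot-combine (fromℕ< k<) (fromℕ< i<)))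
      (cong₂ hang (Finₚ.toℕ-fromℕ< k<) (Finₚ.toℕ-fromℕ< i<)))

  located : ∀ a → Σ Site λ s → Σ (ValidSite s) λ v → at v ≡ a
  located a = subst (λ b → Σ Site λ s → Σ (ValidSite s) λ v → at v ≡ b) (Finₚ.join-splitAt (n * n) (n * B) a)
    (split (Fin.splitAt (n * n) a))
    where
    split : ∀ c → Σ Site λ s → Σ (ValidSite s) λ v → at v ≡ Fin.join (n * n) (n * B) c
    split (inj₁ c) = _ , vs (Finₚ.toℕ<n (proj₁ (Fin.remQuot {n} n c))) (Finₚ.toℕ<n (proj₂ (Fin.remQuot {n} n c)))
      , cong (Fin._↑ˡ (n * B)) (trans (cong₂ (Fin.combine {n} {n}) (Finₚ.fromℕ<-toℕ _ _) (Finₚ.fromℕ<-toℕ _ _)) (Finₚ.combine-remQuot {n} n c))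
    split (inj₂ c) = _ , vh (Finₚ.toℕ<n (proj₁ (Fin.remQuot {n} B c))) (Finₚ.toℕ<n (proj₂ (Fin.remQuot {n} B c)))
      , cong ((n * n) Fin.↑ʳ_) (trans (cong₂ (Fin.combine {n} {B}) (Finₚ.fromℕ<-toℕ _ _) (Finₚ.fromℕ<-toℕ _ _)) (Finₚ.combine-remQuot {n} B c))

  at-unique : ∀ {s} (v w : ValidSite s) → at v ≡ at w
  at-unique (vs _ _) (vs _ _) = refl
  at-unique (vh _ _) (vh _ _) = refl

  site-valid : ∀ a → ValidSite (site a)
  site-valid a with located a
  ... | s , v , refl = subst ValidSite (≡.sym (site-at v)) v

  at-site : ∀ {s a} (v : ValidSite s) → site a ≡ s → a ≡ at v
  at-site {a = a} v eq with located a
  ... | s′ , v′ , refl with trans (≡.sym (site-at v′)) eq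
  ...   | refl = at-unique v′ v

  site-injective : ∀ {a b} → site a ≡ site b → a ≡ b
  site-injective {a} {b} eq = trans (at-site (site-valid b) eq) (≡.sym (at-site (site-valid b) refl))

  adj-link : ∀ {a b} → a ≢ b → adj chain a b ≡ link (site a) (site b)
  adj-link ne rewrite ≡ᵇ-false (ne ∘ Finₚ.toℕ-injective) = refl

  -- `link` oriented so that `position` never decreases, with one constructor per kind of edge.
  data Edge : Site → Site → Set where
    along : ∀ {k t} → Edge (sp k t) (sp k (suc t))
    jump  : ∀ {k t} → η ≡ true → suc t ≡ n → Edge (sp k t) (sp (suc k) 0)
    right : ∀ {k i} → (δ ∨ (i ≡ᵇ 0)) ≡ true → Edge (hang k i) (sp k 0)
    left  : ∀ {k t i} → (δ ∨ (i ≡ᵇ 0)) ≡ true → suc t ≡ n → Edge (sp k t) (hang (suc k) i)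
    mates : ∀ {k i j} → γ ≡ true → Edge (hang k i) (hang k j)

  edge-link : ∀ {s s′} → Edge s s′ → link s s′ ≡ true
  edge-link (along {k} {t}) rewrite ≡ᵇ-refl k | ≡ᵇ-refl t = refl
  edge-link (jump {k} {t} eq refl) rewrite eq | ≡ᵇ-false {k} {suc k} (1+n≢n ∘ ≡.sym) | ≡ᵇ-refl k | ≡ᵇ-refl t = refl
  edge-link (right {k} eq) rewrite eq | ≡ᵇ-refl k = refl
  edge-link (left {k} {t} eq refl) rewrite eq | ≡ᵇ-refl k | ≡ᵇ-refl t = ∨-zeroʳ _
  edge-link (mates {k} eq) rewrite eq | ≡ᵇ-refl k = refl

  ∧-true : ∀ {a b} → a ∧ b ≡ true → a ≡ true × b ≡ true
  ∧-true {true} eq = refl , eq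

  ∨-true : ∀ {a b} → a ∨ b ≡ true → a ≡ true ⊎ b ≡ true
  ∨-true {true} eq = inj₁ refl
  ∨-true {false} eq = inj₂ eq

  next-edge : ∀ {k t k′ t′} → next k t k′ t′ ≡ true → Edge (sp k t) (sp k′ t′)
  next-edge {k} {t} {k′} {t′} eq with ∨-true eq
  ... | inj₁ h with ∧-true h
  ...   | p , q with true⇒≡ {k} {k′} p | true⇒≡ {t′} {suc t} q
  ...     | refl | refl = along
  next-edge {k} {t} {k′} {t′} eq | inj₂ h with ∧-true {η} h
  ...   | η≡ , h′ with ∧-true {suc k ≡ᵇ k′} h′
  ...     | p , h″ with ∧-true {suc t ≡ᵇ n} h″
  ...       | q , r with true⇒≡ {suc k} {k′} p | true⇒≡ {t′} {0} r
  ...         | refl | refl = jump η≡ (true⇒≡ q)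

  hook-edge : ∀ {k i k′ t} → hook k i k′ t ≡ true → Edge (hang k i) (sp k′ t) ⊎ Edge (sp k′ t) (hang k i)
  hook-edge {k} {i} {k′} {t} eq with ∧-true {δ ∨ (i ≡ᵇ 0)} eq
  ... | d , h with ∨-true h
  ...   | inj₁ h′ with ∧-true {k′ ≡ᵇ k} h′
  ...     | p , q with true⇒≡ {k′} {k} p | true⇒≡ {t} {0} q
  ...       | refl | refl = inj₁ (right d)
  hook-edge {k} {i} {k′} {t} eq | d , h | inj₂ h′ with ∧-true {suc k′ ≡ᵇ k} h′
  ...     | p , q with true⇒≡ {suc k′} {k} p
  ...       | refl = inj₂ (left d (true⇒≡ q))

  link-edge : ∀ s s′ → link s s′ ≡ true → Edge s s′ ⊎ Edge s′ s
  link-edge (hang k i) (hang k′ j) eq with ∧-true {k ≡ᵇ k′} eq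
  ... | p , q with true⇒≡ {k} {k′} p
  ...   | refl = inj₁ (mates q)
  link-edge (hang k i) (sp k′ t) eq = hook-edge eq
  link-edge (sp k′ t) (hang k i) eq = [ inj₂ , inj₁ ]′ (hook-edge eq)
  link-edge (sp k t) (sp k′ t′) eq = Sum.map next-edge next-edge (∨-true eq)

  ~⇒edge : ∀ {a b} → a ~ b → Edge (site a) (site b) ⊎ Edge (site b) (site a)
  ~⇒edge {a} {b} e = link-edge (site a) (site b) (trans (≡.sym (adj-link (~⇒≢ e))) e)

  edge⇒~ : ∀ {s s′} (v : ValidSite s) (v′ : ValidSite s′) → s ≢ s′ → Edge s s′ → at v ~ at v′
  edge⇒~ v v′ ne e = trans (adj-link (λ eq → ne (trans (≡.sym (site-at v)) (trans (cong site eq) (site-at v′)))))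
    (trans (cong₂ link (site-at v) (site-at v′)) (edge-link e))

  -- A bag shares the position of the first vertex of its block, so an edge changes the position by
  -- at most one.
  position : Site → ℕ
  position (sp k t)   = k * n + t
  position (hang k i) = k * n

  edge-position : ∀ {s s′} → Edge s s′ → position s ≤ position s′ × position s′ ≤ suc (position s)
  edge-position (along {k} {t}) = +-monoʳ-≤ (k * n) (n≤1+n t) , ≤-reflexive (+-suc (k * n) t)
  edge-position (jump {k} {t} _ refl) = <⇒≤ (≤-reflexive (lemma k t)) , ≤-reflexive (≡.sym (lemma k t))
    where
    lemma : ∀ k t → suc (k * suc t + t) ≡ suc (t + k * suc t) + 0
    lemma k t = trans (cong suc (+-comm (k * suc t) t)) (≡.sym (+-identityʳ _))
  edge-position (right {k} _) = ≤-reflexive (≡.sym (+-identityʳ (k * n))) , ≤-trans (≤-reflexive (+-identityʳ (k * n))) (n≤1+n _)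
  edge-position (left {k} {t} _ refl) = <⇒≤ (≤-reflexive (cong suc (+-comm (k * suc t) t))) , ≤-reflexive (cong suc (+-comm t (k * suc t)))
  edge-position (mates _) = ≤-refl , n≤1+n _

  block-< : ∀ {k k′ t} → k < k′ → t < n → k * n + t < k′ * n
  block-< {k} {k′} {t} k<k′ t< = ≤-trans (+-monoʳ-< (k * n) t<) (≤-trans (≤-reflexive (+-comm (k * n) n)) (*-monoˡ-≤ n k<k′))

  chain-connected : 1 < n → 0 < B → (δ ≡ true ⊎ γ ≡ true) → Connected chain
  chain-connected 1<n 0<B reach = subst (0 <_) refl (≤-trans (s≤s z≤n) (Finₚ.toℕ<n root))
    , λ u v → walk-trans (to-root u) (walk-sym (to-root v))
    where
    open Components chain
    0<n : 0 < n
    0<n = <⇒≤ 1<n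
    root : V
    root = at (vs 0<n 0<n)
    n-1 : ∃[ t ] suc t ≡ n
    n-1 = pred n , suc-pred-pos 0<n
    spine : ∀ k (k< : k < n) t (t< : t < n) → Walk chain (at (vs k< t<)) root
    spine zero k< zero t< = subst (λ v → Walk chain v root) (at-unique (vs 0<n 0<n) (vs k< t<)) here
    spine (suc k) k< zero t< = step (~-sym (edge⇒~ (vh k< 0<B) (vs k< t<) (λ ()) (right (∨-zeroʳ δ))))
      (step (~-sym (edge⇒~ (vs (<⇒≤ k<) (≤-reflexive (proj₂ n-1))) (vh k< 0<B) (λ ()) (left (∨-zeroʳ δ) (proj₂ n-1))))
        (spine k (<⇒≤ k<) (proj₁ n-1) (≤-reflexive (proj₂ n-1))))
    spine k k< (suc t) t< = step (~-sym (edge⇒~ (vs k< (<⇒≤ t<)) (vs k< t<) (λ ()) along)) (spine k k< t (<⇒≤ t<))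
    hanging : ∀ k (k< : k < n) i (i< : i < B) → Walk chain (at (vh k< i<)) root
    hanging k k< zero i< = step (edge⇒~ (vh k< i<) (vs k< 0<n) (λ ()) (right (∨-zeroʳ δ))) (spine k k< 0 0<n)
    hanging k k< (suc i) i< = by reach
      where
      by : δ ≡ true ⊎ γ ≡ true → Walk chain (at (vh k< i<)) root
      by (inj₁ eq) = step (edge⇒~ (vh k< i<) (vs k< 0<n) (λ ()) (right (cong (_∨ false) eq))) (spine k k< 0 0<n)
      by (inj₂ eq) = step (edge⇒~ (vh k< i<) (vh k< 0<B) (λ ()) (mates eq)) (hanging k k< 0 0<B)
    to-root : ∀ v → Walk chain v root
    to-root v with located v
    ... | _ , vs k< t< , refl = spine _ k< _ t<
    ... | _ , vh k< i< , refl = hanging _ k< _ i<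

  -- The surroundings of bag k, read as a gadget: block k - 1 backwards gives the y's and block k
  -- the z's.
  data Window : ℕ → Site → Set where
    wx : ∀ {k i} → i < B → Window k (hang k i)
    wy : ∀ {k t} → t < n → Window (suc k) (sp k t)
    wz : ∀ {k t} → t < n → Window k (sp k t)

  vtx : ∀ {k s} → Window k s → Vtx
  vtx (wx {i = i} _) = x (suc i)
  vtx (wy {t = t} _) = y (n ∸ t)
  vtx (wz {t = t} _) = z (suc t)

  n∸ : ∀ {t} → t < n → n ∸ t ≡ suc (n ∸ suc t)
  n∸ t< = +-∸-assoc 1 t<

  vtx-valid : ∀ {k s} (w : Window k s) → Valid B n (vtx w)
  vtx-valid (wx i<) = vx i<
  vtx-valid (wy {t = t} t<) = subst (λ l → Valid B n (y l)) (≡.sym (n∸ t<)) (vy (∸-monoʳ-< {o = 0} (s≤s z≤n) t<))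
  vtx-valid (wz t<) = vz t<

  vtx-injective : ∀ {k s s′} (w : Window k s) (w′ : Window k s′) → vtx w ≡ vtx w′ → s ≡ s′
  vtx-injective (wx _) (wx _) refl = refl
  vtx-injective (wy {t = t} t<) (wy {t = t′} t<′) eq = cong (sp _) (∸-cancelˡ-≡ (<⇒≤ t<) (<⇒≤ t<′) (y-injective eq))
  vtx-injective (wz _) (wz _) refl = refl

  link-xy : ∀ k i t → t < n → (δ ∨ (i ≡ᵇ 0)) ∧ (n ∸ t ≡ᵇ 1) ≡ hook (suc k) i k t
  link-xy k i t t< rewrite ≡ᵇ-false {k} {suc k} (1+n≢n ∘ ≡.sym) | ≡ᵇ-refl k = cong ((δ ∨ (i ≡ᵇ 0)) ∧_)
    (≡ᵇ-cong (λ h → trans (+-comm 1 t) (trans (cong (t +_) (≡.sym h)) (m+[n∸m]≡n (<⇒≤ t<)))) (λ { refl → m+n∸n≡m 1 t }))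

  link-xz : ∀ k i t → (δ ∨ (i ≡ᵇ 0)) ∧ (suc t ≡ᵇ 1) ≡ hook k i k t
  link-xz k i t rewrite ≡ᵇ-refl k | ≡ᵇ-false {suc k} {k} 1+n≢n = cong ((δ ∨ (i ≡ᵇ 0)) ∧_) (≡.sym (∨-identityʳ (t ≡ᵇ 0)))

  link-yz : ∀ k t t′ → t < n → η ∧ ((n ∸ t ≡ᵇ 1) ∧ (t′ ≡ᵇ 0)) ≡ next k t (suc k) t′ ∨ next (suc k) t′ k t
  link-yz k t t′ t< rewrite ≡ᵇ-false {k} {suc k} (1+n≢n ∘ ≡.sym) | ≡ᵇ-false {suc k} {k} 1+n≢n
    | ≡ᵇ-false {suc (suc k)} {k} (λ h → <⇒≢ (≤-trans (n<1+n k) (n≤1+n (suc k))) (≡.sym h)) | ≡ᵇ-refl k | ∧-zeroʳ η =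
    trans (cong (λ b → η ∧ (b ∧ (t′ ≡ᵇ 0)))
      (≡ᵇ-cong (λ h → trans (+-comm 1 t) (trans (cong (t +_) (≡.sym h)) (m+[n∸m]≡n (<⇒≤ t<)))) (λ { refl → m+n∸n≡m 1 t })))
      (≡.sym (∨-identityʳ _))

  vtx-link : ∀ {k s s′} (w : Window k s) (w′ : Window k s′) → gadget γ δ η (vtx w) (vtx w′) ≡ link s s′
  vtx-link {k} (wx _) (wx _) rewrite ≡ᵇ-refl k = refl
  vtx-link {suc k} (wx {i = i} _) (wy {t = t} t<) = link-xy k i t t<
  vtx-link {k} (wx {i = i} _) (wz {t = t} t<) = link-xz k i t
  vtx-link {suc k} (wy {t = t} t<) (wx {i = i} _) = link-xy k i t t<
  vtx-link {suc k} (wy {t = t} t<) (wy {t = t′} t<′)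
    rewrite ≡ᵇ-refl k | ≡ᵇ-false {suc k} {k} 1+n≢n | ∧-zeroʳ η | ∨-identityʳ (t′ ≡ᵇ suc t) | ∨-identityʳ (t ≡ᵇ suc t′) =
    trans (∨-comm (n ∸ t′ ≡ᵇ suc (n ∸ t)) _) (cong₂ _∨_ (before t t′ t< t<′) (before t′ t t<′ t<))
    where
    before : ∀ t t′ → t < n → t′ < n → (n ∸ t ≡ᵇ suc (n ∸ t′)) ≡ (t′ ≡ᵇ suc t)
    before t t′ t< t<′ = ≡ᵇ-cong
      (λ h → ≡.sym (+-cancelʳ-≡ (n ∸ t′) (suc t) t′ (trans (≡.sym (+-suc t (n ∸ t′)))
        (trans (cong (t +_) (≡.sym h)) (trans (m+[n∸m]≡n (<⇒≤ t<)) (≡.sym (m+[n∸m]≡n (<⇒≤ t<′))))))))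
      (λ { refl → n∸ t< })
  vtx-link {suc k} (wy {t = t} t<) (wz {t = t′} _) = link-yz k t t′ t<
  vtx-link {k} (wz {t = t} _) (wx {i = i} _) = link-xz k i t
  vtx-link {suc k} (wz {t = t} _) (wy {t = t′} t<′) = trans (link-yz k t′ t t<′) (link-sym (sp k t′) (sp (suc k) t))
  vtx-link {k} (wz {t = t} _) (wz {t = t′} _)
    rewrite ≡ᵇ-refl k | ≡ᵇ-false {suc k} {k} 1+n≢n | ∧-zeroʳ η | ∨-identityʳ (t′ ≡ᵇ suc t) | ∨-identityʳ (t ≡ᵇ suc t′) = refl

  windowed : ∀ k {s} → ValidSite s → k * n < position s + n → position s < k * n + n → Window k s
  windowed k {sp k′ t} (vs k< t<) lo hi with <-cmp k′ k
  ... | tri≈ _ refl _ = wz t<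
  ... | tri> _ _ gt = contradiction hi (≤⇒≯ (≤-trans (≤-trans (≤-reflexive (+-comm (k * n) n)) (*-monoˡ-≤ n gt)) (m≤m+n (k′ * n) t)))
  ... | tri< lt _ _ with suc k′ ≟ k
  ...   | yes refl = wy t<
  ...   | no ne = contradiction lo (≤⇒≯ (≤-trans
            (≤-trans (≤-reflexive (+-comm (k′ * n + t) n)) (+-monoʳ-≤ n (<⇒≤ (block-< {k′} {suc k′} ≤-refl t<)))) (*-monoˡ-≤ n (≤∧≢⇒< lt ne))))
  windowed k {hang k′ i} (vh k< i<) lo hi with <-cmp k′ k
  ... | tri≈ _ refl _ = wx i<
  ... | tri> _ _ gt = contradiction hi (≤⇒≯ (≤-trans (≤-reflexive (+-comm (k * n) n)) (*-monoˡ-≤ n gt)))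
  ... | tri< lt _ _ = contradiction lo (≤⇒≯ (≤-trans (≤-reflexive (+-comm (k′ * n) n)) (*-monoˡ-≤ n lt)))

-- The ancestors of v on levels 0 to lev v are pairwise distinct.
lev-<-size : ∀ {H} (L : Distance.Levelling H) v → Distance.Levelling.lev L v < size H
lev-<-size {H} L v = Finₚ.injective⇒≤ {f = λ (j : Fin (suc (lev v))) → anc v (toℕ j)}
  (λ {i} {j} eq → Finₚ.toℕ-injective (trans (≡.sym (lev-anc v (s≤s⁻¹ (Finₚ.toℕ<n i)))) (trans (cong lev eq) (lev-anc v (s≤s⁻¹ (Finₚ.toℕ<n j))))))
  where
  open Distance.Levelling L
  open LevelPaths H L

module Locality (n B : ℕ) (γ δ η : Bool) {e} (shape : HasShape γ δ η B n e) where
  open Chain n B γ δ η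

  -- An edge moves the position by at most one, so the image of H stays within size H of the image
  -- of the root. Consecutive windows overlap in a whole block; hence an interval of length 2 * size
  -- H < n fits into one window, where the chain agrees with the gadget.
  localize : ∀ H → Connected H → size H * 2 < n → Contains chain H → Contains (vtxGraph B n e) H
  localize H conn small f = Coding.embed-into-vtx B n e H (λ v → vtx (win v)) (λ v → vtx-valid (win v))
      (λ u v eq → inj f (site-injective (vtx-injective (win u) (win v) eq)))
      (λ u v ne → trans (shape (vtx-valid (win u)) (vtx-valid (win v))
            (λ eq → ne (inj f (site-injective (vtx-injective (win u) (win v) eq)))))
          (trans (vtx-link (win u) (win v)) (trans (≡.sym (adj-link (ne ∘ inj f))) (pres f u v))))
    where
    open Adjacency H using (V; _~_)
    open Distance H
    r = fromℕ< (proj₁ conn)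
    L = levelling conn r
    open Levelling L
    N = size H
    P : V → ℕ
    P v = position (site (map f v))
    near : ∀ k v → Within k r v → P v ≤ P r + k × P r ≤ P v + k
    near zero v refl = m≤m+n _ 0 , m≤m+n _ 0
    near (suc k) v (inj₁ w) = let (a , b) = near k v w in
      ≤-trans a (+-monoʳ-≤ (P r) (n≤1+n k)) , ≤-trans b (+-monoʳ-≤ (P v) (n≤1+n k))
    near (suc k) v (inj₂ (u , w , e)) = let (a , b) = near k u w ; (c , d) = close (~⇒edge (trans (pres f u v) e)) in
      ≤-trans c (≤-trans (s≤s a) (≤-reflexive (≡.sym (+-suc (P r) k)))) ,
      ≤-trans b (≤-trans (+-monoˡ-≤ k d) (≤-reflexive (≡.sym (+-suc (P v) k))))
      where
      close : ∀ {s s′} → Edge s s′ ⊎ Edge s′ s → position s′ ≤ suc (position s) × position s ≤ suc (position s′)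
      close (inj₁ e) = let (p , q) = edge-position e in q , m≤n⇒m≤1+n p
      close (inj₂ e) = let (p , q) = edge-position e in m≤n⇒m≤1+n p , q
    bounds : ∀ v → P v ≤ P r + N × P r ≤ P v + N
    bounds v = let (a , b) = near (lev v) v (lev-within v) in
      ≤-trans a (+-monoʳ-≤ (P r) (<⇒≤ (lev-<-size L v))) , ≤-trans b (+-monoʳ-≤ (P v) (<⇒≤ (lev-<-size L v)))
    N+N<n : N + N < n
    N+N<n = subst (_< n) (trans (*-comm N 2) (cong (N +_) (+-identityʳ N))) small
    base : ∀ {s} → ValidSite s → ∃[ k ] ∃[ t ] t < n × position s ≡ k * n + t
    base (vs {k} {t} _ t<) = k , t , t< , refl
    base (vh {k} k< _) = k , 0 , ≤-trans (s≤s z≤n) k< , ≡.sym (+-identityʳ (k * n))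
    choose : Σ ℕ λ k → ∀ p → p ≤ P r + N → P r ≤ p + N → k * n < p + n × p < k * n + n
    choose with base (site-valid (map f r))
    ... | k , t , t< , eq with t + N <? n
    ...   | yes fits = k , λ p hi lo →
            ≤-<-trans (≤-trans (m≤m+n (k * n) t) (≤-reflexive (≡.sym eq))) (≤-<-trans lo (+-monoʳ-< p (≤-<-trans (m≤m+n N N) N+N<n)))
            , ≤-<-trans hi (subst (λ q → q + N < k * n + n) (≡.sym eq) (subst (_< k * n + n) (≡.sym (+-assoc (k * n) t N)) (+-monoʳ-< (k * n) fits)))
    -- Now t > N, because t + N ≥ n > N + N. So nothing reaches back before block k, which the
    -- window of bag k + 1 contains.
    ...   | no ¬fits = suc k , λ p hi lo →
            subst (_< p + n) (+-comm (k * n) n) (+-monoˡ-< n (+-cancelʳ-< N (k * n) p (<-≤-trans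
              (+-cancelʳ-< N (k * n + N) (k * n + t) (≤-trans (≤-trans
                 (≤-reflexive (trans (cong suc (+-assoc (k * n) N N)) (≡.sym (+-suc (k * n) (N + N)))))
                 (+-monoʳ-≤ (k * n) (≤-trans N+N<n (≮⇒≥ ¬fits))))
                 (≤-reflexive (≡.sym (+-assoc (k * n) t N)))))
              (≤-trans (≤-reflexive (≡.sym eq)) lo))))
            , ≤-<-trans hi (subst (λ q → q + N < suc k * n + n) (≡.sym eq)
                (≤-<-trans (+-monoˡ-≤ N (<⇒≤ (block-< {k} {suc k} ≤-refl t<))) (+-monoʳ-< (suc k * n) (≤-<-trans (m≤m+n N N) N+N<n))))
    win : ∀ v → Window (proj₁ choose) (site (map f v))
    win v = let (a , b) = bounds v ; (lo , hi) = proj₂ choose (P v) a b in windowed (proj₁ choose) (site-valid (map f v)) lo hi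

-- Graphs without small covers or partitions

module Gadgets (n B : ℕ) (γ : Bool) (1<n : 1 < n) where
  open Chain n B γ true false
  open Adjacency chain
  open PieceFacts chain

  0<n : 0 < n
  0<n = <⇒≤ 1<n

  last-< : pred n < n
  last-< = ≤-reflexive (suc-pred-pos 0<n)

  -- Bag 0 starts the chain and has no block before it, so only the bags from 1 on are gaps.
  gap : Fin (pred n) → ℕ
  gap k = suc (toℕ k)

  gap-< : ∀ k → gap k < n
  gap-< k = ≤-trans (s≤s (Finₚ.toℕ<n k)) last-<

  before after : Fin (pred n) → V
  before k = at (vs (<⇒≤ (gap-< k)) last-<)
  after k = at (vs (gap-< k) 0<n)

  member : Fin (pred n) → ∀ {i} → i < B → V
  member k i< = at (vh (gap-< k) i<)

  before~member : ∀ k {i} (i< : i < B) → before k ~ member k i<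
  before~member k i< = edge⇒~ (vs (<⇒≤ (gap-< k)) last-<) (vh (gap-< k) i<) (λ ()) (left refl (suc-pred-pos 0<n))

  after~member : ∀ k {i} (i< : i < B) → after k ~ member k i<
  after~member k i< = ~-sym (edge⇒~ (vh (gap-< k) i<) (vs (gap-< k) 0<n) (λ ()) (right refl))

  before≢after : ∀ k → before k ≢ after k
  before≢after k eq with trans (≡.sym (site-at (vs (<⇒≤ (gap-< k)) last-<))) (trans (cong site eq) (site-at (vs (gap-< k) 0<n)))
  ... | h = 1+n≢n (≡.sym (block-injective h))
    where
    block-injective : ∀ {a b c d} → sp a b ≡ sp c d → a ≡ c
    block-injective refl = refl

  P : V → ℕ
  P v = position (site v)

  -- A piece that meets three gaps passes through both ends of the middle one.
  through-before : ∀ (p : SPPiece chain) k {u v} → InPiece p u → InPiece p v →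
    P u ≤ toℕ k * n → gap k * n ≤ P v → InPiece p (before k)
  through-before p k {u} {v} pu pv lo hi with crossing p {λ w → P w < toℕ k * n + pred n} (λ w → _ <? _) pu pv
      (≤-<-trans lo (≤-trans (≤-reflexive (+-comm 1 _)) (+-monoʳ-≤ (toℕ k * n) (s≤s⁻¹ (≤-trans 1<n (≤-reflexive (≡.sym (suc-pred-pos 0<n))))))))
      (≤⇒≯ (≤-trans (<⇒≤ (block-< {toℕ k} ≤-refl last-<)) hi))
  ... | u′ , v′ , _ , pv′ , l , ¬l , e = subst (InPiece p) (at-site (vs (<⇒≤ (gap-< k)) last-<) (exact (site-valid v′) here-P)) pv′
    where
    next-to : ∀ {s s′} → Edge s s′ ⊎ Edge s′ s → position s′ ≤ suc (position s)
    next-to (inj₁ e) = proj₂ (edge-position e)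
    next-to (inj₂ e) = m≤n⇒m≤1+n (proj₁ (edge-position e))
    -- An edge gains at most one position, so the crossing lands exactly on the cut. Bags have
    -- multiples of n as positions, which leaves only `before k`.
    here-P : P v′ ≡ toℕ k * n + pred n
    here-P = ≤-antisym (≤-trans (next-to (~⇒edge e)) l) (≮⇒≥ ¬l)
    exact : ∀ {s} → ValidSite s → position s ≡ toℕ k * n + pred n → s ≡ sp (toℕ k) (pred n)
    exact (vs {k′} {t} _ t<) eq with <-cmp k′ (toℕ k)
    ... | tri< lt _ _ = contradiction eq (<⇒≢ (≤-trans (block-< lt t<) (m≤m+n (toℕ k * n) (pred n))))
    ... | tri≈ _ refl _ = cong (sp (toℕ k)) (+-cancelˡ-≡ (toℕ k * n) t (pred n) eq)
    ... | tri> _ _ gt = contradiction (≡.sym eq) (<⇒≢ (≤-trans (block-< gt last-<) (m≤m+n (k′ * n) t)))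
    exact (vh {k′} {i} k< i<) eq with <-cmp k′ (toℕ k)
    ... | tri< lt _ _ = contradiction eq (<⇒≢ (≤-trans (≤-trans (s≤s (≤-reflexive (≡.sym (+-identityʳ (k′ * n))))) (block-< lt 0<n)) (m≤m+n (toℕ k * n) (pred n))))
    ... | tri≈ _ refl _ = contradiction (+-cancelˡ-≡ (toℕ k * n) 0 (pred n) (trans (+-identityʳ (toℕ k * n)) eq))
            (<⇒≢ (s≤s⁻¹ (≤-trans 1<n (≤-reflexive (≡.sym (suc-pred-pos 0<n))))))
    ... | tri> _ _ gt = contradiction (≡.sym eq) (<⇒≢ (block-< gt last-<))

  -- Position alone does not tell `after k` from the bag members. But every edge leading from a
  -- position up to `gap k * n` to a larger one starts at `after k`, since the bag members have no
  -- neighbours further on.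
  through-after : ∀ (p : SPPiece chain) k {u v} → InPiece p u → InPiece p v →
    P u ≤ toℕ k * n → gap k * n < P v → InPiece p (after k)
  through-after p k {u} {v} pu pv lo hi with inPiece? p (after k)
  ... | yes h = h
  ... | no misses with crossing p {λ w → P w ≤ gap k * n} (λ w → _ ≤? _) pu pv
      (≤-trans lo (*-monoˡ-≤ n (n≤1+n (toℕ k)))) (<⇒≱ hi)
  ...   | u′ , v′ , pu′ , _ , l , ¬l , e = ⊥-elim (misses (subst (InPiece p) (at-site (vs (gap-< k) 0<n) (exit (~⇒edge e) refl refl l (≰⇒> ¬l))) pu′))
    where
    beyond : ∀ {k′ t} → t < n → k′ * n + t ≤ gap k * n → gap k * n < k′ * n + suc t → k′ ≡ gap k × t ≡ 0
    beyond {k′} {t} t< lo hi = k≡ , t≡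
      where
      tight : k′ * n + t ≡ gap k * n
      tight = ≤-antisym lo (s≤s⁻¹ (≤-trans hi (≤-reflexive (+-suc (k′ * n) t))))
      k≡ : k′ ≡ gap k
      k≡ with <-cmp k′ (gap k)
      ... | tri< lt _ _ = contradiction tight (<⇒≢ (block-< lt t<))
      ... | tri≈ _ eq _ = eq
      ... | tri> _ _ gt = contradiction (≡.sym tight) (<⇒≢ (≤-trans (≤-trans (s≤s (≤-reflexive (≡.sym (+-identityʳ (gap k * n))))) (block-< gt 0<n)) (m≤m+n (k′ * n) t)))
      t≡ : t ≡ 0
      t≡ = +-cancelˡ-≡ (gap k * n) t 0 (trans (subst (λ l → l * n + t ≡ gap k * n) k≡ tight) (≡.sym (+-identityʳ _)))
    exit : ∀ {s s′} → Edge s s′ ⊎ Edge s′ s → site u′ ≡ s → site v′ ≡ s′ → position s ≤ gap k * n → gap k * n < position s′ → s ≡ sp (gap k) 0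
    exit (inj₁ (along {k′} {t})) eu ev lo hi = let (a , b) = beyond (valid-t (subst ValidSite eu (site-valid u′))) lo hi in cong₂ sp a b
      where
      valid-t : ValidSite (sp k′ t) → t < n
      valid-t (vs _ t<) = t<
    exit (inj₁ (right {k′} _)) eu ev lo hi = contradiction hi (≤⇒≯ (≤-trans (≤-reflexive (+-identityʳ (k′ * n))) lo))
    exit (inj₁ (left {k′} {t} _ eq)) eu ev lo hi = contradiction 1<n (≤⇒≯ (≤-reflexive (trans (≡.sym eq) (cong suc (proj₂
      (beyond {k′} {t} (≤-reflexive eq) lo (subst (gap k * n <_) (trans (+-comm n (k′ * n)) (cong (k′ * n +_) (≡.sym eq))) hi)))))))
    exit (inj₁ (mates _)) eu ev lo hi = contradiction hi (≤⇒≯ lo)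
    exit (inj₂ e) eu ev lo hi = contradiction hi (≤⇒≯ (≤-trans (proj₁ (edge-position e)) lo))

  Meets : SPPiece chain → Fin (pred n) → Set
  Meets p k = Σ (Fin B) λ i → InPiece p (member k (Finₚ.toℕ<n i))

  Through : SPPiece chain → Fin (pred n) → Set
  Through p k = InPiece p (before k) × InPiece p (after k)

  position-member : ∀ k {i} (i< : i < B) → P (member k i<) ≡ gap k * n
  position-member k i< = cong position (site-at (vh (gap-< k) i<))

  through-some-gap : ∀ ps → length ps * 2 < pred n → ∃[ k ] All (λ p → Meets p k → Through p k) ps
  through-some-gap ps big with few-bad {Bad = λ p k → Meets p k × ¬ Through p k}
      (λ p k → Finₚ.any? (λ i → inPiece? p (member k (Finₚ.toℕ<n i))) ×-dec ¬? (inPiece? p (before k) ×-dec inPiece? p (after k))) thrice ps big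
    where
    thrice : ∀ p {k₁ k₂ k₃} → k₁ Fin.< k₂ → k₂ Fin.< k₃ →
      Meets p k₁ × ¬ Through p k₁ → Meets p k₂ × ¬ Through p k₂ → Meets p k₃ × ¬ Through p k₃ → ⊥
    thrice p {k₁} {k₂} {k₃} lt lt′ ((i , m₁) , _) (_ , ¬through) ((j , m₃) , _) = ¬through
      ( through-before p k₂ m₁ m₃ lo (<⇒≤ hi) , through-after p k₂ m₁ m₃ lo hi )
      where
      lo : P (member k₁ (Finₚ.toℕ<n i)) ≤ toℕ k₂ * n
      lo = subst (_≤ toℕ k₂ * n) (≡.sym (position-member k₁ (Finₚ.toℕ<n i))) (*-monoˡ-≤ n lt)
      hi : gap k₂ * n < P (member k₃ (Finₚ.toℕ<n j))
      hi = subst (gap k₂ * n <_) (≡.sym (position-member k₃ (Finₚ.toℕ<n j))) (*-monoˡ-< n {{>-nonZero 0<n}} (s≤s lt′))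
  ... | k , good = k , All.map (λ {p} ¬bad meets → decidable-stable (inPiece? p (before k) ×-dec inPiece? p (after k)) (λ ¬t → ¬bad (meets , ¬t))) good

  member≢ : ∀ k {i j} (i< : i < B) (j< : j < B) → i ≢ j → member k i< ≢ member k j<
  member≢ k i< j< ne eq with trans (≡.sym (site-at (vh (gap-< k) i<))) (trans (cong site eq) (site-at (vh (gap-< k) j<)))
  ... | refl = ne refl

  -- Two members of the bag and the two ends of the gap would form a 4-cycle inside the piece.
  one-member : ∀ p k {i j} (i< : i < B) (j< : j < B) → i ≢ j → Through p k → InPiece p (member k i<) → InPiece p (member k j<) → ⊥
  one-member p k i< j< ne (pa , pb) pi pj = no-square p pa pb pi pj (before≢after k) (member≢ k i< j< ne)
    (before~member k i<) (after~member k i<) (before~member k j<) (after~member k j<)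

  fromℕ-member : ∀ p k {i} (i< : i < B) → InPiece p (member k i<) → Meets p k
  fromℕ-member p k i< h = fromℕ< i< , subst (InPiece p) (at-eq i< (Finₚ.toℕ<n (fromℕ< i<)) (Finₚ.toℕ-fromℕ< i<)) h
    where
    at-eq : ∀ {i j} (i< : i < B) (j< : j < B) → j ≡ i → member k i< ≡ member k j<
    at-eq i< j< refl = at-unique (vh (gap-< k) i<) (vh (gap-< k) j<)

  -- At a gap where every meeting piece passes through, each piece covers at most one member of the
  -- bag, and there are more members than pieces.
  not-coverable : ∀ {c} → c < B → c * 2 < pred n → ¬ inspc≤ chain c
  not-coverable {c} c<B big (ps , few , cov) with through-some-gap ps (≤-<-trans (*-monoˡ-≤ 2 few) big)
  ... | k , good with Finₚ.pigeonhole (≤-<-trans few c<B) (λ i → Any.index (cov (member k (Finₚ.toℕ<n i))))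
  ...   | i , j , i<j , same = one-member p k (Finₚ.toℕ<n i) (Finₚ.toℕ<n j) (<⇒≢ i<j)
            (All.lookup good (∈-lookup (Any.index (cov (member k (Finₚ.toℕ<n i))))) (i , pi)) pi pj
    where
    p = lookup ps (Any.index (cov (member k (Finₚ.toℕ<n i))))
    pi : InPiece p (member k (Finₚ.toℕ<n i))
    pi = Anyₚ.lookup-index (cov (member k (Finₚ.toℕ<n i)))
    pj : InPiece p (member k (Finₚ.toℕ<n j))
    pj = subst (λ l → InPiece (lookup ps l) (member k (Finₚ.toℕ<n j))) (≡.sym same) (Anyₚ.lookup-index (cov (member k (Finₚ.toℕ<n j))))

  -- The pieces of two members of the bag both contain `before k`, so disjointness makes them one
  -- piece.
  not-partitionable : ∀ {c} → 1 < B → c * 2 < pred n → ¬ inspp≤ chain c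
  not-partitionable {c} 1<B big (ps , few , cov , disj) with through-some-gap ps (≤-<-trans (*-monoˡ-≤ 2 few) big)
  ... | k , good with find (cov (member k (<⇒≤ 1<B))) | find (cov (member k 1<B))
  ...   | p , p∈ , p₀ | q , q∈ , q₁ with All.lookup good p∈ (fromℕ-member p k (<⇒≤ 1<B) p₀) | All.lookup good q∈ (fromℕ-member q k 1<B q₁)
  ...     | tp | tq = one-member p k (<⇒≤ 1<B) 1<B (λ ()) tp p₀ (subst (λ r → InPiece r (member k 1<B))
              (≡.sym (same-piece disj p∈ q∈ (proj₁ tp) (proj₁ tq))) q₁)

hang-block : ∀ {k l i j} → hang k i ≡ hang l j → k ≡ l
hang-block refl = refl

-- The pendant vertices x 2 have a single neighbour each, and no two of them share it.
F1-chain-uncoverable : ∀ n {c} → c * 2 < n → ¬ inspc≤ (Chain.chain n 2 true false false) c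
F1-chain-uncoverable n {c} = simplicial-uncoverable Q Q-injective simplicial far
  where
  open Chain n 2 true false false
  open Adjacency chain
  open PieceFacts chain
  Q : Fin n → V
  Q k = at (vh {i = 1} (Finₚ.toℕ<n k) (s≤s (s≤s z≤n)))
  site-Q : ∀ k → site (Q k) ≡ hang (toℕ k) 1
  site-Q k = site-at (vh (Finₚ.toℕ<n k) (s≤s (s≤s z≤n)))
  Q-injective : ∀ {k l} → Q k ≡ Q l → k ≡ l
  Q-injective {k} {l} eq = Finₚ.toℕ-injective (hang-block (trans (≡.sym (site-Q k)) (trans (cong site eq) (site-Q l))))
  nbr : ∀ {u} k → u ~ Q k → site u ≡ hang (toℕ k) 0
  nbr {u} k e = by (site-Q k) (site-valid u) refl (~⇒edge {u} {Q k} e)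
    where
    unhooked : ∀ {l i} → hang l i ≡ hang (toℕ k) 1 → ¬ (i ≡ᵇ 0) ≡ true
    unhooked refl ()
    by : ∀ {s s′} → s′ ≡ hang (toℕ k) 1 → ValidSite s → site u ≡ s → Edge s s′ ⊎ Edge s′ s → s ≡ hang (toℕ k) 0
    by h (vh {i = 0} _ _) eq (inj₁ (mates _)) = cong (λ l → hang l 0) (hang-block h)
    by h (vh {i = 0} _ _) eq (inj₂ (mates _)) = cong (λ l → hang l 0) (hang-block h)
    by h (vh {i = 1} _ _) eq (inj₁ (mates _)) = contradiction (site-injective (trans eq (trans (cong (λ l → hang l 1) (hang-block h)) (≡.sym (site-Q k))))) (~⇒≢ {u} {Q k} e)
    by h (vh {i = 1} _ _) eq (inj₂ (mates _)) = contradiction (site-injective (trans eq (trans (cong (λ l → hang l 1) (hang-block h)) (≡.sym (site-Q k))))) (~⇒≢ {u} {Q k} e)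
    by h (vh {i = suc (suc _)} _ (s≤s (s≤s ()))) eq _
    by h (vs _ _) eq (inj₁ (left hooked _)) = ⊥-elim (unhooked h hooked)
    by h (vs _ _) eq (inj₂ (right hooked)) = ⊥-elim (unhooked h hooked)
  simplicial : ∀ k {u v} → u ~ Q k → v ~ Q k → u ≢ v → u ~ v
  simplicial k e e′ ne = contradiction (site-injective (trans (nbr k e) (≡.sym (nbr k e′)))) ne
  far : ∀ {i j u} → i ≢ j → ¬ Q i ~ Q j → u ~ Q i → u ~ Q j → ⊥
  far {i} {j} ne _ e e′ = ne (Finₚ.toℕ-injective (hang-block (trans (≡.sym (nbr i e)) (nbr j e′))))

-- The neighbours of a bag vertex are the spine vertices on its two sides, which `jump` joins.
-- `1 < n` keeps the two ends of a block different, so that no neighbour is shared.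
F2-chain-uncoverable : ∀ n {c} → 1 < n → c * 2 < n → ¬ inspc≤ (Chain.chain n 1 false true true) c
F2-chain-uncoverable n {c} 1<n = simplicial-uncoverable Q Q-injective simplicial far
  where
  open Chain n 1 false true true
  open Adjacency chain
  open PieceFacts chain
  Q : Fin n → V
  Q k = at (vh {i = 0} (Finₚ.toℕ<n k) (s≤s z≤n))
  site-Q : ∀ k → site (Q k) ≡ hang (toℕ k) 0
  site-Q k = site-at (vh (Finₚ.toℕ<n k) (s≤s z≤n))
  Q-injective : ∀ {k l} → Q k ≡ Q l → k ≡ l
  Q-injective {k} {l} eq = Finₚ.toℕ-injective (hang-block (trans (≡.sym (site-Q k)) (trans (cong site eq) (site-Q l))))
  Side : ℕ → Site → Set
  Side k s = (s ≡ sp k 0) ⊎ (∃[ l ] ∃[ t ] (suc l ≡ k) × (suc t ≡ n) × s ≡ sp l t)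
  nbr : ∀ {u} k → u ~ Q k → Side (toℕ k) (site u)
  nbr {u} k e = by (~⇒edge {u} {Q k} e) (site-Q k)
    where
    by : ∀ {s s′} → Edge s s′ ⊎ Edge s′ s → s′ ≡ hang (toℕ k) 0 → Side (toℕ k) s
    by (inj₁ (left {l} {t} _ eq)) h = inj₂ (l , t , hang-block h , eq , refl)
    by (inj₂ (right _)) refl = inj₁ refl
  joined : ∀ {k s s′ a b} → Side k s → Side k s′ → site a ≡ s → site b ≡ s′ → a ≢ b → a ~ b
  joined (inj₁ refl) (inj₁ refl) ea eb ne = contradiction (site-injective (trans ea (≡.sym eb))) ne
  joined (inj₂ (l , t , refl , refl , refl)) (inj₂ (_ , _ , refl , refl , refl)) ea eb ne = contradiction (site-injective (trans ea (≡.sym eb))) ne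
  joined (inj₂ (l , t , refl , eq , refl)) (inj₁ refl) ea eb ne = trans (adj-link ne) (trans (cong₂ link ea eb) (edge-link (jump {l} {t} refl eq)))
  joined (inj₁ refl) (inj₂ (l , t , refl , eq , refl)) ea eb ne = trans (adj-link ne) (trans (cong₂ link ea eb) (trans (link-sym (sp (suc l) 0) (sp l t)) (edge-link (jump {l} {t} refl eq))))
  simplicial : ∀ k {u v} → u ~ Q k → v ~ Q k → u ≢ v → u ~ v
  simplicial k e e′ = joined (nbr k e) (nbr k e′) refl refl
  clash : ∀ {k l s} → Side k s → Side l s → k ≡ l
  clash (inj₁ refl) (inj₁ refl) = refl
  clash (inj₁ refl) (inj₂ (_ , _ , _ , eq , refl)) = contradiction (≤-reflexive (≡.sym eq)) (<⇒≱ 1<n)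
  clash (inj₂ (_ , _ , _ , eq , refl)) (inj₁ refl) = contradiction (≤-reflexive (≡.sym eq)) (<⇒≱ 1<n)
  clash (inj₂ (_ , _ , refl , _ , refl)) (inj₂ (_ , _ , refl , _ , refl)) = refl
  far : ∀ {i j u} → i ≢ j → ¬ Q i ~ Q j → u ~ Q i → u ~ Q j → ⊥
  far {i} {j} ne _ e e′ = ne (Finₚ.toℕ-injective (clash (nbr i e) (nbr j e′)))

-- Complete graphs and spiders

complete-adj : ∀ n {u v : Fin n} → u ≢ v → adj (complete n) u v ≡ true
complete-adj n ne rewrite ≡ᵇ-false (ne ∘ Finₚ.toℕ-injective) = refl

complete-uncoverable : ∀ n {c} → c * 2 < n → ¬ inspc≤ (complete n) c
complete-uncoverable n = PieceFacts.simplicial-uncoverable (complete n) id id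
  (λ _ _ _ → complete-adj n) (λ ne ¬e _ _ → ¬e (complete-adj n ne))

complete-connected : ∀ n → 0 < n → Connected (complete n)
complete-connected n 0<n = 0<n , walk
  where
  walk : ∀ u v → Walk (complete n) u v
  walk u v with u Finₚ.≟ v
  ... | yes refl = here
  ... | no ne = step (complete-adj n ne) here

-- Common to S* and S~; whether the hub sees the far ends enters only in `uncoverable` and
-- `unpartitionable`.
module Spider (G : Graph) {n : ℕ} (hub : Fin (size G)) (Y Z : Fin n → Fin (size G)) where
  open Adjacency G

  data Spot : V → Set where
    at-hub : Spot hub
    at-Y   : ∀ i → Spot (Y i)
    at-Z   : ∀ i → Spot (Z i)

  module _ (spot : ∀ v → Spot v) (hub~Y : ∀ i → hub ~ Y i) (Y~Z : ∀ i → Y i ~ Z i) (Y~Z⇒ : ∀ {i j} → Y i ~ Z j → i ≡ j)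
    (Y≁Y : ∀ i j → ¬ Y i ~ Y j) (Z≁Z : ∀ i j → ¬ Z i ~ Z j) where
    open PieceFacts G

    spider-connected : Connected G
    spider-connected = ≤-trans (s≤s z≤n) (Finₚ.toℕ<n hub) , λ u v → walk-trans (walk-sym (from-hub u)) (from-hub v)
      where
      open Components G
      from-hub : ∀ v → Walk G hub v
      from-hub v with spot v
      ... | at-hub = here
      ... | at-Y i = step (hub~Y i) here
      ... | at-Z i = step (hub~Y i) (step (Y~Z i) here)

    Z-injective : ∀ {i j} → Z i ≡ Z j → i ≡ j
    Z-injective {i} {j} eq = Y~Z⇒ (subst (Y i ~_) eq (Y~Z i))

    uncoverable : (∀ i → ¬ hub ~ Z i) → ∀ {c} → c * 2 < n → ¬ inspc≤ G c
    uncoverable hub≁Z = simplicial-uncoverable Z Z-injective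
      (λ k eu ev ne → contradiction (trans (nbr k eu) (≡.sym (nbr k ev))) ne)
      (λ {i} {j} ne _ eu ev → ne (Y~Z⇒ (subst (_~ Z j) (nbr i eu) ev)))
      where
      nbr : ∀ {u} k → u ~ Z k → u ≡ Y k
      nbr {u} k h with spot u
      ... | at-hub = contradiction h (hub≁Z k)
      ... | at-Y i = cong Y (Y~Z⇒ h)
      ... | at-Z i = contradiction h (Z≁Z i k)

    Pair : Fin n → V → Set
    Pair k v = v ≡ Y k ⊎ v ≡ Z k

    pair-unique : ∀ {k l v} → Pair k v → Pair l v → k ≡ l
    pair-unique {k} {l} (inj₁ refl) (inj₁ eq) = Y~Z⇒ (subst (_~ Z l) (≡.sym eq) (Y~Z l))
    pair-unique {k} {l} (inj₁ refl) (inj₂ eq) = contradiction (subst (_~ Y l) (≡.sym eq) (~-sym (Y~Z l))) (Y≁Y k l)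
    pair-unique {k} {l} (inj₂ refl) (inj₁ eq) = contradiction (subst (Y k ~_) eq (Y~Z k)) (Y≁Y k l)
    pair-unique (inj₂ refl) (inj₂ eq) = Z-injective eq

    leave-pair : ∀ {k u v} → Pair k u → ¬ Pair k v → u ~ v → v ≡ hub
    leave-pair {k} {u} {v} pu ¬pv h with spot v
    ... | at-hub = refl
    leave-pair {k} (inj₁ refl) ¬pv h | at-Y i = contradiction h (Y≁Y k i)
    leave-pair {k} (inj₂ refl) ¬pv h | at-Y i = contradiction (inj₁ (cong Y (Y~Z⇒ (~-sym h)))) ¬pv
    leave-pair {k} (inj₁ refl) ¬pv h | at-Z i = contradiction (inj₂ (cong Z (≡.sym (Y~Z⇒ h)))) ¬pv
    leave-pair {k} (inj₂ refl) ¬pv h | at-Z i = contradiction h (Z≁Z k i)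

    MissesHub : SPPiece G → Fin n → Set
    MissesHub p k = (InPiece p (Y k) ⊎ InPiece p (Z k)) × ¬ InPiece p hub

    -- Without the hub the legs are separate components, so a connected piece that avoids the hub
    -- stays in one leg.
    misses-once : ∀ p {k l} → k ≢ l → MissesHub p k → MissesHub p l → ⊥
    misses-once p {k} {l} ne (mk , ¬hub) (ml , _) = go (meet mk) (meet ml)
      where
      Met : Fin n → Set
      Met k = ∃[ v ] InPiece p v × Pair k v
      meet : ∀ {k} → InPiece p (Y k) ⊎ InPiece p (Z k) → Met k
      meet (inj₁ h) = _ , h , inj₁ refl
      meet (inj₂ h) = _ , h , inj₂ refl
      go : Met k → Met l → ⊥
      go (u , pu , ku) (v , pv , lv) with crossing p {Pair k} (λ w → (w Finₚ.≟ Y k) ⊎-dec (w Finₚ.≟ Z k)) pu pv ku (λ kv → ne (pair-unique kv lv))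
      ... | u′ , v′ , _ , pv′ , k′ , ¬k′ , h = ¬hub (subst (InPiece p) (leave-pair k′ ¬k′ h) pv′)

    -- On some leg the pieces of both vertices contain the hub. Disjointness makes them one piece,
    -- which then contains a triangle.
    unpartitionable : (∀ i → hub ~ Z i) → ∀ {c} → c * 2 < n → ¬ inspp≤ G c
    unpartitionable hub~Z big (ps , few , cov , disj) with few-bad {Bad = MissesHub}
        (λ p k → (inPiece? p (Y k) ⊎-dec inPiece? p (Z k)) ×-dec ¬? (inPiece? p hub))
        (λ p lt _ b b′ _ → misses-once p (Finₚ.<⇒≢ lt) b b′) ps (≤-<-trans (*-monoˡ-≤ 2 few) big)
    ... | k , good with find (cov (Y k)) | find (cov (Z k))
    ...   | p , p∈ , pY | q , q∈ , qZ = no-triangle p p-hub pY (subst (λ r → InPiece r (Z k)) (≡.sym (same-piece disj p∈ q∈ p-hub q-hub)) qZ)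
              (hub~Y k) (hub~Z k) (Y~Z k)
      where
      p-hub : InPiece p hub
      p-hub = decidable-stable (inPiece? p hub) (λ ¬h → All.lookup good p∈ (inj₁ pY , ¬h))
      q-hub : InPiece q hub
      q-hub = decidable-stable (inPiece? q hub) (λ ¬h → All.lookup good q∈ (inj₂ qZ , ¬h))

module SpiderGraph (n : ℕ) (e : Vtx → Vtx → Bool)
  (xy : ∀ j → e (x 1) (y (suc j)) ∨ e (y (suc j)) (x 1) ≡ true)
  (yy : ∀ i j → e (y (suc i)) (y (suc j)) ∨ e (y (suc j)) (y (suc i)) ≡ false)
  (yz : ∀ i j → e (y (suc i)) (z (suc j)) ∨ e (z (suc j)) (y (suc i)) ≡ (i ≡ᵇ j))
  (zz : ∀ i j → e (z (suc i)) (z (suc j)) ∨ e (z (suc j)) (z (suc i)) ≡ false) where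
  open Coding 1 n

  private
    G = vtxGraph 1 n e

  hub : Fin (size G)
  hub = vertex {x 1} (vx (s≤s z≤n))

  Y Z : Fin n → Fin (size G)
  Y i = vertex (vy (Finₚ.toℕ<n i))
  Z i = vertex (vz (Finₚ.toℕ<n i))

  open Spider G hub Y Z

  adj-vertex : ∀ {u v} (p : Valid 1 n u) (q : Valid 1 n v) → u ≢ v → adj G (vertex p) (vertex q) ≡ e u v ∨ e v u
  adj-vertex p q ne = trans (adj-vtx e (vertex p) (vertex q)
      (λ eq → ne (trans (≡.sym (label-vertex p)) (trans (cong label eq) (label-vertex q)))))
    (cong₂ (λ u v → e u v ∨ e v u) (label-vertex p) (label-vertex q))

  adj-hub-Z : ∀ i → adj G hub (Z i) ≡ e (x 1) (z (suc (toℕ i))) ∨ e (z (suc (toℕ i))) (x 1)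
  adj-hub-Z i = adj-vertex (vx (s≤s z≤n)) (vz (Finₚ.toℕ<n i)) (λ ())

  spot : ∀ v → Spot v
  spot v = by (label-valid v) refl
    where
    same : ∀ {u} (p : Valid 1 n u) → label v ≡ u → vertex p ≡ v
    same p eq = label-inj (trans (label-vertex p) (≡.sym eq))
    by : ∀ {u} → Valid 1 n u → label v ≡ u → Spot v
    by (vx {zero} _) eq = subst Spot (same (vx (s≤s z≤n)) eq) at-hub
    by (vx {suc _} (s≤s ())) eq
    by (vy i<) eq = subst Spot (same (vy (Finₚ.toℕ<n (fromℕ< i<))) (trans eq (cong (λ i → y (suc i)) (≡.sym (Finₚ.toℕ-fromℕ< i<))))) (at-Y (fromℕ< i<))
    by (vz i<) eq = subst Spot (same (vz (Finₚ.toℕ<n (fromℕ< i<))) (trans eq (cong (λ i → z (suc i)) (≡.sym (Finₚ.toℕ-fromℕ< i<))))) (at-Z (fromℕ< i<))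

  hub~Y : ∀ i → adj G hub (Y i) ≡ true
  hub~Y i = trans (adj-vertex (vx (s≤s z≤n)) (vy (Finₚ.toℕ<n i)) (λ ())) (xy (toℕ i))

  adj-Y-Z : ∀ i j → adj G (Y i) (Z j) ≡ (toℕ i ≡ᵇ toℕ j)
  adj-Y-Z i j = trans (adj-vertex (vy (Finₚ.toℕ<n i)) (vz (Finₚ.toℕ<n j)) (λ ())) (yz (toℕ i) (toℕ j))

  Y~Z : ∀ i → adj G (Y i) (Z i) ≡ true
  Y~Z i = trans (adj-Y-Z i i) (≡ᵇ-refl (toℕ i))

  Y~Z⇒ : ∀ {i j} → adj G (Y i) (Z j) ≡ true → i ≡ j
  Y~Z⇒ {i} {j} h = Finₚ.toℕ-injective (true⇒≡ (trans (≡.sym (adj-Y-Z i j)) h))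

  Y≁Y : ∀ i j → ¬ adj G (Y i) (Y j) ≡ true
  Y≁Y i j h with i Finₚ.≟ j
  ... | yes refl = no-loop G (Y i) h
  ... | no ne with () ← trans (≡.sym h) (trans (adj-vertex (vy (Finₚ.toℕ<n i)) (vy (Finₚ.toℕ<n j))
                          (λ eq → ne (Finₚ.toℕ-injective (suc-injective (y-injective eq))))) (yy (toℕ i) (toℕ j)))

  Z≁Z : ∀ i j → ¬ adj G (Z i) (Z j) ≡ true
  Z≁Z i j h with i Finₚ.≟ j
  ... | yes refl = no-loop G (Z i) h
  ... | no ne with () ← trans (≡.sym h) (trans (adj-vertex (vz (Finₚ.toℕ<n i)) (vz (Finₚ.toℕ<n j))
                          (λ eq → ne (Finₚ.toℕ-injective (suc-injective (z-injective eq))))) (zz (toℕ i) (toℕ j)))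

  graph-connected : Connected G
  graph-connected = spider-connected spot hub~Y Y~Z Y~Z⇒ Y≁Y Z≁Z

  graph-uncoverable : (∀ i → adj G hub (Z i) ≡ false) → ∀ {c} → c * 2 < n → ¬ inspc≤ G c
  graph-uncoverable hub≁Z = uncoverable spot hub~Y Y~Z Y~Z⇒ Y≁Y Z≁Z (λ i → Adjacency.false⇒≁ G {hub} {Z i} (hub≁Z i))

  graph-unpartitionable : (∀ i → adj G hub (Z i) ≡ true) → ∀ {c} → c * 2 < n → ¬ inspp≤ G c
  graph-unpartitionable = unpartitionable spot hub~Y Y~Z Y~Z⇒ Y≁Y Z≁Z

module S*-graph (n : ℕ) where
  open SpiderGraph n eS* (λ _ → refl) (λ _ _ → refl) (λ _ _ → ∨-identityʳ _) (λ _ _ → refl)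

  S*-connected : Connected (S* n)
  S*-connected = graph-connected

  S*-uncoverable : ∀ {c} → c * 2 < n → ¬ inspc≤ (S* n) c
  S*-uncoverable = graph-uncoverable adj-hub-Z

module S~-graph (n : ℕ) where
  open SpiderGraph n eS~ (λ _ → refl) (λ _ _ → refl) (λ _ _ → ∨-identityʳ _) (λ _ _ → refl)

  S~-connected : Connected (S~ n)
  S~-connected = graph-connected

  S~-unpartitionable : ∀ {c} → c * 2 < n → ¬ inspp≤ (S~ n) c
  S~-unpartitionable = graph-unpartitionable adj-hub-Z

-- The theorem

avoids : ∀ {ℋ F G} → Free ℋ G → Any (Contains F) ℋ → ¬ Contains G F
avoids free h g = Allₚ.All¬⇒¬Any free (Any.map (Contains-trans g) h)

sufficient-I : ∀ {ℋ n} → ℋ ≼ familyI n → ∀ G → Connected G → Free ℋ G → inspc≤ G (coverBound n)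
sufficient-I {n = n} (k ∷ s ∷ f₁ ∷ f₂ ∷ f₃ ∷ []) G conn free =
  bounded-cover n G conn (avoids free k , avoids free s , avoids free f₁ , avoids free f₂) (avoids free f₃)

sufficient-II : ∀ {ℋ n} → ℋ ≼ familyII n → ∀ G → Connected G → Free ℋ G → inspp≤ G (partitionBound n)
sufficient-II {n = n} (k ∷ s ∷ s~ ∷ f₁ ∷ f₂ ∷ f₄ ∷ f₅ ∷ []) G conn free =
  bounded-partition n G conn (avoids free k , avoids free s , avoids free f₁ , avoids free f₂)
    (avoids free s~) (avoids free f₄) (avoids free f₅)

inspp⇒inspc : ∀ {G c} → inspp≤ G c → inspc≤ G c
inspp⇒inspc (ps , few , cov , _) = ps , few , cov

-- The sum of the sizes, taken as a convenient upper bound for each of them.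
maxSize : List Graph → ℕ
maxSize ℋ = List.foldr (λ H m → size H + m) 0 ℋ

size≤maxSize : ∀ ℋ → All (λ H → size H ≤ maxSize ℋ) ℋ
size≤maxSize [] = []
size≤maxSize (H ∷ ℋ) = m≤m+n (size H) _ ∷ All.map (λ h → ≤-trans h (m≤n+m (maxSize ℋ) (size H))) (size≤maxSize ℋ)

module Necessity (ℋ : List Graph) (conn : All Connected ℋ) (c : ℕ) where

  -- `maxSize ℋ * 2` keeps every member of ℋ inside one window of a chain, and `c * 2` leaves an
  -- unspoiled choice even among the n - 1 gaps. The summand 4 gives `4 ≤ n` and the slack for
  -- strict inequalities.
  n : ℕ
  n = 4 + (maxSize ℋ * 2 + c * 2)

  4≤n : 4 ≤ n
  4≤n = s≤s (s≤s (s≤s (s≤s z≤n)))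

  1<n : 1 < n
  1<n = s≤s (s≤s z≤n)

  2c<pred-n : c * 2 < pred n
  2c<pred-n = s≤s (≤-trans (m≤n+m (c * 2) (maxSize ℋ * 2)) (m≤n+m _ 2))

  2c<n : c * 2 < n
  2c<n = m≤n⇒m≤1+n 2c<pred-n

  c<n : c < n
  c<n = ≤-<-trans (≤-trans (m≤m+n c (c + 0)) (≤-reflexive (*-comm 2 c))) 2c<n

  module Containment (Bounded : Graph → Set) (bounded : ∀ G → Connected G → Free ℋ G → Bounded G) where

    some-contained : ∀ G → Connected G → ¬ Bounded G → Any (Contains G) ℋ
    some-contained G G-conn unbounded with Any.any? (contains? G) ℋ
    ... | yes h = h
    ... | no none = contradiction (bounded G G-conn (Allₚ.¬Any⇒All¬ ℋ none)) unbounded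

    -- The chain, rather than the gadget, defeats the bound; locality carries the member of ℋ found
    -- in it over to the gadget.
    localized : ∀ {B γ δ η e} → HasShape γ δ η B n e → 0 < B → δ ≡ true ⊎ γ ≡ true →
      ¬ Bounded (Chain.chain n B γ δ η) → Any (Contains (vtxGraph B n e)) ℋ
    localized {B} {γ} {δ} {η} {e} shape 0<B reach unbounded =
      go conn (size≤maxSize ℋ) (some-contained _ (Chain.chain-connected n B γ δ η 1<n 0<B reach) unbounded)
      where
      go : ∀ {Hs} → All Connected Hs → All (λ H → size H ≤ maxSize ℋ) Hs → Any (Contains (Chain.chain n B γ δ η)) Hs →
        Any (Contains (vtxGraph B n e)) Hs
      go {H ∷ _} (H-conn ∷ _) (H-small ∷ _) (here f) = here (Locality.localize n B γ δ η {e} shape H H-conn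
        (≤-<-trans (≤-trans (*-monoˡ-≤ 2 H-small) (m≤m+n _ (c * 2))) (m≤n+m _ 3)) f)
      go (_ ∷ conns) (_ ∷ smalls) (there h) = there (go conns smalls h)

  necessary-I : (∀ G → Connected G → Free ℋ G → inspc≤ G c) → ℋ ≼ familyI n
  necessary-I bounded =
      some-contained (complete n) (complete-connected n (<⇒≤ 1<n)) (complete-uncoverable n 2c<n)
    ∷ some-contained (S* n) (S*-graph.S*-connected n) (S*-graph.S*-uncoverable n 2c<n)
    ∷ localized {e = eF1} (F1-shape n) (s≤s z≤n) (inj₂ refl) (F1-chain-uncoverable n 2c<n)
    ∷ localized {e = eF2} (F2-shape n) (s≤s z≤n) (inj₁ refl) (F2-chain-uncoverable n 1<n 2c<n)
    ∷ localized {e = eF3} (F3-shape n n) (<⇒≤ 1<n) (inj₁ refl) (Gadgets.not-coverable n n false 1<n c<n 2c<pred-n)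
    ∷ []
    where
    open Containment (λ G → inspc≤ G c) bounded

  necessary-II : (∀ G → Connected G → Free ℋ G → inspp≤ G c) → ℋ ≼ familyII n
  necessary-II bounded =
      some-contained (complete n) (complete-connected n (<⇒≤ 1<n)) (complete-uncoverable n 2c<n ∘ inspp⇒inspc)
    ∷ some-contained (S* n) (S*-graph.S*-connected n) (S*-graph.S*-uncoverable n 2c<n ∘ inspp⇒inspc)
    ∷ some-contained (S~ n) (S~-graph.S~-connected n) (S~-graph.S~-unpartitionable n 2c<n)
    ∷ localized {e = eF1} (F1-shape n) (s≤s z≤n) (inj₂ refl) (F1-chain-uncoverable n 2c<n ∘ inspp⇒inspc)
    ∷ localized {e = eF2} (F2-shape n) (s≤s z≤n) (inj₁ refl) (F2-chain-uncoverable n 1<n 2c<n ∘ inspp⇒inspc)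
    ∷ localized {e = eF3} (F3-shape 2 n) (s≤s z≤n) (inj₁ refl) (Gadgets.not-partitionable n 2 false 1<n (s≤s (s≤s z≤n)) 2c<pred-n)
    ∷ localized {e = eF5} (F5-shape n) (s≤s z≤n) (inj₁ refl) (Gadgets.not-partitionable n 2 true 1<n (s≤s (s≤s z≤n)) 2c<pred-n)
    ∷ []
    where
    open Containment (λ G → inspp≤ G c) bounded

theorem1p2 : (ℋ : List Graph) → All Connected ℋ →
    ((∃[ c ] (∀ (G : Graph) → Connected G → Free ℋ G → inspc≤ G c))
    ⇔ (∃[ n ] (4 ≤ n) × (ℋ ≼ familyI n)))
    ×
    ((∃[ c ] (∀ (G : Graph) → Connected G → Free ℋ G → inspp≤ G c))
    ⇔ (∃[ n ] (4 ≤ n) × (ℋ ≼ familyII n)))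
theorem1p2 ℋ conn =
    mk⇔ (λ (c , bounded) → let open Necessity ℋ conn c in n , 4≤n , necessary-I bounded)
        (λ (n , _ , ≼I) → coverBound n , sufficient-I {ℋ} {n} ≼I)
  , mk⇔ (λ (c , bounded) → let open Necessity ℋ conn c in n , 4≤n , necessary-II bounded)
        (λ (n , _ , ≼II) → partitionBound n , sufficient-II {ℋ} {n} ≼II)
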